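{- For every $\gamma>2$ there is a polynomial-time $\bigl(\gamma,\frac{2\gamma}{\gamma-2}H_r\bigr)$-approximation algorithm for the $k$-route multiway cut problem with general nonnegative edge costs, where $r$ is the number of terminals and $H_r=1+\frac12+\dots+\frac1r$. That is, given a finite undirected graph $G=(V,E)$ with nonnegative edge costs $\{c_e\}_{e\in E}$, a set $T\subseteq V$ of $r$ terminals and an integer $k\ge1$, the algorithm returns in polynomial time a set $F\subseteq E$ with $\sum_{e\in F}c_e\le\frac{2\gamma}{\gamma-2}H_r\cdot\mathrm{OPT}$ such that $(V,E\setminus F)$ contains at most $\gamma(k-1)$ edge-disjoint paths between every pair of distinct terminals.
   Context: $k$-route multiway cut problem: given a finite undirected graph $G=(V,E)$ with nonnegative edge costs $\{c_e\}_{e\in E}$, a set $T\subseteq V$ of $r$ terminals, and an integer $k\ge1$, find a minimum-cost set $F\subseteq E$ such that $(V,E\setminus F)$ contains at most $k-1$ edge-disjoint paths between every pair of distinct terminals. $\mathrm{OPT}$ denotes the minimum cost. An $(\alpha,\beta)$-approximation is a set $F\subseteq E$ with $\sum_{e\in F}c_e\le\beta\,\mathrm{OPT}$ such that $(V,E\setminus F)$ contains at most $\alpha(k-1)$ edge-disjoint paths between every pair of distinct terminals.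
   Formalization: The parameter γ ranges over the rational numbers greater than 2, and the edge costs are nonnegative rational numbers (given in binary), instead of real numbers. -}

module Defs where

open import Data.Bool.Base using (Bool; true; false; if_then_else_)
open import Data.Fin.Base using (Fin; toℕ)
open import Data.Fin.Subset using (Subset; _∈_; ∁; ∣_∣)
open import Data.Integer.Base using (+_) renaming (∣_∣ to absℤ)
open import Data.List.Base using (List; []; _∷_; allFin)
open import Data.List.Relation.Binary.Disjoint.Propositional using (Disjoint)
open import Data.List.Relation.Unary.Unique.Propositional using (Unique)
open import Data.Nat.Base as ℕ using (ℕ; zero; suc)
open import Data.Nat.Binary.Base using (ℕᵇ; zero; 2[1+_]; 1+[2_]; fromℕ)
open import Data.Product.Base using (_×_; _,_; proj₁; proj₂; Σ-syntax; ∃-syntax)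
open import Data.Rational.Base
  using (ℚ; 0ℚ; ↥_; ↧ₙ_; _/_; _≤_; _<_; _+_; _*_; _-_; -_; NonZero; positive)
open import Data.Rational.Properties using (+-0-commutativeMonoid; pos⇒nonZero; +-monoˡ-<)
open import Data.Sum.Base using (_⊎_)
open import Data.Vec.Base using (lookup; toList)
open import Relation.Binary.PropositionalEquality using (_≡_; _≢_)
open import Relation.Nullary.Decidable using (⌊_⌋)
open import Algebra.Properties.CommutativeMonoid.Sum +-0-commutativeMonoid using (sum)
import Data.Nat.Properties as ℕ

------------------------------------------------------------------------
-- Rational arithmetic

ℕ→ℚ : ℕ → ℚ
ℕ→ℚ n = + n / 1

2ℚ : ℚ
2ℚ = ℕ→ℚ 2

harmonic : ℕ → ℚ
harmonic zero    = 0ℚ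
harmonic (suc n) = harmonic n + (+ 1 / suc n)

γ-2-nonZero : ∀ {γ} → 2ℚ < γ → NonZero (γ - 2ℚ)
γ-2-nonZero {γ} 2<γ = pos⇒nonZero (γ - 2ℚ) {{positive (+-monoˡ-< (- 2ℚ) 2<γ)}}

------------------------------------------------------------------------
-- Graphs and edge-disjoint paths

-- Edges are named by Fin #E, so parallel edges (and loops, which lie on no
-- path) are allowed; the order of the two endpoints carries no meaning.
record Graph : Set where
  field
    #V   : ℕ
    #E   : ℕ
    ends : Fin #E → Fin #V × Fin #V

module _ (G : Graph) where
  open Graph G

  Joins : Fin #E → Fin #V → Fin #V → Set
  Joins e u v = ends e ≡ (u , v) ⊎ ends e ≡ (v , u)

  -- Walks in the spanning subgraph (V , A).
  data Walk (A : Subset #E) : Fin #V → Fin #V → Set where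
    stop : ∀ {u} → Walk A u u
    step : ∀ {u v w} (e : Fin #E) → e ∈ A → Joins e u v → Walk A v w → Walk A u w

  module _ {A : Subset #E} where

    vertices : ∀ {u v} → Walk A u v → List (Fin #V)
    vertices {u} stop           = u ∷ []
    vertices {u} (step _ _ _ w) = u ∷ vertices w

    edges : ∀ {u v} → Walk A u v → List (Fin #E)
    edges stop           = []
    edges (step e _ _ w) = e ∷ edges w

  Path : Subset #E → Fin #V → Fin #V → Set
  Path A s t = Σ[ w ∈ Walk A s t ] Unique (vertices w)

  EdgeDisjoint : ∀ {A s t ℓ} → (Fin ℓ → Path A s t) → Set
  EdgeDisjoint P = ∀ i j → i ≢ j → Disjoint (edges (proj₁ (P i))) (edges (proj₁ (P j)))

  AtMostEdgeDisjointPaths : ℚ → Subset #E → Fin #V → Fin #V → Set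
  AtMostEdgeDisjointPaths x A s t =
    ∀ ℓ (P : Fin ℓ → Path A s t) → EdgeDisjoint P → ℕ→ℚ ℓ ≤ x

------------------------------------------------------------------------
-- k-route multiway cut

record Instance : Set where
  field
    graph : Graph
  open Graph graph public
  field
    cost   : Fin #E → ℚ
    cost≥0 : ∀ e → 0ℚ ≤ cost e
    T      : Subset #V
    k      : ℕ
    k≥1    : 1 ℕ.≤ k

  #terminals : ℕ
  #terminals = ∣ T ∣

module _ (I : Instance) where
  open Instance I

  totalCost : Subset #E → ℚ
  totalCost F = sum (λ e → if lookup F e then cost e else 0ℚ)

  LeavesAtMost : ℚ → Subset #E → Set
  LeavesAtMost x F = ∀ s t → s ∈ T → t ∈ T → s ≢ t →
    AtMostEdgeDisjointPaths graph x (∁ F) s t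

  Feasible : Subset #E → Set
  Feasible = LeavesAtMost (ℕ→ℚ (k ℕ.∸ 1))

  -- The minimum exists: F = E is feasible and there are finitely many F.
  IsOPT : ℚ → Set
  IsOPT opt = (∃[ F ] Feasible F × totalCost F ≡ opt)
            × (∀ F → Feasible F → opt ≤ totalCost F)

  record IsApproximation (α β : ℚ) (F : Subset #E) : Set where
    field
      cost-bound : ∀ opt → IsOPT opt → totalCost F ≤ β * opt
      path-bound : LeavesAtMost (α * ℕ→ℚ (k ℕ.∸ 1)) F

------------------------------------------------------------------------
-- Machine model: Jones's imperative language WHILE, whose only data are
-- binary trees, with its usual step count.  No instruction inspects more than
-- the root of a tree, and trees can be kept in memory as shared graphs, so a
-- running time polynomial in the size of the input is the same as on a Turing
-- machine.

infixr 5 _∙_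
data Tree : Set where
  nil : Tree
  _∙_ : Tree → Tree → Tree

size : Tree → ℕ
size nil     = 1
size (a ∙ b) = suc (size a ℕ.+ size b)

Var : Set
Var = ℕ

data Expr : Set where
  var   : Var → Expr
  nil   : Expr
  cons  : Expr → Expr → Expr
  hd tl : Expr → Expr

infixr 4 _⨾_
infix  5 _≔_
data Cmd : Set where
  _≔_    : Var → Expr → Cmd
  _⨾_    : Cmd → Cmd → Cmd
  ifElse : Expr → Cmd → Cmd → Cmd
  while  : Expr → Cmd → Cmd

Store : Set
Store = Var → Tree

_[_↦_] : Store → Var → Tree → Store
(σ [ x ↦ d ]) y = if ⌊ y ℕ.≟ x ⌋ then d else σ y

head tail : Tree → Tree
head nil     = nil
head (a ∙ _) = a
tail nil     = nil
tail (_ ∙ b) = b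

eval : Expr → Store → Tree
eval (var x)    σ = σ x
eval nil        σ = nil
eval (cons a b) σ = eval a σ ∙ eval b σ
eval (hd a)     σ = head (eval a σ)
eval (tl a)     σ = tail (eval a σ)

exprTime : Expr → ℕ
exprTime (var _)    = 1
exprTime nil        = 1
exprTime (cons a b) = suc (exprTime a ℕ.+ exprTime b)
exprTime (hd a)     = suc (exprTime a)
exprTime (tl a)     = suc (exprTime a)

-- nil counts as false, every other tree as true.
IsTrue : Tree → Set
IsTrue d = d ≢ nil

-- Exec c σ σ′ t : run from σ, the command c halts in σ′ after t steps.
data Exec : Cmd → Store → Store → ℕ → Set where
  assign : ∀ {x a σ} →
    Exec (x ≔ a) σ (σ [ x ↦ eval a σ ]) (suc (exprTime a))
  seq : ∀ {c₁ c₂ σ σ′ σ″ t₁ t₂} →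
    Exec c₁ σ σ′ t₁ → Exec c₂ σ′ σ″ t₂ → Exec (c₁ ⨾ c₂) σ σ″ (t₁ ℕ.+ t₂)
  if-true : ∀ {a c₁ c₂ σ σ′ t} → IsTrue (eval a σ) →
    Exec c₁ σ σ′ t → Exec (ifElse a c₁ c₂) σ σ′ (suc (exprTime a ℕ.+ t))
  if-false : ∀ {a c₁ c₂ σ σ′ t} → eval a σ ≡ nil →
    Exec c₂ σ σ′ t → Exec (ifElse a c₁ c₂) σ σ′ (suc (exprTime a ℕ.+ t))
  while-false : ∀ {a c σ} → eval a σ ≡ nil →
    Exec (while a c) σ σ (suc (exprTime a))
  while-true : ∀ {a c σ σ′ σ″ t₁ t₂} → IsTrue (eval a σ) →
    Exec c σ σ′ t₁ → Exec (while a c) σ′ σ″ t₂ →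
    Exec (while a c) σ σ″ (suc (exprTime a ℕ.+ (t₁ ℕ.+ t₂)))

-- Variable 0 holds the input at the start and the output at the end.
initial : Tree → Store
initial d = (λ _ → nil) [ 0 ↦ d ]

Computes : Cmd → Tree → Tree → ℕ → Set
Computes p input output t = ∃[ σ ] Exec p (initial input) σ t × σ 0 ≡ output

------------------------------------------------------------------------
-- Encoding: every number is written in binary.

encodeBool : Bool → Tree
encodeBool false = nil
encodeBool true  = nil ∙ nil

encodeList : {A : Set} → (A → Tree) → List A → Tree
encodeList f []       = nil
encodeList f (x ∷ xs) = f x ∙ encodeList f xs

encodeℕᵇ : ℕᵇ → Tree
encodeℕᵇ zero     = nil
encodeℕᵇ 2[1+ b ] = encodeBool false ∙ encodeℕᵇ b
encodeℕᵇ 1+[2 b ] = encodeBool true ∙ encodeℕᵇ b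

encodeℕ : ℕ → Tree
encodeℕ n = encodeℕᵇ (fromℕ n)

-- Only used for nonnegative q, so the sign is not recorded.
encodeℚ : ℚ → Tree
encodeℚ q = encodeℕ (absℤ (↥ q)) ∙ encodeℕ (↧ₙ q)

encodeSubset : ∀ {n} → Subset n → Tree
encodeSubset S = encodeList encodeBool (toList S)

-- The number of vertices is the length of the list that encodes T.
encodeInstance : Instance → Tree
encodeInstance I = encodeSubset T ∙ encodeList encodeEdge (allFin #E) ∙ encodeℕ k
  where
  open Instance I
  encodeVertex : Fin #V → Tree
  encodeVertex v = encodeℕ (toℕ v)
  encodeEdge : Fin #E → Tree
  encodeEdge e =
    (encodeVertex (proj₁ (ends e)) ∙ encodeVertex (proj₂ (ends e))) ∙ encodeℚ (cost e)

------------------------------------------------------------------------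
-- Polynomial-time approximation algorithms

-- β is the cost ratio as a function of the number of terminals.
record PolyTimeApproximation (α : ℚ) (β : ℕ → ℚ) : Set where
  field
    program : Cmd
    c d     : ℕ
    correct : ∀ I → ∃[ F ] ∃[ t ]
        Computes program (encodeInstance I) (encodeSubset F) t
      × t ℕ.≤ c ℕ.* size (encodeInstance I) ℕ.^ d ℕ.+ c
      × IsApproximation I α (β (Instance.#terminals I)) F

-- Write γ = p/q and d = p − 2q, let m be the number of edges and
-- K = min (k − 1, m).  While r ≥ 2 terminals are active, one of them is cut
-- off.  For a threshold μ, every cost c is rounded to its level, the least
-- v ≤ N with c ≤ v μ (N if there is none), where N = pm + 2.  A threshold
-- succeeds if some active terminal t has an isolating cut δ S, one with t and
-- no other active terminal in S, for which q · level (δ S) ≤ pKN + N − 1.  At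
-- most γK edges of such a cut have level N; they are kept and the others,
-- which cost at most μ · level (δ S), are removed.  Levels only change at the
-- thresholds μ = c / i with i < N, so the least successful threshold can be
-- found among polynomially many.
--
-- To bound it, let F⋆ be optimal.  By Menger's theorem any two terminals are
-- separated by at most K edges outside F⋆; splitting along such cuts divides
-- the vertices into r parts, one for each active terminal, with at most
-- (r − 1) K edges outside F⋆ between different parts.  Averaging the level of
-- the boundary over the parts, one sees that
-- μ = 2q OPT / r (dKN + (d + q) m + 1) succeeds.  Hence a round with r active
-- terminals costs at most (2γ / (γ − 2)) OPT / r, and these bounds add up to
-- the harmonic number.
--
-- Minimum cuts come from augmenting paths: in a list of arcs, reversing the
-- arcs of a path from s to t lowers the number of arcs leaving any set that
-- contains s but not t by exactly one.
--
-- For the running time, a fold whose accumulator grows by a polynomially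
-- bounded amount at each step is computed by a WHILE program in polynomial
-- time, and the algorithm is a composition of such folds.

{-# OPTIONS --safe #-}
module Submission where

open import Defs
open import Data.Bool.Base using (Bool; true; false; if_then_else_; _∧_; _∨_; not; T)
open import Data.Bool.ListAction using (any; all)
open import Data.Bool.Properties using () renaming (_≟_ to _≟ᵇ_)
open import Data.Empty using (⊥; ⊥-elim)
open import Data.Fin.Base as Fin using (Fin; toℕ)
import Data.Fin.Properties as Fin
import Data.Fin.Subset as Subset
import Data.Integer.Base as ℤ
import Data.Integer.Properties as ℤ
open import Data.List.Base using (List; []; _∷_; _++_; foldr; foldl; map; concatMap; length; filterᵇ; replicate; reverse; allFin; downFrom; tabulate)
import Data.List.Membership.DecPropositional as DecMembership
open import Data.List.Membership.Propositional using (_∈_; _∉_)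
open import Data.List.Membership.Propositional.Properties
import Data.List.Properties as List
open import Data.List.Relation.Binary.Disjoint.Propositional using (Disjoint)
open import Data.List.Relation.Binary.Permutation.Propositional using (_↭_; prep; swap; ↭-refl; ↭-sym; ↭-trans; ↭-reflexive)
import Data.List.Relation.Binary.Permutation.Propositional.Properties as Perm
open import Data.List.Relation.Unary.All as All using (All; []; _∷_)
import Data.List.Relation.Unary.All.Properties as All
open import Data.List.Relation.Unary.AllPairs using ([]; _∷_)
open import Data.List.Relation.Unary.Any using (here; there)
open import Data.List.Relation.Unary.Unique.Propositional using (Unique)
import Data.List.Relation.Unary.Unique.Propositional.Properties as Unique
open import Data.Nat.Base
open import Data.Nat.Binary.Base as Bin using (ℕᵇ)
import Data.Nat.Binary.Properties as Bin
open import Data.Nat.Divisibility using (_∣_)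
open import Data.Nat.DivMod using (_/_; m/n*n≡m)
open import Data.Nat.ListAction using (product)
open import Data.Nat.ListAction.Properties using (∈⇒∣product; product≢0)
open import Data.Nat.Properties
open import Data.Nat.Tactic.RingSolver using (solve-∀)
open import Data.Product.Base using (_×_; _,_; proj₁; proj₂; Σ-syntax; ∃-syntax)
open import Data.Product.Properties using (≡-dec)
open import Data.Rational.Base as ℚ using (ℚ; 0ℚ; 1ℚ; mkℚ; ↥_; ↧ₙ_)
import Data.Rational.Properties as ℚ
import Data.Rational.Solver as ℚ
import Data.Rational.Unnormalised.Base as ℚᵘ
import Data.Rational.Unnormalised.Properties as ℚᵘ
open import Data.Sum.Base using (_⊎_; inj₁; inj₂)
open import Data.Unit.Base using (⊤; tt)
open import Data.Vec.Base as Vec using (lookup; toList)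
import Data.Vec.Properties as Vec
open import Data.Vec.Properties using (lookup⇒[]=)
open import Function.Base using (id)
open import Relation.Binary.PropositionalEquality
open import Relation.Nullary using (Dec; yes; no; contradiction)
open import Relation.Nullary.Decidable using (⌊_⌋; T?; toWitness; fromWitness)
open import Algebra.Properties.CommutativeMonoid.Sum ℚ.+-0-commutativeMonoid using (sum)

-- Polynomials

-- Truncating costs at `N` levels lets one minimum cut bound two quantities at once: a kept edge
-- pays `N`, a removed one its rounded cost. The constants come from fitting the average boundary
-- below the acceptance bound. An edge between two parts lies on two boundaries, so the edges
-- outside F⋆ use up 2qKN of pKN, which is why γ must exceed 2; rounding uses up qm, and what
-- remains pays for F⋆ and fixes the threshold. The excess N - 1 is free, being too small for one
-- more kept edge.
--
-- Large numbers are the other obstacle. Since k may be exponential, it is capped, so that levels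
-- and networks can be unary. Costs cannot: programs compare thresholds by cross multiplication in
-- binary, while the analysis counts costs in units of 1 / D for a common denominator D that no
-- program computes.
--
-- In WHILE, `cons` can double a tree in constant time, so running time does not bound size; every
-- program carries a size bound for its result as well.
--
-- The cuts found do not depend on F⋆. The analysis is used twice: against the removal of all edges
-- for the path bound, and against an optimum for the cost bound.

infixl 6 _⊞_
infixl 7 _⊠_
data Poly : Set where
  con     : ℕ → Poly
  arg     : Poly
  _⊞_ _⊠_ : Poly → Poly → Poly

at : Poly → ℕ → ℕ
at (con c) n = c
at arg       n = n
at (p ⊞ q) n = at p n + at q n
at (p ⊠ q) n = at p n * at q n

at-mono : ∀ p {m n} → m ≤ n → at p m ≤ at p n
at-mono (con c) m≤n = ≤-refl
at-mono arg       m≤n = m≤n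
at-mono (p ⊞ q) m≤n = +-mono-≤ (at-mono p m≤n) (at-mono q m≤n)
at-mono (p ⊠ q) m≤n = *-mono-≤ (at-mono p m≤n) (at-mono q m≤n)

infixl 8 _⟪_⟫
_⟪_⟫ : Poly → Poly → Poly
con c   ⟪ r ⟫ = con c
arg       ⟪ r ⟫ = r
(p ⊞ q) ⟪ r ⟫ = (p ⟪ r ⟫) ⊞ (q ⟪ r ⟫)
(p ⊠ q) ⟪ r ⟫ = (p ⟪ r ⟫) ⊠ (q ⟪ r ⟫)

at-⟪⟫ : ∀ p r n → at (p ⟪ r ⟫) n ≡ at p (at r n)
at-⟪⟫ (con c) r n = refl
at-⟪⟫ arg       r n = refl
at-⟪⟫ (p ⊞ q) r n = cong₂ _+_ (at-⟪⟫ p r n) (at-⟪⟫ q r n)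
at-⟪⟫ (p ⊠ q) r n = cong₂ _*_ (at-⟪⟫ p r n) (at-⟪⟫ q r n)

at-comp : ∀ p r {m n} → m ≤ at r n → at p m ≤ at (p ⟪ r ⟫) n
at-comp p r {m} {n} m≤ = subst (at p m ≤_) (sym (at-⟪⟫ p r n)) (at-mono p m≤)

-- The degree of a sum is bounded by the sum of the degrees instead of their maximum; for arguments
-- at least 1 larger exponents only help.
coeff degree : Poly → ℕ
coeff (con c) = c
coeff arg       = 1
coeff (p ⊞ q) = coeff p + coeff q
coeff (p ⊠ q) = coeff p * coeff q
degree (con c) = 0
degree arg       = 1
degree (p ⊞ q) = degree p + degree q
degree (p ⊠ q) = degree p + degree q

at≤monomial : ∀ p n .{{_ : NonZero n}} → at p n ≤ coeff p * n ^ degree p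
at≤monomial (con c) n = ≤-reflexive (sym (*-identityʳ c))
at≤monomial arg       n = ≤-reflexive (sym (trans (*-identityˡ (n ^ 1)) (^-identityʳ n)))
at≤monomial (p ⊞ q) n = begin
  at p n + at q n ≤⟨ +-mono-≤ (at≤monomial p n) (at≤monomial q n) ⟩
  coeff p * n ^ degree p + coeff q * n ^ degree q ≤⟨ +-mono-≤ (*-monoʳ-≤ (coeff p) (^-monoʳ-≤ n (m≤m+n (degree p) (degree q))))
                                                                  (*-monoʳ-≤ (coeff q) (^-monoʳ-≤ n (m≤n+m (degree q) (degree p)))) ⟩
  coeff p * n ^ d + coeff q * n ^ d ≡⟨ *-distribʳ-+ (n ^ d) (coeff p) (coeff q) ⟨
  (coeff p + coeff q) * n ^ d ∎
  where
  open ≤-Reasoning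
  d = degree p + degree q
at≤monomial (p ⊠ q) n = begin
  at p n * at q n ≤⟨ *-mono-≤ (at≤monomial p n) (at≤monomial q n) ⟩
  (coeff p * n ^ degree p) * (coeff q * n ^ degree q) ≡⟨ lemma (coeff p) (n ^ degree p) (coeff q) (n ^ degree q) ⟩
  coeff p * coeff q * (n ^ degree p * n ^ degree q) ≡⟨ cong (coeff p * coeff q *_) (^-distribˡ-+-* n (degree p) (degree q)) ⟨
  coeff p * coeff q * n ^ (degree p + degree q) ∎
  where
  open ≤-Reasoning
  lemma : ∀ a b c d → (a * b) * (c * d) ≡ a * c * (b * d)
  lemma = solve-∀

-- Functions computed by WHILE programs in polynomial time

infixr 5 _⊗_
data Ty : Set where
  one bool nat : Ty
  list         : Ty → Ty
  _⊗_          : Ty → Ty → Ty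

⟦_⟧ : Ty → Set
⟦ one ⟧    = ⊤
⟦ bool ⟧   = Bool
⟦ nat ⟧    = ℕ
⟦ list A ⟧ = List ⟦ A ⟧
⟦ A ⊗ B ⟧  = ⟦ A ⟧ × ⟦ B ⟧

-- Numbers that control loops are kept in unary, so that their value is bounded by the size of the
-- input of the loop. Costs stay binary, as lists of bits.
encUnary : ℕ → Tree
encUnary zero    = nil
encUnary (suc n) = nil ∙ encUnary n

enc : ∀ A → ⟦ A ⟧ → Tree
enc one      _       = nil
enc bool     b       = encodeBool b
enc nat      n       = encUnary n
enc (list A) xs      = encodeList (enc A) xs
enc (A ⊗ B)  (x , y) = enc A x ∙ enc B y

sz : ∀ A → ⟦ A ⟧ → ℕ
sz A x = size (enc A x)

size≥1 : ∀ t → 1 ≤ size t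
size≥1 nil     = s≤s z≤n
size≥1 (a ∙ b) = s≤s z≤n

length≤sz : ∀ A (xs : List ⟦ A ⟧) → length xs ≤ sz (list A) xs
length≤sz A []       = z≤n
length≤sz A (x ∷ xs) = s≤s (≤-trans (length≤sz A xs) (m≤n+m _ (sz A x)))

-- The last component is a frame condition: a caller keeps its own data in the variables below the
-- one at which it starts a subprogram.
Result : Cmd → ℕ → Store → Tree → ℕ → Set
Result c n σ out b = Σ[ σ′ ∈ Store ] Σ[ t ∈ ℕ ]
  Exec c σ σ′ t × t ≤ b × σ′ n ≡ out × (∀ y → y < n → σ′ y ≡ σ y)

-- prog n reads its argument from variable n, leaves its value there and
-- may use the variables above n as scratch space.
record PT (A B : Ty) (f : ⟦ A ⟧ → ⟦ B ⟧) : Set where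
  field
    prog  : ℕ → Cmd
    time  : Poly
    run   : ∀ n σ a → σ n ≡ enc A a →
            Result (prog n) n σ (enc B (f a)) (at time (sz A a))
    -- The time bound does not yield a size bound: repeating `x ≔ cons (var x) (var x)` makes the
    -- tree exponentially large in the number of steps.
    bound : Poly
    small : ∀ a → sz B (f a) ≤ at bound (sz A a)

open PT

update-same : ∀ σ x d → (σ [ x ↦ d ]) x ≡ d
update-same σ x d with x ≟ x
... | yes _  = refl
... | no x≢x = contradiction refl x≢x

update-other : ∀ σ {x y} d → y ≢ x → (σ [ x ↦ d ]) y ≡ σ y
update-other σ {x} {y} d y≢x with y ≟ x
... | yes y≡x = contradiction y≡x y≢x
... | no _    = refl

expr : ∀ {A B f} → (e : ℕ → Expr) → (cost : ℕ) → (∀ n → exprTime (e n) ≡ cost) →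
       (∀ n σ a → σ n ≡ enc A a → eval (e n) σ ≡ enc B (f a)) →
       (b : Poly) → (∀ a → sz B (f a) ≤ at b (sz A a)) → PT A B f
expr {A} {B} {f} e cost cost-ok value b small-ok = record
  { prog  = λ n → n ≔ e n
  ; time  = con (suc cost)
  ; run   = λ n σ a eq → σ [ n ↦ eval (e n) σ ] , suc (exprTime (e n)) , assign , s≤s (≤-reflexive (cost-ok n))
            , trans (update-same σ n _) (value n σ a eq) , λ y y<n → update-other σ _ (<⇒≢ y<n)
  ; bound = b
  ; small = small-ok
  }

call : ∀ {A B f} → PT A B f → ℕ → ℕ → Cmd
call P m n = m ≔ var n ⨾ prog P m

call-run : ∀ {A B f} (P : PT A B f) m n σ a → σ n ≡ enc A a →
           Result (call P m n) m σ (enc B (f a)) (2 + at (time P) (sz A a))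
call-run P m n σ a eq
  with run P m (σ [ m ↦ σ n ]) a (trans (update-same σ m _) eq)
... | σ′ , t , ex , t≤ , out , keep =
  σ′ , 2 + t , seq assign ex , +-monoʳ-≤ 2 t≤ , out , λ y y<m → trans (keep y y<m) (update-other σ _ (<⇒≢ y<m))

infixr 9 _∘ᴾ_
_∘ᴾ_ : ∀ {A B C g f} → PT B C g → PT A B f → PT A C (λ a → g (f a))
_∘ᴾ_ {A} {B} {C} {g} {f} Q P = record
  { prog  = λ n → prog P n ⨾ prog Q n
  ; time  = time P ⊞ (time Q ⟪ bound P ⟫)
  ; run   = λ n σ a eq → runs n σ a eq
  ; bound = bound Q ⟪ bound P ⟫
  ; small = λ a → ≤-trans (small Q (f a)) (at-comp (bound Q) (bound P) (small P a))
  }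
  where
  runs : ∀ n σ a → σ n ≡ enc A a →
         Result (prog P n ⨾ prog Q n) n σ (enc C (g (f a))) (at (time P ⊞ (time Q ⟪ bound P ⟫)) (sz A a))
  runs n σ a eq with run P n σ a eq
  ... | σ₁ , t₁ , ex₁ , t₁≤ , out₁ , keep₁ with run Q n σ₁ (f a) out₁
  ... | σ₂ , t₂ , ex₂ , t₂≤ , out₂ , keep₂ =
    σ₂ , t₁ + t₂ , seq ex₁ ex₂ , +-mono-≤ t₁≤ (≤-trans t₂≤ (at-comp (time Q) (bound P) (small P a))) , out₂ ,
    λ y y<n → trans (keep₂ y y<n) (keep₁ y y<n)

infixr 4 _,ᴾ_
_,ᴾ_ : ∀ {A B C f g} → PT A B f → PT A C g → PT A (B ⊗ C) (λ a → f a , g a)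
_,ᴾ_ {A} {B} {C} {f} {g} P Q = record
  { prog  = λ n → call P (1 + n) n ⨾ call Q (2 + n) n ⨾ n ≔ cons (var (1 + n)) (var (2 + n))
  ; time  = con 8 ⊞ time P ⊞ time Q
  ; run   = runs
  ; bound = con 1 ⊞ (bound P ⊞ bound Q)
  ; small = λ a → s≤s (+-mono-≤ (small P a) (small Q a))
  }
  where
  shape : ∀ x y → (2 + x) + ((2 + y) + 4) ≡ (8 + x) + y
  shape = solve-∀
  runs : ∀ n σ a → σ n ≡ enc A a → Result _ n σ (enc (B ⊗ C) (f a , g a)) _
  runs n σ a eq with call-run P (1 + n) n σ a eq
  ... | σ₁ , t₁ , ex₁ , t₁≤ , out₁ , keep₁ with call-run Q (2 + n) n σ₁ a (trans (keep₁ n ≤-refl) eq)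
  ... | σ₂ , t₂ , ex₂ , t₂≤ , out₂ , keep₂ =
    σ₂ [ n ↦ _ ] , t₁ + (t₂ + 4) , seq ex₁ (seq ex₂ assign) ,
    ≤-trans (+-mono-≤ t₁≤ (+-monoˡ-≤ 4 t₂≤)) (≤-reflexive (shape (at (time P) (sz A a)) _)) ,
    trans (update-same σ₂ n _) (cong₂ _∙_ (trans (keep₂ (1 + n) ≤-refl) out₁) out₂) ,
    λ y y<n → trans (update-other σ₂ _ (<⇒≢ y<n))
             (trans (keep₂ y (m<n⇒m<1+n (m<n⇒m<1+n y<n))) (keep₁ y (m<n⇒m<1+n y<n)))

ifᴾ : ∀ {A B c f g} → PT A bool c → PT A B f → PT A B g → PT A B (λ a → if c a then f a else g a)
ifᴾ {A} {B} {c} {f} {g} C P Q = record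
  { prog  = λ n → call C (1 + n) n ⨾ ifElse (var (1 + n)) (prog P n) (prog Q n)
  ; time  = con 4 ⊞ time C ⊞ (time P ⊞ time Q)
  ; run   = runs
  ; bound = bound P ⊞ bound Q
  ; small = smalls
  }
  where
  smalls : ∀ a → sz B (if c a then f a else g a) ≤ at (bound P) (sz A a) + at (bound Q) (sz A a)
  smalls a with c a
  ... | true  = ≤-trans (small P a) (m≤m+n _ _)
  ... | false = ≤-trans (small Q a) (m≤n+m _ _)
  shape : ∀ x y → (2 + x) + (2 + y) ≡ 4 + x + y
  shape = solve-∀
  runs : ∀ n σ a → σ n ≡ enc A a → Result _ n σ (enc B (if c a then f a else g a))
         (4 + at (time C) (sz A a) + (at (time P) (sz A a) + at (time Q) (sz A a)))
  runs n σ a eq with call-run C (1 + n) n σ a eq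
  ... | σ₁ , t₁ , ex₁ , t₁≤ , out₁ , keep₁ with c a
  ... | true with run P n σ₁ a (trans (keep₁ n ≤-refl) eq)
  ...   | σ₂ , t₂ , ex₂ , t₂≤ , out₂ , keep₂ =
    σ₂ , t₁ + (2 + t₂) , seq ex₁ (if-true (λ isNil → case-nil (trans (sym out₁) isNil)) ex₂) ,
    ≤-trans (+-mono-≤ t₁≤ (+-monoʳ-≤ 2 (≤-trans t₂≤ (m≤m+n _ _)))) (≤-reflexive (shape (at (time C) (sz A a)) _)) ,
    out₂ , λ y y<n → trans (keep₂ y y<n) (keep₁ y (m<n⇒m<1+n y<n))
    where
    case-nil : encodeBool true ≢ nil
    case-nil ()
  runs n σ a eq | σ₁ , t₁ , ex₁ , t₁≤ , out₁ , keep₁ | false with run Q n σ₁ a (trans (keep₁ n ≤-refl) eq)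
  ...   | σ₂ , t₂ , ex₂ , t₂≤ , out₂ , keep₂ =
    σ₂ , t₁ + (2 + t₂) , seq ex₁ (if-false out₁ ex₂) ,
    ≤-trans (+-mono-≤ t₁≤ (+-monoʳ-≤ 2 (≤-trans t₂≤ (m≤n+m _ (at (time P) (sz A a)))))) (≤-reflexive (shape (at (time C) (sz A a)) _)) ,
    out₂ , λ y y<n → trans (keep₂ y y<n) (keep₁ y (m<n⇒m<1+n y<n))

-- Loops over lists

n<2+n : ∀ n → n < 2 + n
n<2+n n = m<n⇒m<1+n ≤-refl

-- A polynomial step can still double the accumulator in every lap. The bound therefore covers all
-- intermediate accumulators, which gives one time bound for all laps.
Bounded : ∀ {S : Set} B → ℕ → (⟦ B ⟧ → S → ⟦ B ⟧) → ⟦ B ⟧ → List S → Set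
Bounded B M g acc []       = sz B acc ≤ M
Bounded B M g acc (x ∷ xs) = sz B acc ≤ M × Bounded B M g (g acc x) xs

module _ {Γ A B : Ty} {l : ⟦ Γ ⟧ → List ⟦ A ⟧} {z : ⟦ Γ ⟧ → ⟦ B ⟧} {h : ⟦ (Γ ⊗ A) ⊗ B ⟧ → ⟦ B ⟧}
         (L : PT Γ (list A) l) (Z : PT Γ B z) (H : PT ((Γ ⊗ A) ⊗ B) B h) (q : Poly)
         where

  foldStep : ⟦ Γ ⟧ → ⟦ B ⟧ → ⟦ A ⟧ → ⟦ B ⟧
  foldStep a acc x = h ((a , x) , acc)

  module _ (bd : ∀ a → Bounded B (at q (sz Γ a)) (foldStep a) (z a) (l a)) where
    private
      -- Variable `n` holds the environment, `1 + n` the unread part of the list and `2 + n` the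
      -- accumulator; the step is computed in `3 + n`.
      body : ℕ → Cmd
      body n = 3 + n ≔ cons (cons (var n) (hd (var (1 + n)))) (var (2 + n)) ⨾ prog H (3 + n)
             ⨾ 2 + n ≔ var (3 + n) ⨾ 1 + n ≔ tl (var (1 + n))

      loop : ℕ → Cmd
      loop n = while (var (1 + n)) (body n)

      input : Poly
      input = con 2 ⊞ arg ⊞ bound L ⊞ q

      lap : ℕ → ℕ
      lap s = 14 + at (time H) (at input s)

      loop-run : ∀ n a xs acc σ → sz (list A) xs ≤ at (bound L) (sz Γ a) →
        Bounded B (at q (sz Γ a)) (foldStep a) acc xs →
        σ n ≡ enc Γ a → σ (1 + n) ≡ enc (list A) xs → σ (2 + n) ≡ enc B acc →
        Σ[ σ′ ∈ Store ] Σ[ t ∈ ℕ ] Exec (loop n) σ σ′ t × t ≤ 2 + length xs * lap (sz Γ a)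
          × σ′ (2 + n) ≡ enc B (foldl (foldStep a) acc xs) × (∀ y → y < n → σ′ y ≡ σ y)
      loop-run n a [] acc σ sz≤ bnd σ0 σ1 σ2 = σ , 2 , while-false σ1 , ≤-refl , σ2 , λ _ _ → refl
      loop-run n a (x ∷ xs) acc σ sz≤ (acc≤ , bnd) σ0 σ1 σ2
        with run H (3 + n) (σ [ 3 + n ↦ _ ]) ((a , x) , acc)
               (trans (update-same σ (3 + n) (eval (cons (cons (var n) (hd (var (1 + n)))) (var (2 + n))) σ))
                      (cong₂ _∙_ (cong₂ _∙_ σ0 (cong head σ1)) σ2))
      ... | σb , t , exH , t≤ , outH , keepH
        with loop-run n a xs (foldStep a acc x) ((σb [ 2 + n ↦ σb (3 + n) ]) [ 1 + n ↦ _ ])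
               (≤-trans (≤-trans (m≤n+m _ (sz A x)) (n≤1+n _)) sz≤) bnd
               (trans (update-other (σb [ 2 + n ↦ σb (3 + n) ]) {1 + n} {n} _ (<⇒≢ ≤-refl))
                 (trans (update-other σb {2 + n} {n} (σb (3 + n)) (<⇒≢ (n<2+n n)))
                   (trans (keepH n (m<n⇒m<1+n (n<2+n n))) (trans (update-other σ {3 + n} {n} _ (<⇒≢ (m<n⇒m<1+n (n<2+n n)))) σ0))))
               (trans (update-same (σb [ 2 + n ↦ σb (3 + n) ]) (1 + n) (eval (tl (var (1 + n))) (σb [ 2 + n ↦ σb (3 + n) ])))
                 (cong tail (trans (update-other σb {2 + n} {1 + n} (σb (3 + n)) (<⇒≢ ≤-refl))
                   (trans (keepH (1 + n) (s≤s (n<2+n n))) (trans (update-other σ {3 + n} {1 + n} _ (<⇒≢ (s≤s (n<2+n n)))) σ1)))))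
               (trans (update-other (σb [ 2 + n ↦ σb (3 + n) ]) {1 + n} {2 + n} _ (λ p → <⇒≢ ≤-refl (sym p)))
                 (trans (update-same σb (2 + n) (σb (3 + n))) outH))
      ... | σ′ , t′ , ex , t′≤ , out , keep =
        σ′ , 2 + ((7 + (t + 5)) + t′)
        , while-true (λ isNil → nonNil (trans (sym σ1) isNil)) (seq assign (seq exH (seq assign assign))) ex
        , ≤-trans (+-monoʳ-≤ 2 (+-mono-≤ (+-monoʳ-≤ 7 (+-monoˡ-≤ 5 (≤-trans t≤ (at-mono (time H) input≤)))) t′≤))
                  (≤-reflexive (shape (at (time H) (at input (sz Γ a))) (length xs * lap (sz Γ a))))
        , out
        , λ y y<n → trans (keep y y<n)
            (trans (update-other (σb [ 2 + n ↦ σb (3 + n) ]) {1 + n} {y} _ (<⇒≢ (m<n⇒m<1+n y<n)))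
              (trans (update-other σb {2 + n} {y} (σb (3 + n)) (<⇒≢ (m<n⇒m<1+n (m<n⇒m<1+n y<n))))
                (trans (keepH y (m<n⇒m<1+n (m<n⇒m<1+n (m<n⇒m<1+n y<n)))) (update-other σ {3 + n} {y} _ (<⇒≢ (m<n⇒m<1+n (m<n⇒m<1+n (m<n⇒m<1+n y<n))))))))
        where
        nonNil : ∀ {x y} → (x ∙ y) ≢ nil
        nonNil ()
        shape : ∀ u v → 2 + ((7 + (u + 5)) + (2 + v)) ≡ 2 + ((14 + u) + v)
        shape = solve-∀
        input≤ : suc (suc (sz Γ a + sz A x) + sz B acc) ≤ at input (sz Γ a)
        input≤ = +-mono-≤ (+-monoʳ-≤ 2 (+-monoʳ-≤ (sz Γ a)
                   (≤-trans (≤-trans (m≤m+n (sz A x) _) (n≤1+n _)) sz≤))) acc≤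

      final≤ : ∀ a xs acc → Bounded B (at q (sz Γ a)) (foldStep a) acc xs →
               sz B (foldl (foldStep a) acc xs) ≤ at q (sz Γ a)
      final≤ a []       acc b       = b
      final≤ a (x ∷ xs) acc (_ , b) = final≤ a xs (foldStep a acc x) b

      foldProg : ℕ → Cmd
      foldProg n = call L (1 + n) n ⨾ call Z (2 + n) n ⨾ loop n ⨾ n ≔ var (2 + n)

      foldTime : Poly
      foldTime = con 8 ⊞ time L ⊞ time Z ⊞ bound L ⊠ (con 14 ⊞ (time H ⟪ input ⟫))

      shape : ∀ x y z → (2 + x) + ((2 + y) + ((2 + z) + 2)) ≡ 8 + x + y + z
      shape = solve-∀

      fold-run : ∀ n σ a → σ n ≡ enc Γ a →
        Result (foldProg n) n σ (enc B (foldl (foldStep a) (z a) (l a))) (at foldTime (sz Γ a))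
      fold-run n σ a eq with call-run L (1 + n) n σ a eq
      ... | σ₁ , t₁ , ex₁ , t₁≤ , out₁ , keep₁ with call-run Z (2 + n) n σ₁ a (trans (keep₁ n ≤-refl) eq)
      ... | σ₂ , t₂ , ex₂ , t₂≤ , out₂ , keep₂
        with loop-run n a (l a) (z a) σ₂ (small L a) (bd a)
               (trans (keep₂ n (m<n⇒m<1+n ≤-refl)) (trans (keep₁ n ≤-refl) eq))
               (trans (keep₂ (1 + n) ≤-refl) out₁) out₂
      ... | σ₃ , t₃ , ex₃ , t₃≤ , out₃ , keep₃ =
        σ₃ [ n ↦ _ ] , t₁ + (t₂ + (t₃ + 2)) , seq ex₁ (seq ex₂ (seq ex₃ assign))
        , ≤-trans (+-mono-≤ t₁≤ (+-mono-≤ t₂≤ (+-monoˡ-≤ 2 (≤-trans t₃≤ (+-monoʳ-≤ 2 laps≤)))))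
                  (≤-reflexive (shape (at (time L) (sz Γ a)) _ _))
        , trans (update-same σ₃ n _) out₃
        , λ y y<n → trans (update-other σ₃ _ (<⇒≢ y<n)) (trans (keep₃ y y<n)
            (trans (keep₂ y (m<n⇒m<1+n (m<n⇒m<1+n y<n))) (keep₁ y (m<n⇒m<1+n y<n))))
        where
        laps≤ : length (l a) * lap (sz Γ a) ≤ at (bound L) (sz Γ a) * (14 + at (time H ⟪ input ⟫) (sz Γ a))
        laps≤ = *-mono-≤ (≤-trans (length≤sz A (l a)) (small L a))
                         (+-monoʳ-≤ 14 (at-comp (time H) input ≤-refl))

    foldlᴾ : PT Γ B (λ a → foldl (foldStep a) (z a) (l a))
    foldlᴾ = record
      { prog  = foldProg
      ; time  = foldTime
      ; run   = fold-run
      ; bound = q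
      ; small = λ a → final≤ a (l a) (z a) (bd a)
      }

-- Basic programs: expressions, folds, Booleans and unary numbers

PT-ext : ∀ {A B f g} → (∀ a → f a ≡ g a) → PT A B f → PT A B g
PT-ext {A} {B} f≗g P = record
  { prog  = prog P
  ; time  = time P
  ; run   = λ n σ a eq → subst (λ b → Result (prog P n) n σ (enc B b) (at (time P) (sz A a))) (f≗g a) (run P n σ a eq)
  ; bound = bound P
  ; small = λ a → subst (λ b → sz B b ≤ at (bound P) (sz A a)) (f≗g a) (small P a)
  }

-- Values of different types may share a tree: a head paired with a tail is a nonempty list, and a
-- unary number is a list of units. Such a conversion is a bare assignment.
coerceᴾ : ∀ {A B f} → (∀ a → enc A a ≡ enc B (f a)) → PT A B f
coerceᴾ enc≡ = expr var 1 (λ _ → refl) (λ n σ a eq → trans eq (enc≡ a)) arg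
                    (λ a → ≤-reflexive (cong size (sym (enc≡ a))))

fstᴾ : ∀ {A B} → PT (A ⊗ B) A proj₁
fstᴾ {A} {B} = expr (λ n → hd (var n)) 2 (λ _ → refl) (λ n σ a eq → cong head eq) arg
                    (λ (a , b) → ≤-trans (m≤m+n _ (sz B b)) (n≤1+n _))

sndᴾ : ∀ {A B} → PT (A ⊗ B) B proj₂
sndᴾ {A} {B} = expr (λ n → tl (var n)) 2 (λ _ → refl) (λ n σ a eq → cong tail eq) arg
                    (λ (a , b) → ≤-trans (m≤n+m _ (sz A a)) (n≤1+n _))

wk : ∀ {Γ A B f} → PT Γ B f → PT (Γ ⊗ A) B (λ ρ → f (proj₁ ρ))
wk P = P ∘ᴾ fstᴾ

literal : Tree → Expr
literal nil     = nil
literal (s ∙ t) = cons (literal s) (literal t)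

eval-literal : ∀ t σ → eval (literal t) σ ≡ t
eval-literal nil     σ = refl
eval-literal (s ∙ t) σ = cong₂ _∙_ (eval-literal s σ) (eval-literal t σ)

constᴾ : ∀ {Γ A} (x : ⟦ A ⟧) → PT Γ A (λ _ → x)
constᴾ {Γ} {A} x = expr (λ _ → literal (enc A x)) _ (λ _ → refl) (λ _ σ _ _ → eval-literal (enc A x) σ)
                        (con (sz A x)) (λ _ → ≤-refl)

infixr 5 _∷ᴾ_
_∷ᴾ_ : ∀ {Γ A f g} → PT Γ A f → PT Γ (list A) g → PT Γ (list A) (λ ρ → f ρ ∷ g ρ)
P ∷ᴾ Q = coerceᴾ (λ _ → refl) ∘ᴾ (P ,ᴾ Q)

sucᴾ : ∀ {Γ f} → PT Γ nat f → PT Γ nat (λ ρ → suc (f ρ))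
sucᴾ P = expr (λ n → cons nil (var n)) 3 (λ _ → refl) (λ n σ a eq → cong (nil ∙_) eq) (con 2 ⊞ arg) (λ _ → ≤-refl) ∘ᴾ P

predᴾ : ∀ {Γ f} → PT Γ nat f → PT Γ nat (λ ρ → pred (f ρ))
predᴾ P = expr {nat} {nat} {pred} (λ n → tl (var n)) 2 (λ _ → refl)
               (λ { n σ zero eq → cong tail eq ; n σ (suc _) eq → cong tail eq }) arg
               (λ { zero → ≤-refl ; (suc m) → m≤n+m _ 2 }) ∘ᴾ P

sz-∈ : ∀ A x (xs : List ⟦ A ⟧) → sz A x ≤ sz (list A) (x ∷ xs)
sz-∈ A x xs = ≤-trans (m≤m+n (sz A x) _) (n≤1+n _)

-- A potential argument: `μ` dominates the size and each lap adds at most `w` to it, so it never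
-- exceeds its initial value plus `w` for every entry. `Inv` carries the facts about the accumulator
-- on which the growth estimate relies.
bounded-additive : ∀ {A B} (μ : ⟦ B ⟧ → ℕ) → (∀ b → sz B b ≤ μ b) →
  (Inv : ⟦ B ⟧ → Set) (g : ⟦ B ⟧ → ⟦ A ⟧ → ⟦ B ⟧) (w s M : ℕ) →
  (∀ acc x → sz A x ≤ s → Inv acc → Inv (g acc x) × μ (g acc x) ≤ μ acc + w) →
  ∀ xs acc → sz (list A) xs ≤ s → Inv acc → μ acc + length xs * w ≤ M → Bounded B M g acc xs
bounded-additive μ sz≤μ Inv g w s M grows [] acc _ _ fits = ≤-trans (sz≤μ acc) (≤-trans (m≤m+n _ 0) fits)
bounded-additive {A} {B} μ sz≤μ Inv g w s M grows (x ∷ xs) acc xs≤ inv fits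
  with grows acc x (≤-trans (sz-∈ A x xs) xs≤) inv
... | inv′ , g≤ = ≤-trans (sz≤μ acc) (≤-trans (m≤m+n _ _) fits)
  , bounded-additive {A} {B} μ sz≤μ Inv g w s M grows xs (g acc x)
      (≤-trans (≤-trans (m≤n+m _ (sz A x)) (n≤1+n _)) xs≤) inv′
      (≤-trans (+-monoˡ-≤ (length xs * w) g≤) (≤-trans (≤-reflexive (+-assoc (μ acc) w _)) fits))

module _ {Γ A B : Ty} {l : ⟦ Γ ⟧ → List ⟦ A ⟧} {z : ⟦ Γ ⟧ → ⟦ B ⟧} {h : ⟦ (Γ ⊗ A) ⊗ B ⟧ → ⟦ B ⟧}
         (L : PT Γ (list A) l) (Z : PT Γ B z) (H : PT ((Γ ⊗ A) ⊗ B) B h)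
         where

  -- The increment may depend on the environment and the entry but not on the accumulator; this is
  -- what excludes exponential growth.
  foldl-measureᴾ : (r₀ r : Poly) (μ : ⟦ B ⟧ → ℕ) (sz≤μ : ∀ b → sz B b ≤ μ b) (Inv : ⟦ Γ ⟧ → ⟦ B ⟧ → Set)
    (initially : ∀ a → Inv a (z a) × μ (z a) ≤ at r₀ (sz Γ a))
    (grows : ∀ a x acc → Inv a acc →
             Inv a (h ((a , x) , acc)) × μ (h ((a , x) , acc)) ≤ μ acc + at r (sz Γ a + sz A x)) →
    PT Γ B (λ a → foldl (λ acc x → h ((a , x) , acc)) (z a) (l a))
  foldl-measureᴾ r₀ r μ sz≤μ Inv initially grows = foldlᴾ L Z H (r₀ ⊞ bound L ⊠ (r ⟪ arg ⊞ bound L ⟫)) λ a →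
    bounded-additive {A} {B} μ sz≤μ (Inv a) _ (at (r ⟪ arg ⊞ bound L ⟫) (sz Γ a)) (at (bound L) (sz Γ a)) _
      (λ acc x x≤ inv → proj₁ (grows a x acc inv)
        , ≤-trans (proj₂ (grows a x acc inv))
                  (+-monoʳ-≤ (μ acc) (at-comp r (arg ⊞ bound L) (+-monoʳ-≤ (sz Γ a) x≤))))
      (l a) (z a) (small L a) (proj₁ (initially a))
      (+-mono-≤ (proj₂ (initially a)) (*-monoˡ-≤ _ (≤-trans (length≤sz A (l a)) (small L a))))

  foldl-sizeᴾ : (r : Poly) →
    (∀ a x acc → sz B (h ((a , x) , acc)) ≤ sz B acc + at r (sz Γ a + sz A x)) →
    PT Γ B (λ a → foldl (λ acc x → h ((a , x) , acc)) (z a) (l a))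
  foldl-sizeᴾ r grows = foldl-measureᴾ (bound Z) r (sz B) (λ _ → ≤-refl) (λ _ _ → ⊤)
    (λ a → tt , small Z a) (λ a x acc _ → tt , grows a x acc)

sz-∷ : ∀ A x (xs : List ⟦ A ⟧) → sz (list A) (x ∷ xs) ≡ sz (list A) xs + suc (sz A x)
sz-∷ A x xs = trans (cong suc (+-comm (sz A x) _)) (sym (+-suc (sz (list A) xs) (sz A x)))

reverseᴾ : ∀ {Γ A l} → PT Γ (list A) l → PT Γ (list A) (λ ρ → reverse (l ρ))
reverseᴾ {Γ} {A} L = foldl-sizeᴾ L (constᴾ []) (wk sndᴾ ∷ᴾ sndᴾ) (con 1 ⊞ arg)
  λ a x acc → ≤-trans (≤-reflexive (sz-∷ A x acc)) (+-monoʳ-≤ (sz (list A) acc) (s≤s (m≤n+m _ (sz Γ a))))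

module _ {Γ A B : Ty} {l : ⟦ Γ ⟧ → List ⟦ A ⟧} {z : ⟦ Γ ⟧ → ⟦ B ⟧} {h : ⟦ (Γ ⊗ A) ⊗ B ⟧ → ⟦ B ⟧}
         (L : PT Γ (list A) l) (Z : PT Γ B z) (H : PT ((Γ ⊗ A) ⊗ B) B h)
         where

  -- A loop consumes its list from the front, so a right fold is run as a left fold over the
  -- reversed list.
  foldr-measureᴾ : (r₀ r : Poly) (μ : ⟦ B ⟧ → ℕ) (sz≤μ : ∀ b → sz B b ≤ μ b) (Inv : ⟦ Γ ⟧ → ⟦ B ⟧ → Set)
    (initially : ∀ a → Inv a (z a) × μ (z a) ≤ at r₀ (sz Γ a))
    (grows : ∀ a x acc → Inv a acc →
             Inv a (h ((a , x) , acc)) × μ (h ((a , x) , acc)) ≤ μ acc + at r (sz Γ a + sz A x)) →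
    PT Γ B (λ a → foldr (λ x acc → h ((a , x) , acc)) (z a) (l a))
  foldr-measureᴾ r₀ r μ sz≤μ Inv initially grows =
    PT-ext (λ a → List.reverse-foldl _ (z a) (l a)) (foldl-measureᴾ (reverseᴾ L) Z H r₀ r μ sz≤μ Inv initially grows)

  foldrᴾ : (r : Poly) → (∀ a x acc → sz B (h ((a , x) , acc)) ≤ sz B acc + at r (sz Γ a + sz A x)) →
    PT Γ B (λ a → foldr (λ x acc → h ((a , x) , acc)) (z a) (l a))
  foldrᴾ r grows = foldr-measureᴾ (bound Z) r (sz B) (λ _ → ≤-refl) (λ _ _ → ⊤)
    (λ a → tt , small Z a) (λ a x acc _ → tt , grows a x acc)

-- A fold that ignores its accumulator is a case distinction on the list. In this form `grow`,
-- `augment` and `logCut` ask whether there is anything to do.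
headOrᴾ : ∀ {Γ A B l z h} → PT Γ (list A) l → PT Γ B z → PT (Γ ⊗ A) B h →
  PT Γ B (λ a → foldr (λ x _ → h (a , x)) (z a) (l a))
headOrᴾ {B = B} L Z H = foldrᴾ L Z (wk H) (bound H ⟪ con 1 ⊞ arg ⟫)
  λ a x acc → ≤-trans (≤-trans (small H (a , x)) (at-comp (bound H) (con 1 ⊞ arg) ≤-refl)) (m≤n+m _ (sz B acc))

bool≤3 : ∀ b → sz bool b ≤ 3
bool≤3 false = s≤s z≤n
bool≤3 true  = ≤-refl

foldBoolᴾ : ∀ {Γ A l z h} → PT Γ (list A) l → PT Γ bool z → PT ((Γ ⊗ A) ⊗ bool) bool h →
  PT Γ bool (λ a → foldr (λ x acc → h ((a , x) , acc)) (z a) (l a))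
foldBoolᴾ L Z H = foldrᴾ L Z H (con 3) (λ a x acc → ≤-trans (bool≤3 _) (m≤n+m 3 _))

infixr 6 _∧ᴾ_
infixr 5 _∨ᴾ_
_∧ᴾ_ : ∀ {Γ f g} → PT Γ bool f → PT Γ bool g → PT Γ bool (λ ρ → f ρ ∧ g ρ)
_∧ᴾ_ {f = f} P Q = PT-ext (λ a → if-∧ (f a)) (ifᴾ P Q (constᴾ false))
  where
  if-∧ : ∀ b {c} → (if b then c else false) ≡ b ∧ c
  if-∧ false = refl
  if-∧ true  = refl

_∨ᴾ_ : ∀ {Γ f g} → PT Γ bool f → PT Γ bool g → PT Γ bool (λ ρ → f ρ ∨ g ρ)
_∨ᴾ_ {f = f} P Q = PT-ext (λ a → if-∨ (f a)) (ifᴾ P (constᴾ true) Q)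
  where
  if-∨ : ∀ b {c} → (if b then true else c) ≡ b ∨ c
  if-∨ false = refl
  if-∨ true  = refl

notᴾ : ∀ {Γ f} → PT Γ bool f → PT Γ bool (λ ρ → not (f ρ))
notᴾ {f = f} P = PT-ext (λ a → if-not (f a)) (ifᴾ P (constᴾ false) (constᴾ true))
  where
  if-not : ∀ b → (if b then false else true) ≡ not b
  if-not false = refl
  if-not true  = refl

module _ {Γ A l p} (L : PT Γ (list A) l) (P : PT (Γ ⊗ A) bool p) where

  anyᴾ : PT Γ bool (λ ρ → any (λ x → p (ρ , x)) (l ρ))
  anyᴾ = PT-ext (λ a → any-foldr a (l a)) (foldBoolᴾ L (constᴾ false) (wk P ∨ᴾ sndᴾ))
    where
    any-foldr : ∀ a xs → foldr (λ x acc → p (a , x) ∨ acc) false xs ≡ any (λ x → p (a , x)) xs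
    any-foldr a []       = refl
    any-foldr a (x ∷ xs) = cong (p (a , x) ∨_) (any-foldr a xs)

  allᴾ : PT Γ bool (λ ρ → all (λ x → p (ρ , x)) (l ρ))
  allᴾ = PT-ext (λ a → all-foldr a (l a)) (foldBoolᴾ L (constᴾ true) (wk P ∧ᴾ sndᴾ))
    where
    all-foldr : ∀ a xs → foldr (λ x acc → p (a , x) ∧ acc) true xs ≡ all (λ x → p (a , x)) xs
    all-foldr a []       = refl
    all-foldr a (x ∷ xs) = cong (p (a , x) ∧_) (all-foldr a xs)

  filterᴾ : PT Γ (list A) (λ ρ → filterᵇ (λ x → p (ρ , x)) (l ρ))
  filterᴾ = PT-ext (λ a → filter-foldr a (l a))
    (foldrᴾ L (constᴾ []) (ifᴾ (wk P) (wk sndᴾ ∷ᴾ sndᴾ) sndᴾ) (con 1 ⊞ arg) grows)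
    where
    filter-foldr : ∀ a xs → foldr (λ x acc → if p (a , x) then x ∷ acc else acc) [] xs ≡ filterᵇ (λ x → p (a , x)) xs
    filter-foldr a []       = refl
    filter-foldr a (x ∷ xs) with p (a , x)
    ... | true  = cong (x ∷_) (filter-foldr a xs)
    ... | false = filter-foldr a xs
    grows : ∀ a x acc → sz (list A) (if p (a , x) then x ∷ acc else acc) ≤ sz (list A) acc + suc (sz Γ a + sz A x)
    grows a x acc with p (a , x)
    ... | true  = ≤-trans (≤-reflexive (trans (cong suc (+-comm (sz A x) _)) (sym (+-suc (sz (list A) acc) (sz A x)))))
                          (+-monoʳ-≤ (sz (list A) acc) (s≤s (m≤n+m _ (sz Γ a))))
    ... | false = m≤m+n _ _

sz-++ : ∀ A (xs ys : List ⟦ A ⟧) → sz (list A) (xs ++ ys) ≤ sz (list A) xs + sz (list A) ys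
sz-++ A []       ys = n≤1+n _
sz-++ A (x ∷ xs) ys = s≤s (≤-trans (+-monoʳ-≤ (sz A x) (sz-++ A xs ys)) (≤-reflexive (sym (+-assoc (sz A x) _ _))))

infixr 5 _++ᴾ_
_++ᴾ_ : ∀ {Γ A f g} → PT Γ (list A) f → PT Γ (list A) g → PT Γ (list A) (λ ρ → f ρ ++ g ρ)
_++ᴾ_ {Γ} {A} {f} {g} P Q = PT-ext (λ a → sym (List.++-is-foldr (f a) (g a)))
  (foldrᴾ P Q (wk sndᴾ ∷ᴾ sndᴾ) (con 1 ⊞ arg)
    λ a x acc → ≤-trans (≤-reflexive (sz-∷ A x acc)) (+-monoʳ-≤ (sz (list A) acc) (s≤s (m≤n+m _ (sz Γ a)))))

concatMapᴾ : ∀ {Γ A B l h} → PT Γ (list A) l → PT (Γ ⊗ A) (list B) h → PT Γ (list B) (λ ρ → concatMap (λ x → h (ρ , x)) (l ρ))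
concatMapᴾ {Γ} {A} {B} {l} {h} L H = PT-ext (λ a → concatMap-foldr a (l a))
  (foldrᴾ L (constᴾ []) (wk H ++ᴾ sndᴾ) (bound H ⟪ con 1 ⊞ arg ⟫)
    λ a x acc → ≤-trans (sz-++ B (h (a , x)) acc) (≤-trans (≤-reflexive (+-comm (sz (list B) (h (a , x))) _))
      (+-monoʳ-≤ (sz (list B) acc) (≤-trans (small H (a , x)) (at-comp (bound H) (con 1 ⊞ arg) ≤-refl)))))
  where
  concatMap-foldr : ∀ a xs → foldr (λ x acc → h (a , x) ++ acc) [] xs ≡ concatMap (λ x → h (a , x)) xs
  concatMap-foldr a []       = refl
  concatMap-foldr a (x ∷ xs) = cong (h (a , x) ++_) (concatMap-foldr a xs)

mapᴾ : ∀ {Γ A B l h} → PT Γ (list A) l → PT (Γ ⊗ A) B h → PT Γ (list B) (λ ρ → map (λ x → h (ρ , x)) (l ρ))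
mapᴾ {Γ} {A} {B} {l} {h} L H = PT-ext (λ a → map-foldr a (l a))
  (foldrᴾ L (constᴾ []) (wk H ∷ᴾ sndᴾ) (con 1 ⊞ (bound H ⟪ con 1 ⊞ arg ⟫))
    λ a x acc → ≤-trans (≤-reflexive (sz-∷ B (h (a , x)) acc))
      (+-monoʳ-≤ (sz (list B) acc) (s≤s (≤-trans (small H (a , x)) (at-comp (bound H) (con 1 ⊞ arg) ≤-refl)))))
  where
  map-foldr : ∀ a xs → foldr (λ x acc → h (a , x) ∷ acc) [] xs ≡ map (λ x → h (a , x)) xs
  map-foldr a []       = refl
  map-foldr a (x ∷ xs) = cong (h (a , x) ∷_) (map-foldr a xs)

sz-nat : ∀ n → sz nat n ≡ 1 + n * 2
sz-nat zero    = refl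
sz-nat (suc n) = cong (2 +_) (sz-nat n)

lengthᴾ : ∀ {Γ A l} → PT Γ (list A) l → PT Γ nat (λ ρ → length (l ρ))
lengthᴾ L = foldrᴾ L (constᴾ 0) (sucᴾ sndᴾ) (con 2)
  λ a x acc → ≤-reflexive (+-comm 2 (sz nat acc))

onesᴾ : ∀ {Γ k} → PT Γ nat k → PT Γ (list one) (λ ρ → replicate (k ρ) tt)
onesᴾ K = coerceᴾ enc-ones ∘ᴾ K
  where
  enc-ones : ∀ n → enc nat n ≡ enc (list one) (replicate n tt)
  enc-ones zero    = refl
  enc-ones (suc n) = cong (nil ∙_) (enc-ones n)

iter : ∀ {S : Set} → ℕ → (S → S) → S → S
iter zero    f x = x
iter (suc n) f x = f (iter n f x)

iter-foldr : ∀ {S : Set} n (f : S → S) x → foldr (λ _ → f) x (replicate n tt) ≡ iter n f x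
iter-foldr zero    f x = refl
iter-foldr (suc n) f x = cong f (iter-foldr n f x)

module _ {Γ B k z h} (K : PT Γ nat k) (Z : PT Γ B z) (H : PT (Γ ⊗ B) B h) where

  iter-measureᴾ : (r₀ r : Poly) (μ : ⟦ B ⟧ → ℕ) (sz≤μ : ∀ b → sz B b ≤ μ b) (Inv : ⟦ Γ ⟧ → ⟦ B ⟧ → Set) →
    (∀ a → Inv a (z a) × μ (z a) ≤ at r₀ (sz Γ a)) →
    (∀ a acc → Inv a acc → Inv a (h (a , acc)) × μ (h (a , acc)) ≤ μ acc + at r (sz Γ a)) →
    PT Γ B (λ a → iter (k a) (λ acc → h (a , acc)) (z a))
  iter-measureᴾ r₀ r μ sz≤μ Inv initially grows = PT-ext (λ a → iter-foldr (k a) (λ acc → h (a , acc)) (z a))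
    (foldr-measureᴾ (onesᴾ K) Z (H ∘ᴾ (fstᴾ ∘ᴾ fstᴾ ,ᴾ sndᴾ)) r₀ r μ sz≤μ Inv initially
      λ a _ acc inv → proj₁ (grows a acc inv)
        , ≤-trans (proj₂ (grows a acc inv)) (+-monoʳ-≤ (μ acc) (at-mono r (m≤m+n _ _))))

  iterᴾ : (r : Poly) → (∀ a acc → sz B (h (a , acc)) ≤ sz B acc + at r (sz Γ a)) →
    PT Γ B (λ a → iter (k a) (λ acc → h (a , acc)) (z a))
  iterᴾ r grows = iter-measureᴾ (bound Z) r (sz B) (λ _ → ≤-refl) (λ _ _ → ⊤)
    (λ a → tt , small Z a) (λ a acc _ → tt , grows a acc)

infixl 6 _+ᴾ_ _∸ᴾ_
infixl 7 _*ᴾ_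
_+ᴾ_ : ∀ {Γ f g} → PT Γ nat f → PT Γ nat g → PT Γ nat (λ ρ → f ρ + g ρ)
_+ᴾ_ {f = f} P Q = PT-ext (λ a → iter-suc (f a) _)
  (iterᴾ P Q (sucᴾ sndᴾ) (con 2) λ _ acc → ≤-reflexive (+-comm 2 (sz nat acc)))
  where
  iter-suc : ∀ m n → iter m suc n ≡ m + n
  iter-suc zero    n = refl
  iter-suc (suc m) n = cong suc (iter-suc m n)

sz-pred : ∀ n → sz nat (pred n) ≤ sz nat n
sz-pred zero    = ≤-refl
sz-pred (suc n) = m≤n+m _ 2

_∸ᴾ_ : ∀ {Γ f g} → PT Γ nat f → PT Γ nat g → PT Γ nat (λ ρ → f ρ ∸ g ρ)
_∸ᴾ_ {g = g} P Q = PT-ext (λ a → iter-pred _ (g a))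
  (iterᴾ Q P (predᴾ sndᴾ) (con 0) λ _ acc → ≤-trans (sz-pred acc) (m≤m+n _ 0))
  where
  iter-pred : ∀ m n → iter n pred m ≡ m ∸ n
  iter-pred m zero    = refl
  iter-pred m (suc n) = trans (cong pred (iter-pred m n)) (pred[m∸n]≡m∸[1+n] m n)

sz-+ : ∀ m n → sz nat (m + n) ≤ sz nat n + sz nat m
sz-+ m n = begin
  sz nat (m + n) ≡⟨ sz-nat (m + n) ⟩
  1 + (m + n) * 2 ≤⟨ n≤1+n _ ⟩
  2 + (m + n) * 2 ≡⟨ shape m n ⟩
  (1 + n * 2) + (1 + m * 2) ≡⟨ cong₂ _+_ (sz-nat n) (sz-nat m) ⟨
  sz nat n + sz nat m ∎
  where
  open ≤-Reasoning
  shape : ∀ m n → 2 + (m + n) * 2 ≡ (1 + n * 2) + (1 + m * 2)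
  shape = solve-∀

_*ᴾ_ : ∀ {Γ f g} → PT Γ nat f → PT Γ nat g → PT Γ nat (λ ρ → f ρ * g ρ)
_*ᴾ_ {f = f} {g} P Q = PT-ext (λ a → iter-+ (f a) (g a))
  (iterᴾ P (constᴾ 0) (wk Q +ᴾ sndᴾ) (bound Q)
    λ a acc → ≤-trans (sz-+ (g a) acc) (+-monoʳ-≤ (sz nat acc) (small Q a)))
  where
  iter-+ : ∀ m n → iter m (n +_) 0 ≡ m * n
  iter-+ zero    n = refl
  iter-+ (suc m) n = cong (n +_) (iter-+ m n)

isZeroᴾ : ∀ {Γ f} → PT Γ nat f → PT Γ bool (λ ρ → f ρ ≡ᵇ 0)
isZeroᴾ {f = f} P = PT-ext (λ a → foldr-zero (f a)) (foldBoolᴾ (onesᴾ P) (constᴾ true) (constᴾ false))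
  where
  foldr-zero : ∀ n → foldr (λ _ _ → false) true (replicate n tt) ≡ (n ≡ᵇ 0)
  foldr-zero zero    = refl
  foldr-zero (suc n) = refl

_≤ᵇᴾ_ : ∀ {Γ f g} → PT Γ nat f → PT Γ nat g → PT Γ bool (λ ρ → f ρ ∸ g ρ ≡ᵇ 0)
P ≤ᵇᴾ Q = isZeroᴾ (P ∸ᴾ Q)

_≡ᵇᴾ_ : ∀ {Γ f g} → PT Γ nat f → PT Γ nat g → PT Γ bool (λ ρ → f ρ ≡ᵇ g ρ)
_≡ᵇᴾ_ {f = f} {g} P Q = PT-ext (λ a → both (f a) (g a)) ((P ≤ᵇᴾ Q) ∧ᴾ (Q ≤ᵇᴾ P))
  where
  both : ∀ m n → (m ∸ n ≡ᵇ 0) ∧ (n ∸ m ≡ᵇ 0) ≡ (m ≡ᵇ n)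
  both zero    zero    = refl
  both zero    (suc n) = refl
  both (suc m) zero    = refl
  both (suc m) (suc n) = both m n

_⊓ᴾ_ : ∀ {Γ f g} → PT Γ nat f → PT Γ nat g → PT Γ nat (λ ρ → f ρ ⊓ g ρ)
_⊓ᴾ_ {f = f} {g} P Q = PT-ext (λ a → ∸-⊓ (f a) (g a)) (P ∸ᴾ (P ∸ᴾ Q))
  where
  ∸-⊓ : ∀ m n → m ∸ (m ∸ n) ≡ m ⊓ n
  ∸-⊓ m n with ≤-total m n
  ... | inj₁ m≤n = trans (cong (m ∸_) (m≤n⇒m∸n≡0 m≤n)) (sym (m≤n⇒m⊓n≡m m≤n))
  ... | inj₂ n≤m = trans (m∸[m∸n]≡n n≤m) (sym (m≥n⇒m⊓n≡n n≤m))

bitsT costT arcT edgeT : Ty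
bitsT = list bool
costT = bitsT ⊗ bitsT
arcT  = nat ⊗ nat
edgeT = arcT ⊗ costT

-- Binary arithmetic

-- Numerals have their least significant bit first and
-- may have trailing zeros.
firstBit : List Bool → Bool
firstBit = foldr (λ b _ → b) false

rest : {A : Set} → List A → List A
rest []       = []
rest (_ ∷ xs) = xs

-- With a leading zero for each bit of `ys`, a single pass over the padded list is sure to exhaust
-- `ys`.
pad : List Bool → List Bool → List Bool
pad xs ys = xs ++ map (λ _ → false) ys

_xor_ : Bool → Bool → Bool
b xor c = if b then not c else c

-- The state consists of the unread second summand, the carry, and the sum bits found so far in
-- reverse order.
addBit : List Bool × (Bool × List Bool) → Bool → List Bool × (Bool × List Bool)
addBit s x = rest (proj₁ s) , ((if x then y ∨ c else y ∧ c) , (x xor (y xor c)) ∷ proj₂ (proj₂ s))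
  where
  y = firstBit (proj₁ s)
  c = proj₁ (proj₂ s)

add : List Bool → List Bool → List Bool
add xs ys = reverse (proj₂ (proj₂ s)) ++ proj₁ (proj₂ s) ∷ []
  where s = foldl addBit (ys , (false , [])) (pad xs ys)

-- More significant bits come later, so wherever the numbers differ the current bit overrules the
-- verdict so far.
lessBit : List Bool × Bool → Bool → List Bool × Bool
lessBit s x = rest (proj₁ s) , (if x xor y then y else proj₂ s)
  where y = firstBit (proj₁ s)

lessBits : List Bool → List Bool → Bool
lessBits xs ys = proj₂ (foldl lessBit (ys , false) (pad xs ys))

-- The first factor is in the bijective notation of encodeℕᵇ: the digits
-- false and true stand for 2 and 1.
mul : List Bool → List Bool → List Bool
mul ds ys = foldr (λ d acc → add (if d then ys else false ∷ ys) (false ∷ acc)) [] ds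

scale : ℕ → List Bool → List Bool
scale i ys = iter i (add ys) []

-- The inner product with the bit list of 1 converts the denominator from bijective digits to bits,
-- the form required of a second factor.
crossMul : ⟦ costT ⟧ → ⟦ costT ⟧ → List Bool
crossMul c c′ = mul (proj₁ c) (mul (proj₂ c′) (true ∷ []))

-- i · c < j · c′ for fractions c, c′ of bijective numerals.
costLess : ℕ → ⟦ costT ⟧ → ℕ → ⟦ costT ⟧ → Bool
costLess i c j c′ = lessBits (scale i (crossMul c c′)) (scale j (crossMul c′ c))

firstBitᴾ : ∀ {Γ f} → PT Γ bitsT f → PT Γ bool (λ ρ → firstBit (f ρ))
firstBitᴾ P = foldBoolᴾ P (constᴾ false) (wk sndᴾ)

sz-rest : ∀ A (xs : List ⟦ A ⟧) → sz (list A) (rest xs) ≤ sz (list A) xs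
sz-rest A []       = ≤-refl
sz-rest A (x ∷ xs) = ≤-trans (m≤n+m _ (sz A x)) (n≤1+n _)

restᴾ : ∀ {Γ A f} → PT Γ (list A) f → PT Γ (list A) (λ ρ → rest (f ρ))
restᴾ {A = A} P = expr {list A} {list A} {rest} (λ n → tl (var n)) 2 (λ _ → refl)
  (λ { n σ [] eq → cong tail eq ; n σ (_ ∷ _) eq → cong tail eq }) arg (sz-rest A) ∘ᴾ P

_xorᴾ_ : ∀ {Γ f g} → PT Γ bool f → PT Γ bool g → PT Γ bool (λ ρ → f ρ xor g ρ)
P xorᴾ Q = ifᴾ P (notᴾ Q) Q

padᴾ : ∀ {Γ f g} → PT Γ bitsT f → PT Γ bitsT g → PT Γ bitsT (λ ρ → pad (f ρ) (g ρ))
padᴾ P Q = P ++ᴾ mapᴾ Q (constᴾ false)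

addBitᴾ : ∀ {Γ s x} → PT Γ (bitsT ⊗ (bool ⊗ bitsT)) s → PT Γ bool x → PT Γ (bitsT ⊗ (bool ⊗ bitsT)) (λ ρ → addBit (s ρ) (x ρ))
addBitᴾ P Q = restᴾ (fstᴾ ∘ᴾ P) ,ᴾ (ifᴾ Q (y ∨ᴾ c) (y ∧ᴾ c) ,ᴾ (Q xorᴾ (y xorᴾ c)) ∷ᴾ (sndᴾ ∘ᴾ sndᴾ ∘ᴾ P))
  where
  y = firstBitᴾ (fstᴾ ∘ᴾ P)
  c = fstᴾ ∘ᴾ sndᴾ ∘ᴾ P

sz-addBit : ∀ s x → sz (bitsT ⊗ (bool ⊗ bitsT)) (addBit s x) ≤ sz (bitsT ⊗ (bool ⊗ bitsT)) s + 7
sz-addBit s@(ys , (c , out)) x = begin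
  suc (sz bitsT (rest ys) + suc (sz bool _ + suc (sz bool b + sz bitsT out)))
    ≤⟨ s≤s (+-mono-≤ (sz-rest bool ys) (s≤s (+-mono-≤ (bool≤3 _) (s≤s (+-monoˡ-≤ (sz bitsT out) (bool≤3 b)))))) ⟩
  suc (sz bitsT ys + suc (3 + suc (3 + sz bitsT out))) ≡⟨ shape (sz bitsT ys) (sz bitsT out) ⟩
  suc (sz bitsT ys + suc (0 + sz bitsT out)) + 7 ≤⟨ +-monoˡ-≤ 7 (s≤s (+-monoʳ-≤ (sz bitsT ys) (s≤s (+-monoˡ-≤ (sz bitsT out) z≤n)))) ⟩
  suc (sz bitsT ys + suc (sz bool c + sz bitsT out)) + 7 ∎
  where
  open ≤-Reasoning
  b = x xor (firstBit ys xor c)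
  shape : ∀ a o → suc (a + suc (3 + suc (3 + o))) ≡ suc (a + suc (0 + o)) + 7
  shape = solve-∀

addᴾ : ∀ {Γ f g} → PT Γ bitsT f → PT Γ bitsT g → PT Γ bitsT (λ ρ → add (f ρ) (g ρ))
addᴾ {Γ} P Q = reverseᴾ (sndᴾ ∘ᴾ sndᴾ ∘ᴾ S) ++ᴾ (fstᴾ ∘ᴾ sndᴾ ∘ᴾ S) ∷ᴾ constᴾ []
  where
  S = foldl-sizeᴾ (padᴾ P Q) (Q ,ᴾ constᴾ (false , [])) (addBitᴾ sndᴾ (wk sndᴾ)) (con 7) (λ a x acc → sz-addBit acc x)

lessBitsᴾ : ∀ {Γ f g} → PT Γ bitsT f → PT Γ bitsT g → PT Γ bool (λ ρ → lessBits (f ρ) (g ρ))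
lessBitsᴾ {Γ} P Q = sndᴾ ∘ᴾ foldl-sizeᴾ (padᴾ P Q) (Q ,ᴾ constᴾ false)
  (restᴾ (fstᴾ ∘ᴾ sndᴾ) ,ᴾ ifᴾ (wk sndᴾ xorᴾ y) y (sndᴾ ∘ᴾ sndᴾ)) (con 3)
  λ a x acc → ≤-trans (s≤s (+-mono-≤ (sz-rest bool (proj₁ acc)) (bool≤3 _)))
    (s≤s (+-monoˡ-≤ 3 (m≤m+n _ (sz bool (proj₂ acc)))))
  where y = firstBitᴾ (fstᴾ ∘ᴾ sndᴾ)

length-addBits : ∀ xs s → length (proj₂ (proj₂ (foldl addBit s xs))) ≡ length xs + length (proj₂ (proj₂ s))
length-addBits []       s = refl
length-addBits (x ∷ xs) s = trans (length-addBits xs (addBit s x)) (+-suc (length xs) _)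

length-add : ∀ xs ys → length (add xs ys) ≡ length xs + length ys + 1
length-add xs ys = begin
  length (reverse out ++ _ ∷ []) ≡⟨ List.length-++ (reverse out) ⟩
  length (reverse out) + 1 ≡⟨ cong (_+ 1) (List.length-reverse out) ⟩
  length out + 1 ≡⟨ cong (_+ 1) (length-addBits (pad xs ys) (ys , (false , []))) ⟩
  length (pad xs ys) + 0 + 1 ≡⟨ cong (_+ 1) (+-identityʳ (length (pad xs ys))) ⟩
  length (pad xs ys) + 1 ≡⟨ cong (_+ 1) (List.length-++ xs) ⟩
  length xs + length (map _ ys) + 1 ≡⟨ cong (λ n → length xs + n + 1) (List.length-map _ ys) ⟩
  length xs + length ys + 1 ∎
  where
  open ≡-Reasoning
  out = proj₂ (proj₂ (foldl addBit (ys , (false , [])) (pad xs ys)))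

-- A bit contributes at most 4 to the size, 3 for itself and 1 for its `cons`. Unlike the size of a
-- sum, its length is determined by the lengths of the summands, so repeated addition can be tracked
-- exactly.
bitsMeasure : List Bool → ℕ
bitsMeasure xs = 1 + length xs * 4

sz≤bitsMeasure : ∀ xs → sz bitsT xs ≤ bitsMeasure xs
sz≤bitsMeasure []       = ≤-refl
sz≤bitsMeasure (x ∷ xs) = s≤s (≤-trans (+-mono-≤ (bool≤3 x) (sz≤bitsMeasure xs)) ≤-refl)

measure-add : ∀ xs ys k → length xs ≤ k → bitsMeasure (add xs ys) ≤ bitsMeasure ys + (k * 4 + 4)
measure-add xs ys k xs≤ = begin
  1 + length (add xs ys) * 4 ≡⟨ cong (λ n → 1 + n * 4) (length-add xs ys) ⟩
  1 + (length xs + length ys + 1) * 4 ≤⟨ +-monoʳ-≤ 1 (*-monoˡ-≤ 4 (+-monoˡ-≤ 1 (+-monoˡ-≤ (length ys) xs≤))) ⟩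
  1 + (k + length ys + 1) * 4 ≡⟨ shape k (length ys) ⟩
  (1 + length ys * 4) + (k * 4 + 4) ∎
  where
  open ≤-Reasoning
  shape : ∀ k l → 1 + (k + l + 1) * 4 ≡ (1 + l * 4) + (k * 4 + 4)
  shape = solve-∀

mulᴾ : ∀ {Γ f g} → PT Γ bitsT f → PT Γ bitsT g → PT Γ bitsT (λ ρ → mul (f ρ) (g ρ))
mulᴾ {Γ} {f} {g} P Q = foldr-measureᴾ P (constᴾ [])
  (addᴾ (ifᴾ (wk sndᴾ) (wk (wk Q)) (constᴾ false ∷ᴾ wk (wk Q))) (constᴾ false ∷ᴾ sndᴾ))
  (con 1) (con 4 ⊞ ((con 1 ⊞ bound Q) ⊠ con 4 ⊞ con 4)) bitsMeasure sz≤bitsMeasure (λ _ _ → ⊤)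
  (λ _ → tt , ≤-refl)
  λ a d acc _ → tt , (begin
    bitsMeasure (add (if d then g a else false ∷ g a) (false ∷ acc))
      ≤⟨ measure-add (if d then g a else false ∷ g a) (false ∷ acc) (1 + at (bound Q) (sz Γ a + sz bool d)) (digit a d) ⟩
    bitsMeasure (false ∷ acc) + w a d ≡⟨ cong (_+ w a d) (+-comm 4 (bitsMeasure acc)) ⟩
    (bitsMeasure acc + 4) + w a d ≡⟨ +-assoc (bitsMeasure acc) 4 _ ⟩
    bitsMeasure acc + (4 + w a d) ∎)
  where
  open ≤-Reasoning
  w : ⟦ Γ ⟧ → Bool → ℕ
  w a d = (1 + at (bound Q) (sz Γ a + sz bool d)) * 4 + 4
  factor : ∀ a d → length (g a) ≤ at (bound Q) (sz Γ a + sz bool d)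
  factor a d = ≤-trans (length≤sz bool (g a)) (≤-trans (small Q a) (at-mono (bound Q) (m≤m+n _ _)))
  digit : ∀ a d → length (if d then g a else false ∷ g a) ≤ 1 + at (bound Q) (sz Γ a + sz bool d)
  digit a true  = ≤-trans (factor a true) (n≤1+n _)
  digit a false = s≤s (factor a false)

scaleᴾ : ∀ {Γ f g} → PT Γ nat f → PT Γ bitsT g → PT Γ bitsT (λ ρ → scale (f ρ) (g ρ))
scaleᴾ {Γ} {f} {g} P Q = iter-measureᴾ P (constᴾ []) (addᴾ (wk Q) sndᴾ)
  (con 1) (bound Q ⊠ con 4 ⊞ con 4) bitsMeasure sz≤bitsMeasure (λ _ _ → ⊤) (λ _ → tt , ≤-refl)
  λ a acc _ → tt , measure-add (g a) acc _ (≤-trans (length≤sz bool (g a)) (small Q a))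

costLessᴾ : ∀ {Γ i c j d} → PT Γ nat i → PT Γ costT c → PT Γ nat j → PT Γ costT d →
            PT Γ bool (λ ρ → costLess (i ρ) (c ρ) (j ρ) (d ρ))
costLessᴾ I C J D = lessBitsᴾ (scaleᴾ I (crossᴾ C D)) (scaleᴾ J (crossᴾ D C))
  where
  crossᴾ : ∀ {Γ c d} → PT Γ costT c → PT Γ costT d →
           PT Γ bitsT (λ ρ → crossMul (c ρ) (d ρ))
  crossᴾ C D = mulᴾ (fstᴾ ∘ᴾ C) (mulᴾ (sndᴾ ∘ᴾ D) (constᴾ (true ∷ [])))

-- Augmenting paths

module Flow {Arc : Set} (src tgt : Arc → ℕ) (rev : Arc → Arc) (_==_ : Arc → Arc → Bool) where

  visited : ℕ → List Arc → ℕ → Bool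
  visited s tree v = (v ≡ᵇ s) ∨ any (λ α → tgt α ≡ᵇ v) tree

  frontier : ℕ → List Arc → List Arc → List Arc
  frontier s A tree = filterᵇ (λ α → visited s tree (src α) ∧ not (visited s tree (tgt α))) A

  grow : ℕ → List Arc → List Arc → List Arc
  grow s A tree = foldr (λ α _ → α ∷ tree) tree (frontier s A tree)

  -- Every successful `grow` increases the number of arcs of `A` whose target is visited. This
  -- number is at most `length A`, so with one extra iteration the tree must be closed.
  search : ℕ → List Arc → List Arc
  search s A = iter (length A + 1) (grow s A) []

  traceArc : ℕ × List Arc → Arc → ℕ × List Arc
  traceArc (v , P) α = if tgt α ≡ᵇ v then (src α , α ∷ P) else (v , P)

  -- In a search tree every arc precedes the arc that reached its source, so
  -- one pass recovers the path to v.
  trace : List Arc → ℕ → List Arc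
  trace tree v = proj₂ (foldl traceArc (v , []) tree)

  -- Capacities are represented by parallel copies of an arc, of which only one may be reversed; the
  -- Boolean records whether that has happened.
  flipArc : Arc → Arc → Bool × List Arc → Bool × List Arc
  flipArc α x (done , A) = if not done ∧ (x == α) then (true , rev x ∷ A) else (done , x ∷ A)

  flip : List Arc → Arc → List Arc
  flip A α = proj₂ (foldr (flipArc α) (false , []) A)

  augment : ℕ → (ℕ → Bool) → List Arc → List Arc
  augment s sink A = foldr (λ α _ → foldl flip A (trace (search s A) (tgt α))) A
                           (filterᵇ (λ α → sink (tgt α)) (search s A))

  -- Each augmentation takes one arc out of the cut around `s` alone, which has at most `length A`
  -- arcs. Hence no augmenting path is left after `length A + 1` attempts.
  residual : ℕ → (ℕ → Bool) → List Arc → List Arc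
  residual s sink A = iter (length A + 1) (augment s sink) A

  cutTree : ℕ → (ℕ → Bool) → List Arc → List Arc
  cutTree s sink A = search s (residual s sink A)

-- Booleans, lists and finite sums

true≢false : ∀ {b} → b ≡ true → b ≡ false → ⊥
true≢false refl ()

T⇒true : ∀ {b} → T b → b ≡ true
T⇒true {true} _ = refl

true⇒T : ∀ {b} → b ≡ true → T b
true⇒T refl = tt

not-true : ∀ {b} → not b ≡ true → b ≡ false
not-true {false} _ = refl

∧-true : ∀ {b c} → b ∧ c ≡ true → b ≡ true × c ≡ true
∧-true {true} eq = refl , eq

∨-true : ∀ {b c} → b ∨ c ≡ true → b ≡ true ⊎ c ≡ true
∨-true {true}  _  = inj₁ refl
∨-true {false} eq = inj₂ eq

∨-trueʳ : ∀ b {c} → c ≡ true → b ∨ c ≡ true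
∨-trueʳ true  _  = refl
∨-trueʳ false eq = eq

≡ᵇ-true : ∀ {m n} → (m ≡ᵇ n) ≡ true → m ≡ n
≡ᵇ-true {m} {n} eq = ≡ᵇ⇒≡ m n (true⇒T eq)

≡ᵇ-refl : ∀ n → (n ≡ᵇ n) ≡ true
≡ᵇ-refl n = T⇒true (≡⇒≡ᵇ n n refl)

any⁻ : ∀ {A : Set} (p : A → Bool) xs → any p xs ≡ true → ∃[ x ] x ∈ xs × p x ≡ true
any⁻ p (x ∷ xs) eq with ∨-true {p x} eq
... | inj₁ px = x , here refl , px
... | inj₂ eq′ with any⁻ p xs eq′
...   | y , y∈ , py = y , there y∈ , py

any⁺ : ∀ {A : Set} (p : A → Bool) {x xs} → x ∈ xs → p x ≡ true → any p xs ≡ true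
any⁺ p (here refl) px rewrite px = refl
any⁺ p {xs = y ∷ _} (there x∈) px = ∨-trueʳ (p y) (any⁺ p x∈ px)

∈-filterᵇ⁻ : ∀ {A : Set} (p : A → Bool) {x xs} → x ∈ filterᵇ p xs → x ∈ xs × p x ≡ true
∈-filterᵇ⁻ p x∈ with ∈-filter⁻ (λ x → T? (p x)) x∈
... | x∈xs , px = x∈xs , T⇒true px

∈-filterᵇ⁺ : ∀ {A : Set} (p : A → Bool) {x xs} → x ∈ xs → p x ≡ true → x ∈ filterᵇ p xs
∈-filterᵇ⁺ p x∈ px = ∈-filter⁺ (λ x → T? (p x)) x∈ (true⇒T px)

indicator : Bool → ℕ
indicator b = if b then 1 else 0

indicator≤1 : ∀ b → indicator b ≤ 1
indicator≤1 false = z≤n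
indicator≤1 true  = ≤-refl

total : ∀ {A : Set} → (A → ℕ) → List A → ℕ
total f []       = 0
total f (x ∷ xs) = f x + total f xs

total-cong : ∀ {A : Set} {f g : A → ℕ} xs → (∀ x → x ∈ xs → f x ≡ g x) → total f xs ≡ total g xs
total-cong []       eq = refl
total-cong (x ∷ xs) eq = cong₂ _+_ (eq x (here refl)) (total-cong xs λ y y∈ → eq y (there y∈))

total-mono : ∀ {A : Set} {f g : A → ℕ} xs → (∀ x → x ∈ xs → f x ≤ g x) → total f xs ≤ total g xs
total-mono []       le = z≤n
total-mono (x ∷ xs) le = +-mono-≤ (le x (here refl)) (total-mono xs λ y y∈ → le y (there y∈))

total-++ : ∀ {A : Set} (f : A → ℕ) xs ys → total f (xs ++ ys) ≡ total f xs + total f ys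
total-++ f []       ys = refl
total-++ f (x ∷ xs) ys = trans (cong (f x +_) (total-++ f xs ys)) (sym (+-assoc (f x) _ _))

total-map : ∀ {A B : Set} (f : B → ℕ) (g : A → B) xs → total f (map g xs) ≡ total (λ x → f (g x)) xs
total-map f g []       = refl
total-map f g (x ∷ xs) = cong (f (g x) +_) (total-map f g xs)

total-+ : ∀ {A : Set} (f g : A → ℕ) xs → total (λ x → f x + g x) xs ≡ total f xs + total g xs
total-+ f g []       = refl
total-+ f g (x ∷ xs) = trans (cong (f x + g x +_) (total-+ f g xs)) (shape (f x) (g x) _ _)
  where
  shape : ∀ a b c d → a + b + (c + d) ≡ a + c + (b + d)
  shape = solve-∀

total-*ˡ : ∀ {A : Set} k (f : A → ℕ) xs → total (λ x → k * f x) xs ≡ k * total f xs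
total-*ˡ k f []       = sym (*-zeroʳ k)
total-*ˡ k f (x ∷ xs) = trans (cong (k * f x +_) (total-*ˡ k f xs)) (sym (*-distribˡ-+ k (f x) _))

total-0 : ∀ {A : Set} {f : A → ℕ} xs → (∀ x → x ∈ xs → f x ≡ 0) → total f xs ≡ 0
total-0 []       eq = refl
total-0 (x ∷ xs) eq = cong₂ _+_ (eq x (here refl)) (total-0 xs λ y y∈ → eq y (there y∈))

total-↭ : ∀ {A : Set} (f : A → ℕ) {xs ys} → xs ↭ ys → total f xs ≡ total f ys
total-↭ f _↭_.refl          = refl
total-↭ f (prep x p)    = cong (f x +_) (total-↭ f p)
total-↭ f (swap {ys = ys} x y p) = trans (cong (λ n → f x + (f y + n)) (total-↭ f p)) (shape (f x) (f y) (total f ys))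
  where
  shape : ∀ a b c → a + (b + c) ≡ b + (a + c)
  shape = solve-∀
total-↭ f (_↭_.trans p q)   = trans (total-↭ f p) (total-↭ f q)

total≤length : ∀ {A : Set} (p : A → Bool) xs → total (λ x → indicator (p x)) xs ≤ length xs
total≤length p []       = z≤n
total≤length p (x ∷ xs) = +-mono-≤ (indicator≤1 (p x)) (total≤length p xs)

length-filterᵇ : ∀ {A : Set} (p : A → Bool) xs → length (filterᵇ p xs) ≡ total (λ x → indicator (p x)) xs
length-filterᵇ p []       = refl
length-filterᵇ p (x ∷ xs) with p x
... | true  = cong suc (length-filterᵇ p xs)
... | false = length-filterᵇ p xs

indicator-mono : ∀ {b c} → (b ≡ true → c ≡ true) → indicator b ≤ indicator c
indicator-mono {false} f = z≤n
indicator-mono {true}  f rewrite f refl = ≤-refl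

total-strict : ∀ {A : Set} {f g : A → ℕ} {x} xs → (∀ y → f y ≤ g y) → x ∈ xs → f x < g x → total f xs < total g xs
total-strict (x ∷ xs) le (here refl) lt = +-mono-≤ lt (total-mono xs λ y _ → le y)
total-strict {f = f} {g} (y ∷ xs) le (there x∈) lt =
  ≤-trans (≤-reflexive (sym (+-suc (f y) _))) (+-mono-≤ (le y) (total-strict xs le x∈ lt))

∈⇒↭ : ∀ {A : Set} {x : A} {xs} → x ∈ xs → ∃[ ys ] xs ↭ x ∷ ys
∈⇒↭ {xs = x ∷ xs} (here refl) = xs , ↭-refl
∈⇒↭ {xs = y ∷ xs} (there x∈) with ∈⇒↭ x∈
... | ys , p = y ∷ ys , ↭-trans (prep y p) (swap y _ ↭-refl)

∈-tail : ∀ {A : Set} {x y : A} {xs} → x ∈ y ∷ xs → x ≢ y → x ∈ xs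
∈-tail (here eq)  x≢y = contradiction eq x≢y
∈-tail (there x∈) _   = x∈

unique-tail : ∀ {A : Set} {x : A} {xs} → Unique (x ∷ xs) → Unique xs
unique-tail (_ ∷ uniq) = uniq

-- Correctness of the search and of minimum cuts

module FlowProperties {Arc : Set} (src tgt : Arc → ℕ) (rev : Arc → Arc) (_==_ : Arc → Arc → Bool)
  (src-rev : ∀ α → src (rev α) ≡ tgt α) (tgt-rev : ∀ α → tgt (rev α) ≡ src α)
  (==-sound : ∀ {α β} → (α == β) ≡ true → α ≡ β) (==-refl : ∀ α → (α == α) ≡ true) where

  open Flow src tgt rev _==_

  leaves enters : (ℕ → Bool) → Arc → Bool
  leaves X α = X (src α) ∧ not (X (tgt α))
  enters X α = not (X (src α)) ∧ X (tgt α)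

  out into : (ℕ → Bool) → List Arc → ℕ
  out  X = total (λ α → indicator (leaves X α))
  into X = total (λ α → indicator (enters X α))

  leaves-rev : ∀ X α → leaves X (rev α) ≡ enters X α
  leaves-rev X α rewrite src-rev α | tgt-rev α with X (src α) | X (tgt α)
  ... | true  | true  = refl
  ... | true  | false = refl
  ... | false | true  = refl
  ... | false | false = refl

  out-rev : ∀ X A → out X (map rev A) ≡ into X A
  out-rev X A = trans (total-map _ rev A) (total-cong A λ α _ → cong indicator (leaves-rev X α))

  data Chain : ℕ → ℕ → List Arc → Set where
    []  : ∀ {v} → Chain v v []
    _∷_ : ∀ α {v P} → Chain (tgt α) v P → Chain (src α) v (α ∷ P)

  _∷ʳᶜ_ : ∀ {u P} → (α : Arc) → Chain u (src α) P → Chain u (tgt α) (P ++ α ∷ [])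
  α ∷ʳᶜ []      = α ∷ []
  α ∷ʳᶜ (β ∷ c) = β ∷ (α ∷ʳᶜ c)

  -- Departures from `X` and arrivals in it alternate along a chain, so their numbers differ only by
  -- the membership of the two ends.
  chain-net : ∀ X {u v P} → Chain u v P → out X P + indicator (X v) ≡ into X P + indicator (X u)
  chain-net X []            = refl
  chain-net X {v = v} (_∷_ α {P = P} c) = trans (+-assoc (indicator (leaves X α)) (out X P) _)
    (trans (cong (indicator (leaves X α) +_) (chain-net X c)) (lemma (X (src α)) (X (tgt α)) (into X P)))
    where
    lemma : ∀ b c n → indicator (b ∧ not c) + (n + indicator c) ≡ indicator (not b ∧ c) + n + indicator b
    lemma true  true  n = refl
    lemma true  false n = trans (cong suc (+-identityʳ n)) (+-comm 1 n)
    lemma false true  n = trans (+-comm n 1) (sym (+-identityʳ (suc n)))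
    lemma false false n = refl

  flip-↭ : ∀ {α} A → α ∈ A → ∃[ Q ] A ↭ α ∷ Q × flip A α ↭ rev α ∷ Q
  flip-↭ {α} A α∈ with status A
    where
    done? : List Arc → Bool
    done? A = proj₁ (foldr (flipArc α) (false , []) A)
    status : ∀ A → (done? A ≡ true × ∃[ Q ] A ↭ α ∷ Q × flip A α ↭ rev α ∷ Q)
                 ⊎ (done? A ≡ false × flip A α ≡ A × α ∉ A)
    status []      = inj₂ (refl , refl , ∉[])
    status (x ∷ A) with foldr (flipArc α) (false , []) A | status A
    ... | true  , B | inj₁ (_ , Q , p , r) = inj₁ (refl , x ∷ Q
          , ↭-trans (prep x p) (swap x α ↭-refl) , ↭-trans (prep x r) (swap x (rev α) ↭-refl))
    ... | false , B | inj₂ (_ , refl , α∉) with x == α in eq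
    ...   | true  = inj₁ (refl , A , ↭-reflexive (cong (_∷ A) (==-sound eq)) , ↭-reflexive (cong (λ y → rev y ∷ A) (==-sound eq)))
    ...   | false = inj₂ (refl , refl , λ { (here refl) → true≢false (==-refl α) eq ; (there α∈) → α∉ α∈ })
  ... | inj₁ (_ , res)    = res
  ... | inj₂ (_ , _ , α∉) = contradiction α∈ α∉

  -- The invariant is a parameter because minimum cuts are used twice: the algorithm takes the
  -- trivial one, and Menger's theorem one that remembers the flow.
  Preserved : (List Arc → Set) → Set
  Preserved I = ∀ {α A A′ Q} → A ↭ α ∷ Q → A′ ↭ rev α ∷ Q → I A → I A′

  module _ (I : List Arc → Set) (pres : Preserved I) where

    -- Reversing an arc trades a departure from `X` for an arrival. Since `P` has no repetition, its
    -- remaining arcs are still present after the earlier ones have been reversed.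
    flips-spec : ∀ P A → Unique P → All (_∈ A) P → I A →
      I (foldl flip A P) × (∀ X → out X (foldl flip A P) + out X P ≡ out X A + into X P)
    flips-spec []      A _ _ i = i , λ X → refl
    flips-spec (α ∷ P) A (α≢ ∷ uniq) (α∈ ∷ P∈) i with flip-↭ A α∈
    ... | Q , A↭ , A′↭ with flips-spec P (flip A α) uniq (All.tabulate remains) (pres A↭ A′↭ i)
      where
      remains : ∀ {β} → β ∈ P → β ∈ flip A α
      remains β∈ = Perm.∈-resp-↭ (↭-sym A′↭)
        (there (∈-tail (Perm.∈-resp-↭ A↭ (All.lookup P∈ β∈)) (λ eq → All.lookup α≢ β∈ (sym eq))))
    ...   | i′ , eq = i′ , λ X → let open ≡-Reasoning in begin
      out X A″ + (l X + out X P) ≡⟨ shape₁ (out X A″) (l X) (out X P) ⟩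
      l X + (out X A″ + out X P) ≡⟨ cong (l X +_) (eq X) ⟩
      l X + (out X (flip A α) + into X P) ≡⟨ cong (λ n → l X + (n + into X P)) (total-↭ _ A′↭) ⟩
      l X + (indicator (leaves X (rev α)) + out X Q + into X P)
        ≡⟨ cong (λ b → l X + (indicator b + out X Q + into X P)) (leaves-rev X α) ⟩
      l X + (e X + out X Q + into X P) ≡⟨ shape₂ (l X) (e X) (out X Q) (into X P) ⟩
      l X + out X Q + (e X + into X P) ≡⟨ cong (_+ (e X + into X P)) (total-↭ _ A↭) ⟨
      out X A + (e X + into X P) ∎
      where
      A″ = foldl flip (flip A α) P
      l e : (ℕ → Bool) → ℕ
      l X = indicator (leaves X α)
      e X = indicator (enters X α)
      shape₁ : ∀ a b c → a + (b + c) ≡ b + (a + c)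
      shape₁ = solve-∀
      shape₂ : ∀ a b c d → a + (b + c + d) ≡ a + c + (b + d)
      shape₂ = solve-∀

  data Valid (s : ℕ) : List Arc → Set where
    []  : Valid s []
    grown : ∀ {α tree} → visited s tree (src α) ≡ true → visited s tree (tgt α) ≡ false →
            Valid s tree → Valid s (α ∷ tree)

  visited-root : ∀ s tree → visited s tree s ≡ true
  visited-root s tree rewrite ≡ᵇ-refl s = refl

  visited-∈ : ∀ s {α tree} → α ∈ tree → visited s tree (tgt α) ≡ true
  visited-∈ s {α} α∈ = ∨-trueʳ (tgt α ≡ᵇ s) (any⁺ _ α∈ (≡ᵇ-refl (tgt α)))

  visited-there : ∀ s α tree v → visited s tree v ≡ true → visited s (α ∷ tree) v ≡ true
  visited-there s α tree v eq with ∨-true {v ≡ᵇ s} eq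
  ... | inj₁ eq′ rewrite eq′ = refl
  ... | inj₂ eq′ = ∨-trueʳ (v ≡ᵇ s) (∨-trueʳ (tgt α ≡ᵇ v) eq′)

  visited⁻ : ∀ s tree v → visited s tree v ≡ true → v ≡ s ⊎ (∃[ α ] α ∈ tree × tgt α ≡ v)
  visited⁻ s tree v eq with ∨-true {v ≡ᵇ s} eq
  ... | inj₁ eq′ = inj₁ (≡ᵇ-true eq′)
  ... | inj₂ eq′ with any⁻ _ tree eq′
  ...   | α , α∈ , eq″ = inj₂ (α , α∈ , ≡ᵇ-true eq″)

  Closed : ℕ → List Arc → List Arc → Set
  Closed s A tree = ∀ {α} → α ∈ A → visited s tree (src α) ≡ true → visited s tree (tgt α) ≡ true

  module _ (s : ℕ) (A : List Arc) where

    reached : List Arc → ℕ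
    reached tree = total (λ α → indicator (visited s tree (tgt α))) A

    Grown : ℕ → List Arc → Set
    Grown k tree = Valid s tree × All (_∈ A) tree × (Closed s A tree ⊎ k ≤ reached tree)

    grow-spec : ∀ k tree → Grown k tree → Grown (suc k) (grow s A tree)
    grow-spec k tree (val , tree∈ , prog)
      with frontier s A tree | (λ {α} → ∈-filterᵇ⁻ (λ α → visited s tree (src α) ∧ not (visited s tree (tgt α))) {α} {A})
         | (λ {α} → ∈-filterᵇ⁺ (λ α → visited s tree (src α) ∧ not (visited s tree (tgt α))) {α} {A})
    ... | []    | _ | filter⁺ = val , tree∈ , inj₁ closed
      where
      closed : Closed s A tree
      closed {α} α∈ vis with visited s tree (tgt α) in eq
      ... | true  = refl
      ... | false = contradiction (filter⁺ α∈ (subst₂ (λ b c → b ∧ not c ≡ true) (sym vis) (sym eq) refl)) ∉[]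
    ... | β ∷ _ | filter⁻ | _ with filter⁻ (here refl)
    ...   | β∈ , new with ∧-true {visited s tree (src β)} new
    ...     | srcVis , tgtNew = grown srcVis (not-true tgtNew) val , β∈ ∷ tree∈ , inj₂ (bigger prog)
      where
      more : reached tree < reached (β ∷ tree)
      more = total-strict A (λ α → indicator-mono (visited-there s β tree (tgt α))) β∈
        (subst₂ (λ b c → indicator b < indicator c) (sym (not-true tgtNew)) (sym (visited-∈ s {β} {β ∷ tree} (here refl))) ≤-refl)
      bigger : Closed s A tree ⊎ k ≤ reached tree → suc k ≤ reached (β ∷ tree)
      bigger (inj₁ closed) = ⊥-elim (true≢false (closed β∈ srcVis) (not-true tgtNew))
      bigger (inj₂ k≤)     = ≤-trans (s≤s k≤) more

    iter-grow-spec : ∀ k → Grown k (iter k (grow s A) [])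
    iter-grow-spec zero    = [] , [] , inj₂ z≤n
    iter-grow-spec (suc k) = grow-spec k _ (iter-grow-spec k)

    search-spec : Valid s (search s A) × All (_∈ A) (search s A) × Closed s A (search s A)
    search-spec with iter-grow-spec (length A + 1)
    ... | val , tree∈ , inj₁ closed = val , tree∈ , closed
    ... | val , tree∈ , inj₂ k≤     = contradiction (≤-trans (≤-reflexive (+-comm 1 (length A))) (≤-trans k≤ (total≤length _ A))) 1+n≰n

  -- When an arc joins the tree its target has not been visited, so the path already traced to its
  -- source avoids that target. This makes the path simple.
  trace-spec : ∀ s tree v acc → Valid s tree → visited s tree v ≡ true →
    ∃[ P ] foldl traceArc (v , acc) tree ≡ (s , P ++ acc) × Chain s v P × All (_∈ tree) P × Unique (s ∷ map tgt P)
  trace-spec s [] v acc [] vis with visited⁻ s [] v vis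
  ... | inj₁ refl = [] , refl , [] , [] , ([] ∷ [])
  trace-spec s (α ∷ tree) v acc (grown srcVis tgtNew val) vis with tgt α ≡ᵇ v in eq
  ... | false with trace-spec s tree v acc val vis
  ...   | P , run , chain , P∈ , uniq = P , run , chain , All.map there P∈ , uniq
  trace-spec s (α ∷ tree) v acc (grown srcVis tgtNew val) vis | true
    with ≡ᵇ-true {tgt α} {v} eq | trace-spec s tree (src α) (α ∷ acc) val srcVis
  ... | refl | P , run , chain , P∈ , uniq =
    P ++ α ∷ [] , trans run (cong (s ,_) (sym (List.++-assoc P (α ∷ []) acc))) , (α ∷ʳᶜ chain)
    , All.++⁺ (All.map there P∈) (here refl ∷ [])
    , subst (λ ys → Unique (s ∷ ys)) (sym (List.map-++ tgt P (α ∷ [])))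
        (Unique.++⁺ uniq ([] ∷ []) λ { (v∈ , here refl) → new v∈ })
    where
    new : tgt α ∉ s ∷ map tgt P
    new (here eq′) = true≢false (subst (λ w → visited s tree w ≡ true) (sym eq′) (visited-root s tree)) tgtNew
    new (there v∈) with ∈-map⁻ tgt v∈
    ... | β , β∈ , eq′ = true≢false (subst (λ w → visited s tree w ≡ true) (sym eq′) (visited-∈ s (All.lookup P∈ β∈))) tgtNew

  module MinCut (s : ℕ) (sink : ℕ → Bool) (source-ok : sink s ≡ false) (I : List Arc → Set) (pres : Preserved I) where

    IsCut : (ℕ → Bool) → Set
    IsCut Y = Y s ≡ true × (∀ v → sink v ≡ true → Y v ≡ false)

    hits : List Arc → List Arc
    hits A = filterᵇ (λ α → sink (tgt α)) (search s A)

    -- Here `f` is the value of the flow so far. It has been subtracted from every cut alike, so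
    -- comparisons between cuts are unaffected.
    Progress : List Arc → ℕ → List Arc → Set
    Progress A₀ k A = I A × ∃[ f ] (∀ Y → IsCut Y → out Y A + f ≡ out Y A₀) × (hits A ≡ [] ⊎ f ≡ k)

    augment-spec : ∀ A₀ k A → Progress A₀ k A → Progress A₀ (suc k) (augment s sink A)
    augment-spec A₀ k A (i , f , flow , prog) with hits A in eq
    ... | []    = i , f , flow , inj₁ eq
    ... | α ∷ αs with ∈-filterᵇ⁻ (λ α → sink (tgt α)) {α} {search s A} (subst (α ∈_) (sym eq) (here refl)) | search-spec s A
    ...   | α∈ , sunk | val , tree∈ , _ with trace-spec s (search s A) (tgt α) [] val (visited-∈ s α∈)
    ...     | P , run , chain , P∈ , uniq
      with flips-spec I pres P A (Unique.map⁻ (unique-tail uniq)) (All.map (All.lookup tree∈) P∈) i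
    ...       | i′ , eqs = subst I (sym trace≡) i′ , suc f , flow′ , inj₂ (cong suc (count prog))
      where
      count : α ∷ αs ≡ [] ⊎ f ≡ k → f ≡ k
      count (inj₁ ())
      count (inj₂ f≡k) = f≡k
      trace≡ : foldl flip A (trace (search s A) (tgt α)) ≡ foldl flip A P
      trace≡ = cong (foldl flip A) (trans (cong proj₂ run) (List.++-identityʳ P))
      flow′ : ∀ Y → IsCut Y → out Y (foldl flip A (trace (search s A) (tgt α))) + suc f ≡ out Y A₀
      flow′ Y cut@(Ys , Yt) rewrite trace≡ = trans (+-suc (out Y A′) f) (trans (cong (_+ f) one-less) (flow Y cut))
        where
        A′ = foldl flip A P
        net : out Y P ≡ into Y P + 1
        net = trans (sym (+-identityʳ (out Y P)))
          (subst₂ (λ b c → out Y P + indicator b ≡ into Y P + indicator c) (Yt (tgt α) sunk) Ys (chain-net Y chain))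
        one-less : suc (out Y A′) ≡ out Y A
        one-less = +-cancelʳ-≡ (into Y P) (suc (out Y A′)) (out Y A) (begin
          suc (out Y A′) + into Y P ≡⟨ shape (out Y A′) (into Y P) ⟩
          out Y A′ + (into Y P + 1) ≡⟨ cong (out Y A′ +_) net ⟨
          out Y A′ + out Y P ≡⟨ eqs Y ⟩
          out Y A + into Y P ∎)
          where
          open ≡-Reasoning
          shape : ∀ a b → suc a + b ≡ a + (b + 1)
          shape = solve-∀

    iter-augment-spec : ∀ A₀ k → I A₀ → Progress A₀ k (iter k (augment s sink) A₀)
    iter-augment-spec A₀ zero    i = i , 0 , (λ Y _ → +-identityʳ (out Y A₀)) , inj₂ refl
    iter-augment-spec A₀ (suc k) i = augment-spec A₀ k _ (iter-augment-spec A₀ k i)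

    singleton-cut : IsCut (_≡ᵇ s)
    singleton-cut = ≡ᵇ-refl s , λ v sunk → not-source v sunk
      where
      not-source : ∀ v → sink v ≡ true → (v ≡ᵇ s) ≡ false
      not-source v sunk with v ≡ᵇ s in eq
      ... | false = refl
      ... | true  = ⊥-elim (true≢false (subst (λ w → sink w ≡ true) (≡ᵇ-true eq) sunk) source-ok)

    side : List Arc → ℕ → Bool
    side A = visited s (cutTree s sink A)

    residual-spec : ∀ A → I A → I (residual s sink A) × IsCut (side A) × out (side A) (residual s sink A) ≡ 0
      × ∃[ f ] (∀ Y → IsCut Y → out Y (residual s sink A) + f ≡ out Y A)
    residual-spec A i with iter-augment-spec A (length A + 1) i
    ... | i′ , f , flow , inj₂ refl = contradiction
      (≤-trans (≤-reflexive (+-comm 1 (length A)))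
        (≤-trans (m≤n+m (length A + 1) (out (_≡ᵇ s) (residual s sink A))) (≤-trans (≤-reflexive (flow (_≡ᵇ s) singleton-cut)) (total≤length _ A)))) 1+n≰n
    ... | i′ , f , flow , inj₁ noHits with search-spec s (residual s sink A)
    ...   | _ , _ , closed = i′ , (visited-root s (cutTree s sink A) , no-sink) , total-0 (residual s sink A) (λ α α∈ → no-exit α α∈) , f , flow
      where
      S = side A
      no-sink : ∀ v → sink v ≡ true → S v ≡ false
      no-sink v sunk with S v in eq
      ... | false = refl
      ... | true with visited⁻ s (cutTree s sink A) v eq
      ...   | inj₁ refl = ⊥-elim (true≢false sunk source-ok)
      ...   | inj₂ (α , α∈ , refl) = contradiction (subst (α ∈_) noHits (∈-filterᵇ⁺ (λ α → sink (tgt α)) α∈ sunk)) ∉[]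
      no-exit : ∀ α → α ∈ residual s sink A → indicator (leaves S α) ≡ 0
      no-exit α α∈ with S (src α) in eq
      ... | false = refl
      ... | true rewrite closed α∈ eq = refl

    -- No residual arc leaves the reached side, so its capacity is exactly `f`; any other cut has
    -- capacity `f` plus what is left in the residual list.
    minimum-cut : ∀ A → I A → ∀ Y → IsCut Y → out (side A) A ≤ out Y A
    minimum-cut A i Y cut with residual-spec A i
    ... | _ , cutS , empty , f , flow = begin
      out (side A) A ≡⟨ flow (side A) cutS ⟨
      out (side A) (residual s sink A) + f ≡⟨ cong (_+ f) empty ⟩
      f ≤⟨ m≤n+m f _ ⟩
      out Y (residual s sink A) + f ≡⟨ flow Y cut ⟩
      out Y A ∎
      where open ≤-Reasoning

-- Menger's theorem

unique-⊆⇒↭ : ∀ {A : Set} {xs ys : List A} → Unique xs → All (_∈ ys) xs → ∃[ zs ] ys ↭ xs ++ zs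
unique-⊆⇒↭ {ys = ys} []          []         = ys , ↭-refl
unique-⊆⇒↭           (x≢ ∷ uniq) (x∈ ∷ xs∈) with ∈⇒↭ x∈
... | ys′ , p with unique-⊆⇒↭ uniq (All.tabulate λ {z} z∈ →
                     ∈-tail (Perm.∈-resp-↭ p (All.lookup xs∈ z∈)) (λ eq → All.lookup x≢ z∈ (sym eq)))
...   | zs , r = zs , ↭-trans p (prep _ r)

unique-↭ : ∀ {A : Set} {xs ys : List A} → xs ↭ ys → Unique xs → Unique ys
unique-↭ _↭_.refl        uniq = uniq
unique-↭ (prep x p)      (x≢ ∷ uniq) = Perm.All-resp-↭ p x≢ ∷ unique-↭ p uniq
unique-↭ (swap x y p)    ((x≢y ∷ x≢) ∷ (y≢ ∷ uniq)) =
  ((λ eq → x≢y (sym eq)) ∷ Perm.All-resp-↭ p y≢) ∷ (Perm.All-resp-↭ p x≢ ∷ unique-↭ p uniq)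
unique-↭ (_↭_.trans p q) uniq = unique-↭ q (unique-↭ p uniq)

unique-++⁻ : ∀ {A : Set} (xs : List A) {ys} → Unique (xs ++ ys) → Unique ys × Disjoint xs ys
unique-++⁻ []       uniq = uniq , λ { (() , _) }
unique-++⁻ (x ∷ xs) (x≢ ∷ uniq) with unique-++⁻ xs uniq
... | uniq′ , disj = uniq′ , λ
  { (here refl , z∈) → All.lookup x≢ (∈-++⁺ʳ xs z∈) refl
  ; (there z∈ , z∈′) → disj (z∈ , z∈′) }

module Menger (G : Graph) (E′ : Subset.Subset (Graph.#E G)) where
  open Graph G

  Arc : Set
  Arc = Fin #E × Bool

  srcV tgtV : Arc → Fin #V
  srcV (e , b) = if b then proj₁ (ends e) else proj₂ (ends e)
  tgtV (e , b) = if b then proj₂ (ends e) else proj₁ (ends e)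

  source target : Arc → ℕ
  source α = toℕ (srcV α)
  target α = toℕ (tgtV α)

  reverseArc : Arc → Arc
  reverseArc (e , b) = e , not b

  _≟ᴬ_ : (α β : Arc) → Dec (α ≡ β)
  _≟ᴬ_ = ≡-dec Fin._≟_ _≟ᵇ_

  reverse-involutive : ∀ α → reverseArc (reverseArc α) ≡ α
  reverse-involutive (e , true)  = refl
  reverse-involutive (e , false) = refl

  source-reverse : ∀ α → source (reverseArc α) ≡ target α
  source-reverse (e , true)  = refl
  source-reverse (e , false) = refl

  target-reverse : ∀ α → target (reverseArc α) ≡ source α
  target-reverse (e , true)  = refl
  target-reverse (e , false) = refl

  open Flow source target reverseArc (λ α β → ⌊ α ≟ᴬ β ⌋)
  open FlowProperties source target reverseArc (λ α β → ⌊ α ≟ᴬ β ⌋) source-reverse target-reverse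
    (λ {α} {β} eq → toWitness {a? = α ≟ᴬ β} (true⇒T eq)) (λ α → T⇒true (fromWitness {a? = α ≟ᴬ α} refl))

  present : List (Fin #E)
  present = filterᵇ (lookup E′) (allFin #E)

  bothWays : List (Fin #E) → List Arc
  bothWays []       = []
  bothWays (e ∷ es) = (e , true) ∷ (e , false) ∷ bothWays es

  crosses : (ℕ → Bool) → Fin #E → Bool
  crosses Y e = Y (toℕ (proj₁ (ends e))) xor Y (toℕ (proj₂ (ends e)))

  out-bothWays : ∀ Y es → out Y (bothWays es) ≡ total (λ e → indicator (crosses Y e)) es
  out-bothWays Y []       = refl
  out-bothWays Y (e ∷ es) = trans (sym (+-assoc (indicator (leaves Y (e , true))) _ _))
    (cong₂ _+_ (lemma (Y (toℕ (proj₁ (ends e)))) (Y (toℕ (proj₂ (ends e))))) (out-bothWays Y es))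
    where
    lemma : ∀ b c → indicator (b ∧ not c) + indicator (c ∧ not b) ≡ indicator (b xor c)
    lemma true  true  = refl
    lemma true  false = refl
    lemma false true  = refl
    lemma false false = refl

  ∈-bothWays⁻ : ∀ {α} es → α ∈ bothWays es → proj₁ α ∈ es
  ∈-bothWays⁻ (e ∷ es) (here refl)         = here refl
  ∈-bothWays⁻ (e ∷ es) (there (here refl)) = here refl
  ∈-bothWays⁻ (e ∷ es) (there (there α∈))  = there (∈-bothWays⁻ es α∈)

  unique-bothWays : ∀ {es} → Unique es → Unique (bothWays es)
  unique-bothWays []          = []
  unique-bothWays {e ∷ es} (e≢ ∷ uniq) =
    ((λ ()) ∷ All.tabulate fresh) ∷ (All.tabulate fresh ∷ unique-bothWays uniq)
    where
    fresh : ∀ {b α} → α ∈ bothWays es → (e , b) ≢ α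
    fresh α∈ refl = All.lookup e≢ (∈-bothWays⁻ es α∈) refl

  initialArcs : List Arc
  initialArcs = bothWays present

  unique-initialArcs : Unique initialArcs
  unique-initialArcs = unique-bothWays (Unique.filter⁺ (λ e → T? (lookup E′ e)) (Unique.allFin⁺ #E))

  -- A residual list arises from the initial one by reversing a flow D that
  -- uses every edge in at most one direction.
  Residual : List Arc → Set
  Residual A = ∃[ C ] ∃[ D ] initialArcs ↭ C ++ D × A ↭ C ++ map reverseArc D × Unique (map proj₁ D)

  residual-preserved : Preserved Residual
  residual-preserved {α} {A} {A′} {Q} A↭ A′↭ (C , D , init↭ , res↭ , uniq)
    with DecMembership._∈?_ _≟ᴬ_ α (map reverseArc D)
  ... | yes α∈ with ∈-map⁻ reverseArc α∈
  ...   | β , β∈ , refl with ∈⇒↭ β∈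
  ...     | D′ , D↭ = β ∷ C , D′
    , ↭-trans init↭ (↭-trans (Perm.++⁺ˡ C D↭) (Perm.shift β C D′))
    , ↭-trans A′↭ (subst (λ γ → γ ∷ Q ↭ β ∷ C ++ map reverseArc D′) (sym (reverse-involutive β)) (prep β Q↭))
    , unique-tail (unique-↭ (Perm.map⁺ proj₁ D↭) uniq)
    where
    Q↭ : Q ↭ C ++ map reverseArc D′
    Q↭ = Perm.drop-∷ (↭-trans (↭-sym A↭) (↭-trans res↭ (↭-trans (Perm.++⁺ˡ C (Perm.map⁺ reverseArc D↭))
           (Perm.shift (reverseArc β) C (map reverseArc D′)))))
  residual-preserved {α} {A} {A′} {Q} A↭ A′↭ (C , D , init↭ , res↭ , uniq) | no α∉
    with ∈-++⁻ C (Perm.∈-resp-↭ (↭-trans (↭-sym A↭) res↭) (here refl))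
  ... | inj₂ α∈ = contradiction α∈ α∉
  ... | inj₁ α∈ with ∈⇒↭ α∈
  ...   | C′ , C↭ = C′ , α ∷ D
    , ↭-trans init↭ (↭-trans (Perm.++⁺ʳ D C↭) (↭-sym (Perm.shift α C′ D)))
    , ↭-trans A′↭ (↭-trans (prep (reverseArc α) Q↭) (↭-sym (Perm.shift (reverseArc α) C′ (map reverseArc D))))
    , All.tabulate fresh ∷ uniq
    where
    Q↭ : Q ↭ C′ ++ map reverseArc D
    Q↭ = Perm.drop-∷ (↭-trans (↭-sym A↭) (↭-trans res↭ (Perm.++⁺ʳ (map reverseArc D) C↭)))
    α∉D : α ∉ D
    α∉D α∈D with unique-↭ (↭-trans init↭ (Perm.++⁺ʳ D C↭)) unique-initialArcs
    ... | α≢ ∷ _ = All.lookup α≢ (∈-++⁺ʳ C′ α∈D) refl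
    same-edge : ∀ b c → b ≡ c ⊎ b ≡ not c
    same-edge true  true  = inj₁ refl
    same-edge true  false = inj₂ refl
    same-edge false true  = inj₂ refl
    same-edge false false = inj₁ refl
    fresh : ∀ {e} → e ∈ map proj₁ D → proj₁ α ≢ e
    fresh e∈ refl with ∈-map⁻ proj₁ e∈
    ... | (_ , c) , β∈ , refl with same-edge (proj₂ α) c
    ...   | inj₁ refl = α∉D β∈
    ...   | inj₂ refl = α∉ (∈-map⁺ reverseArc β∈)

  IsPath : ℕ → ℕ → List Arc → Set
  IsPath s t P = Chain s t P × Unique (s ∷ map target P)

  module _ (s t : ℕ) (s≢t : (s ≡ᵇ t) ≡ false) where
    open MinCut s (_≡ᵇ t) s≢t Residual residual-preserved

    -- Flow decomposition, with conservation replaced by the excess of every cut. If `t` were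
    -- unreachable in `D`, the reached set would be a cut that no arc leaves; and taking away a path
    -- from `s` to `t` lowers the excess of every cut by one.
    decompose : ∀ k D → Unique (map proj₁ D) → (∀ Y → IsCut Y → into Y D + k ≤ out Y D) →
      Σ[ P ∈ (Fin k → List Arc) ] (∀ i → IsPath s t (P i) × All (_∈ D) (P i))
        × (∀ i j → i ≢ j → Disjoint (map proj₁ (P i)) (map proj₁ (P j)))
    decompose zero    D uniq net = (λ ()) , (λ ()) , λ ()
    decompose (suc k) D uniq net with search-spec s D | visited s (search s D) t in eq
    ... | val , tree∈ , closed | false = contradiction
      (≤-trans (m≤n+m (suc k) (into Y D)) (≤-trans (net Y cut) (≤-reflexive (total-0 D λ α α∈ → no-exit α α∈)))) λ ()
      where
      Y = visited s (search s D)
      cut : IsCut Y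
      cut = visited-root s (search s D) , λ v v≡t → subst (λ v → Y v ≡ false) (sym (≡ᵇ-true {v} v≡t)) eq
      no-exit : ∀ α → α ∈ D → indicator (leaves Y α) ≡ 0
      no-exit α α∈ with Y (source α) in eq′
      ... | false = refl
      ... | true rewrite closed α∈ eq′ = refl
    ... | val , tree∈ , closed | true with trace-spec s (search s D) t [] val eq
    ...   | P , _ , chain , P∈tree , simple with unique-⊆⇒↭ (Unique.map⁻ {f = target} (unique-tail simple)) (All.map (All.lookup tree∈) P∈tree)
    ...     | D′ , D↭ with unique-++⁻ (map proj₁ P) (subst Unique (List.map-++ proj₁ P D′) (unique-↭ (Perm.map⁺ proj₁ D↭) uniq))
    ...       | uniq′ , disj with decompose k D′ uniq′ net′
      where
      net′ : ∀ Y → IsCut Y → into Y D′ + k ≤ out Y D′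
      net′ Y cut@(Ys , Yt) = +-cancelˡ-≤ (into Y P + 1) _ _ (begin
        into Y P + 1 + (into Y D′ + k) ≡⟨ shape (into Y P) (into Y D′) k ⟩
        into Y P + into Y D′ + suc k ≡⟨ cong (_+ suc k) (trans (total-↭ _ D↭) (total-++ _ P D′)) ⟨
        into Y D + suc k ≤⟨ net Y cut ⟩
        out Y D ≡⟨ trans (total-↭ _ D↭) (total-++ _ P D′) ⟩
        out Y P + out Y D′ ≡⟨ cong (_+ out Y D′) unit ⟩
        into Y P + 1 + out Y D′ ∎)
        where
        open ≤-Reasoning
        shape : ∀ a b c → a + 1 + (b + c) ≡ a + b + suc c
        shape = solve-∀
        unit : out Y P ≡ into Y P + 1
        unit = trans (sym (+-identityʳ (out Y P)))
          (subst₂ (λ b c → out Y P + indicator b ≡ into Y P + indicator c) (Yt t (≡ᵇ-refl t)) Ys (chain-net Y chain))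
    ...         | Ps , paths , disjoint = Qs , good , apart
      where
      Qs : Fin (suc k) → List Arc
      Qs Fin.zero    = P
      Qs (Fin.suc i) = Ps i
      good : ∀ i → IsPath s t (Qs i) × All (_∈ D) (Qs i)
      good Fin.zero    = (chain , simple) , All.map (All.lookup tree∈) P∈tree
      good (Fin.suc i) = proj₁ (paths i) , All.map (λ α∈ → Perm.∈-resp-↭ (↭-sym D↭) (∈-++⁺ʳ P α∈)) (proj₂ (paths i))
      later : ∀ {e} i → e ∈ map proj₁ (Ps i) → e ∈ map proj₁ D′
      later i e∈ with ∈-map⁻ proj₁ e∈
      ... | α , α∈ , refl = ∈-map⁺ proj₁ (All.lookup (proj₂ (paths i)) α∈)
      apart : ∀ i j → i ≢ j → Disjoint (map proj₁ (Qs i)) (map proj₁ (Qs j))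
      apart Fin.zero    Fin.zero    i≢j = contradiction refl i≢j
      apart Fin.zero    (Fin.suc j) _   (e∈ , e∈′) = disj (e∈ , later j e∈′)
      apart (Fin.suc i) Fin.zero    _   (e∈ , e∈′) = disj (e∈′ , later i e∈)
      apart (Fin.suc i) (Fin.suc j) i≢j = disjoint i j (λ eq → i≢j (cong Fin.suc eq))

  srcV-joins : ∀ α → Joins G (proj₁ α) (srcV α) (tgtV α)
  srcV-joins (e , true)  = inj₁ refl
  srcV-joins (e , false) = inj₂ refl

  chain⇒walk : ∀ {x y P} → Chain x y P → All (λ α → proj₁ α Subset.∈ E′) P → ∀ {u v} → x ≡ toℕ u → y ≡ toℕ v →
    Σ[ w ∈ Walk G E′ u v ] map toℕ (vertices G w) ≡ x ∷ map target P × edges G w ≡ map proj₁ P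
  chain⇒walk [] [] x≡ y≡ with Fin.toℕ-injective (trans (sym x≡) y≡)
  ... | refl = stop , cong (_∷ []) (sym x≡) , refl
  chain⇒walk (α ∷ c) (α∈ ∷ P∈) {u} x≡ y≡ with Fin.toℕ-injective x≡ | chain⇒walk c P∈ {tgtV α} refl y≡
  ... | refl | w , verts , eds = step (proj₁ α) α∈ (srcV-joins α) w , cong (toℕ (srcV α) ∷_) verts , cong (proj₁ α ∷_) eds

  menger : ∀ {s t : Fin #V} → s ≢ t → ∀ K →
    (∃[ Y ] Y (toℕ s) ≡ true × Y (toℕ t) ≡ false × total (λ e → indicator (crosses Y e)) present ≤ K)
    ⊎ (Σ[ P ∈ (Fin (suc K) → Path G E′ s t) ] EdgeDisjoint G P)
  menger {s} {t} s≢t K = conclude (residual-spec initialArcs start)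
    where
    source-ok : (toℕ s ≡ᵇ toℕ t) ≡ false
    source-ok with toℕ s ≡ᵇ toℕ t in eq
    ... | false = refl
    ... | true  = contradiction (Fin.toℕ-injective (≡ᵇ-true eq)) s≢t
    open MinCut (toℕ s) (_≡ᵇ toℕ t) source-ok Residual residual-preserved
    start : Residual initialArcs
    start = initialArcs , [] , ↭-reflexive (sym (List.++-identityʳ initialArcs)) , ↭-reflexive (sym (List.++-identityʳ initialArcs)) , []
    Outcome : Set
    Outcome = (∃[ Y ] Y (toℕ s) ≡ true × Y (toℕ t) ≡ false × total (λ e → indicator (crosses Y e)) present ≤ K)
      ⊎ (Σ[ P ∈ (Fin (suc K) → Path G E′ s t) ] EdgeDisjoint G P)
    from-flow : ∀ A′ Y f → Residual A′ → IsCut Y → out Y A′ ≡ 0 →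
      (∀ Z → IsCut Z → out Z A′ + f ≡ out Z initialArcs) → Outcome
    from-flow A′ Y f (C , D , init↭ , res↭ , uniq) (Ys , Yt) empty flow with f ≤? K
    ... | yes f≤K = inj₁ (Y , Ys , Yt (toℕ t) (≡ᵇ-refl (toℕ t)) , ≤-trans (≤-reflexive value) f≤K)
      where
      value : total (λ e → indicator (crosses Y e)) present ≡ f
      value = trans (sym (out-bothWays Y present)) (trans (sym (flow Y (Ys , Yt))) (cong (_+ f) empty))
    ... | no f≰K with decompose (toℕ s) (toℕ t) source-ok (suc K) D uniq net
      where
      net : ∀ Z → IsCut Z → into Z D + suc K ≤ out Z D
      -- The arcs `C` without flow occur in both the initial and the residual list and cancel, which
      -- leaves `f` as the net value of `D`.
      net Z cut = ≤-trans (+-monoʳ-≤ (into Z D) (≰⇒> f≰K)) (≤-reflexive (+-cancelˡ-≡ (out Z C) _ _ (begin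
        out Z C + (into Z D + f) ≡⟨ +-assoc (out Z C) (into Z D) f ⟨
        out Z C + into Z D + f ≡⟨ cong (λ n → out Z C + n + f) (out-rev Z D) ⟨
        out Z C + out Z (map reverseArc D) + f ≡⟨ cong (_+ f) (trans (total-↭ _ res↭) (total-++ _ C (map reverseArc D))) ⟨
        out Z A′ + f ≡⟨ flow Z cut ⟩
        out Z initialArcs ≡⟨ trans (total-↭ _ init↭) (total-++ _ C D) ⟩
        out Z C + out Z D ∎)))
        where open ≡-Reasoning
    ...   | Ps , paths , disjoint = inj₂ (path , apart)
      where
      usable : ∀ {α} → α ∈ D → proj₁ α Subset.∈ E′
      usable {α} α∈ = lookup⇒[]= (proj₁ α) E′ (proj₂ (∈-filterᵇ⁻ (lookup E′) {xs = allFin #E}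
        (∈-bothWays⁻ present (Perm.∈-resp-↭ (↭-sym init↭) (∈-++⁺ʳ C α∈)))))
      walk : ∀ i → Σ[ w ∈ Walk G E′ s t ] map toℕ (vertices G w) ≡ toℕ s ∷ map target (Ps i) × edges G w ≡ map proj₁ (Ps i)
      walk i = chain⇒walk (proj₁ (proj₁ (paths i))) (All.map usable (proj₂ (paths i))) refl refl
      path : Fin (suc K) → Path G E′ s t
      path i = proj₁ (walk i) , Unique.map⁻ {f = toℕ} (subst Unique (sym (proj₁ (proj₂ (walk i)))) (proj₂ (proj₁ (paths i))))
      apart : EdgeDisjoint G path
      apart i j i≢j (e∈ , e∈′) = disjoint i j i≢j
        (subst (_ ∈_) (proj₂ (proj₂ (walk i))) e∈ , subst (_ ∈_) (proj₂ (proj₂ (walk j))) e∈′)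
    conclude : Residual (residual (toℕ s) (_≡ᵇ toℕ t) initialArcs) × IsCut (side initialArcs)
      × out (side initialArcs) (residual (toℕ s) (_≡ᵇ toℕ t) initialArcs) ≡ 0
      × ∃[ f ] (∀ Z → IsCut Z → out Z (residual (toℕ s) (_≡ᵇ toℕ t) initialArcs) + f ≡ out Z initialArcs) → Outcome
    conclude (res , cut , empty , f , flow) = from-flow _ (side initialArcs) f res cut empty flow

-- Programs for augmenting paths

swapArc : ⟦ arcT ⟧ → ⟦ arcT ⟧
swapArc α = proj₂ α , proj₁ α

sameArc : ⟦ arcT ⟧ → ⟦ arcT ⟧ → Bool
sameArc α β = (proj₁ α ≡ᵇ proj₁ β) ∧ (proj₂ α ≡ᵇ proj₂ β)

open Flow {⟦ arcT ⟧} proj₁ proj₂ swapArc sameArc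

module _ {Γ s tree v} (S : PT Γ nat s) (R : PT Γ (list arcT) tree) (V : PT Γ nat v) where

  visitedᴾ : PT Γ bool (λ ρ → visited (s ρ) (tree ρ) (v ρ))
  visitedᴾ = (V ≡ᵇᴾ S) ∨ᴾ anyᴾ R ((sndᴾ ∘ᴾ sndᴾ) ≡ᵇᴾ wk V)

sz-filter : ∀ A p (xs : List ⟦ A ⟧) → sz (list A) (filterᵇ p xs) ≤ sz (list A) xs
sz-filter A p []       = ≤-refl
sz-filter A p (x ∷ xs) with p x
... | true  = s≤s (+-monoʳ-≤ (sz A x) (sz-filter A p xs))
... | false = ≤-trans (sz-filter A p xs) (≤-trans (m≤n+m _ (sz A x)) (n≤1+n _))

sz-grow : ∀ s A tree → sz (list arcT) (grow s A tree) ≤ sz (list arcT) tree + sz (list arcT) A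
sz-grow s A tree = ≤-trans (first (frontier s A tree)) (+-monoʳ-≤ _ (sz-filter arcT _ A))
  where
  first : ∀ xs → sz (list arcT) (foldr (λ α _ → α ∷ tree) tree xs) ≤ sz (list arcT) tree + sz (list arcT) xs
  first []       = m≤m+n _ _
  first (x ∷ xs) = ≤-trans (≤-reflexive (sz-∷ arcT x tree)) (+-monoʳ-≤ (sz (list arcT) tree) (s≤s (m≤m+n (sz arcT x) _)))

growᴾ : ∀ {Γ s A tree} → PT Γ nat s → PT Γ (list arcT) A → PT Γ (list arcT) tree →
        PT Γ (list arcT) (λ ρ → grow (s ρ) (A ρ) (tree ρ))
growᴾ S As R = headOrᴾ
  (filterᴾ As (visitedᴾ (wk S) (wk R) (fstᴾ ∘ᴾ sndᴾ) ∧ᴾ notᴾ (visitedᴾ (wk S) (wk R) (sndᴾ ∘ᴾ sndᴾ))))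
  R (sndᴾ ∷ᴾ wk R)

searchᴾ : ∀ {Γ s A} → PT Γ nat s → PT Γ (list arcT) A → PT Γ (list arcT) (λ ρ → search (s ρ) (A ρ))
searchᴾ {s = s} {A} S As = iterᴾ (lengthᴾ As +ᴾ constᴾ 1) (constᴾ []) (growᴾ (wk S) (wk As) sndᴾ) (bound As)
  λ a acc → ≤-trans (sz-grow (s a) (A a) acc) (+-monoʳ-≤ (sz (list arcT) acc) (small As a))

traceᴾ : ∀ {Γ tree v} → PT Γ (list arcT) tree → PT Γ nat v → PT Γ (list arcT) (λ ρ → trace (tree ρ) (v ρ))
traceᴾ {Γ} R V = sndᴾ ∘ᴾ foldl-sizeᴾ R (V ,ᴾ constᴾ [])
  (ifᴾ ((sndᴾ ∘ᴾ wk sndᴾ) ≡ᵇᴾ (fstᴾ ∘ᴾ sndᴾ)) ((fstᴾ ∘ᴾ wk sndᴾ) ,ᴾ (wk sndᴾ ∷ᴾ (sndᴾ ∘ᴾ sndᴾ))) sndᴾ)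
  (con 1 ⊞ arg ⊞ arg) grows
  where
  grows : ∀ a x acc → sz (nat ⊗ list arcT) (traceArc acc x) ≤ sz (nat ⊗ list arcT) acc + (1 + (sz Γ a + sz arcT x) + (sz Γ a + sz arcT x))
  grows a x (v , P) with proj₂ x ≡ᵇ v
  ... | false = m≤m+n _ _
  ... | true  = begin
    suc (sz nat (proj₁ x) + suc (sz arcT x + sz (list arcT) P)) ≤⟨ s≤s (+-monoˡ-≤ _ (≤-trans (m≤m+n (sz nat (proj₁ x)) _) (n≤1+n _))) ⟩
    suc (sz arcT x + suc (sz arcT x + sz (list arcT) P)) ≡⟨ shape (sz arcT x) (sz (list arcT) P) ⟩
    suc (sz (list arcT) P) + (1 + sz arcT x + sz arcT x) ≤⟨ +-mono-≤ (s≤s (m≤n+m (sz (list arcT) P) (sz nat v)))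
                                                                  (+-mono-≤ (s≤s (m≤n+m (sz arcT x) (sz Γ a))) (m≤n+m (sz arcT x) (sz Γ a))) ⟩
    suc (sz nat v + sz (list arcT) P) + (1 + (sz Γ a + sz arcT x) + (sz Γ a + sz arcT x)) ∎
    where
    open ≤-Reasoning
    shape : ∀ x p → suc (x + suc (x + p)) ≡ suc p + (1 + x + x)
    shape = solve-∀

swapArcᴾ : ∀ {Γ α} → PT Γ arcT α → PT Γ arcT (λ ρ → swapArc (α ρ))
swapArcᴾ P = (sndᴾ ∘ᴾ P) ,ᴾ (fstᴾ ∘ᴾ P)

flipᴾ : ∀ {Γ A α} → PT Γ (list arcT) A → PT Γ arcT α → PT Γ (list arcT) (λ ρ → flip (A ρ) (α ρ))
flipᴾ {Γ} {A} {α} As P = sndᴾ ∘ᴾ foldrᴾ As (constᴾ (false , []))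
  (ifᴾ (notᴾ (fstᴾ ∘ᴾ sndᴾ) ∧ᴾ (((fstᴾ ∘ᴾ wk sndᴾ) ≡ᵇᴾ (fstᴾ ∘ᴾ wk (wk P))) ∧ᴾ ((sndᴾ ∘ᴾ wk sndᴾ) ≡ᵇᴾ (sndᴾ ∘ᴾ wk (wk P)))))
       (constᴾ true ,ᴾ (swapArcᴾ (wk sndᴾ) ∷ᴾ (sndᴾ ∘ᴾ sndᴾ)))
       ((fstᴾ ∘ᴾ sndᴾ) ,ᴾ (wk sndᴾ ∷ᴾ (sndᴾ ∘ᴾ sndᴾ))))
  (con 3 ⊞ (con 1 ⊞ arg)) grows
  where
  open ≤-Reasoning
  cons≤ : ∀ d d′ y w (B : List ⟦ arcT ⟧) → sz bool d′ ≤ sz bool d + 3 → sz arcT y ≤ w →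
    sz (bool ⊗ list arcT) (d′ , y ∷ B) ≤ sz (bool ⊗ list arcT) (d , B) + (3 + (1 + w))
  cons≤ d d′ y w B d≤ y≤ = begin
    suc (sz bool d′ + suc (sz arcT y + sz (list arcT) B)) ≤⟨ s≤s (+-mono-≤ d≤ (s≤s (+-monoˡ-≤ (sz (list arcT) B) y≤))) ⟩
    suc ((sz bool d + 3) + suc (w + sz (list arcT) B)) ≡⟨ shape (sz bool d) w (sz (list arcT) B) ⟩
    suc (sz bool d + sz (list arcT) B) + (3 + (1 + w)) ∎
    where
    shape : ∀ d w b → suc ((d + 3) + suc (w + b)) ≡ suc (d + b) + (3 + (1 + w))
    shape = solve-∀
  grows : ∀ a x acc → sz (bool ⊗ list arcT) (flipArc (α a) x acc) ≤ sz (bool ⊗ list arcT) acc + (3 + (1 + (sz Γ a + sz arcT x)))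
  grows a x (d , B) with not d ∧ sameArc x (α a)
  ... | true  = cons≤ d true (swapArc x) _ B (m≤n+m 3 _)
                  (≤-trans (≤-reflexive (cong suc (+-comm (sz nat (proj₂ x)) _))) (m≤n+m (sz arcT x) (sz Γ a)))
  ... | false = cons≤ d d x _ B (m≤m+n _ 3) (m≤n+m (sz arcT x) (sz Γ a))

sz-flip : ∀ A α → sz (list arcT) (flip A α) ≡ sz (list arcT) A
sz-flip []      α = refl
sz-flip (x ∷ A) α with foldr (flipArc α) (false , []) A | sz-flip A α
... | d , B | eq with not d ∧ sameArc x α
... | true  = cong suc (cong₂ _+_ (cong suc (+-comm (sz nat (proj₂ x)) _)) eq)
... | false = cong (λ n → suc (sz arcT x + n)) eq

sz-flips : ∀ P A → sz (list arcT) (foldl flip A P) ≡ sz (list arcT) A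
sz-flips []      A = refl
sz-flips (α ∷ P) A = trans (sz-flips P (flip A α)) (sz-flip A α)

isSink : List ℕ → ℕ → Bool
isSink ts v = any (λ t → t ≡ᵇ v) ts

isSinkᴾ : ∀ {Γ ts v} → PT Γ (list nat) ts → PT Γ nat v → PT Γ bool (λ ρ → isSink (ts ρ) (v ρ))
isSinkᴾ T V = anyᴾ T (sndᴾ ≡ᵇᴾ wk V)

augmentᴾ : ∀ {Γ s ts A} → PT Γ nat s → PT Γ (list nat) ts → PT Γ (list arcT) A →
           PT Γ (list arcT) (λ ρ → augment (s ρ) (isSink (ts ρ)) (A ρ))
augmentᴾ S T As = headOrᴾ
  (filterᴾ (searchᴾ S As) (isSinkᴾ (wk T) (sndᴾ ∘ᴾ sndᴾ))) As
  (foldl-sizeᴾ (traceᴾ (searchᴾ (wk S) (wk As)) (sndᴾ ∘ᴾ sndᴾ)) (wk As) (flipᴾ sndᴾ (wk sndᴾ))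
    (con 0) (λ a x acc → ≤-trans (≤-reflexive (sz-flip acc x)) (m≤m+n _ 0)))

sz-augment : ∀ s sink A → sz (list arcT) (augment s sink A) ≡ sz (list arcT) A
sz-augment s sink A with filterᵇ (λ α → sink (proj₂ α)) (search s A)
... | []    = refl
... | α ∷ _ = sz-flips (trace (search s A) (proj₂ α)) A

cutTreeᴾ : ∀ {Γ s ts A} → PT Γ nat s → PT Γ (list nat) ts → PT Γ (list arcT) A →
           PT Γ (list arcT) (λ ρ → cutTree (s ρ) (isSink (ts ρ)) (A ρ))
cutTreeᴾ {s = s} {ts} S T As = searchᴾ S (iterᴾ (lengthᴾ As +ᴾ constᴾ 1) As (augmentᴾ (wk S) (wk T) sndᴾ) (con 0)
  λ a acc → ≤-trans (≤-reflexive (sz-augment (s a) (isSink (ts a)) acc)) (m≤m+n _ 0))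

-- The algorithm

candidateT trialT cutT : Ty
candidateT = costT ⊗ nat
trialT     = candidateT ⊗ nat
cutT       = candidateT ⊗ (nat ⊗ list arcT)

-- A candidate (c , i) stands for the threshold c / i.  The level of an edge
-- of cost c′ is the least v ≤ N with c′ ≤ v · c / i (and N if there is none).
level : ℕ → ⟦ candidateT ⟧ → ⟦ costT ⟧ → ℕ
level N μ c′ = iter N (λ v → if costLess v (proj₁ μ) (proj₂ μ) c′ then suc v else v) 0

-- An undirected edge becomes as many unit arcs in each direction as its level. This is affordable
-- because levels are at most `N`, whereas the costs themselves may be exponential.
network : ℕ → ⟦ candidateT ⟧ → List ⟦ edgeT ⟧ → List ⟦ arcT ⟧
network N μ = concatMap λ e →
  replicate (level N μ (proj₂ e)) (proj₁ e) ++ replicate (level N μ (proj₂ e)) (swapArc (proj₁ e))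

-- The minimum with n never applies; it makes the growth of the accumulator
-- evidently bounded.
range : ℕ → List ℕ
range n = iter n (λ is → suc (n ⊓ length is) ∷ is) []

-- The threshold 0, at which every edge of positive cost has level N, takes
-- care of instances with optimum 0.
zeroCost : ⟦ costT ⟧
zeroCost = [] , true ∷ []

candidates : ℕ → List ⟦ edgeT ⟧ → List ⟦ candidateT ⟧
candidates N es = (zeroCost , 1) ∷ concatMap (λ e → map (λ i → proj₂ e , i) (range (N ∸ 1))) es

without : ℕ → List ℕ → List ℕ
without t = filterᵇ (λ v → not (v ≡ᵇ t))

module _ (N : ℕ) (es : List ⟦ edgeT ⟧) (R : List ℕ) where

  trialTree : ⟦ trialT ⟧ → List ⟦ arcT ⟧
  trialTree x = cutTree (proj₂ x) (isSink (without (proj₂ x) R)) (network N (proj₁ x) es)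

  trialSide : ⟦ trialT ⟧ → ℕ → Bool
  trialSide x = visited (proj₂ x) (trialTree x)

  trialSize : ⟦ trialT ⟧ → ℕ
  trialSize x = length (filterᵇ (λ α → trialSide x (proj₁ α) ∧ not (trialSide x (proj₂ α))) (network N (proj₁ x) es))

  trials : List ⟦ trialT ⟧
  trials = concatMap (λ μ → map (λ t → μ , t) R) (candidates N es)

smaller : ⟦ trialT ⟧ → ⟦ trialT ⟧ → Bool
smaller x y = costLess (proj₂ (proj₁ y)) (proj₁ (proj₁ x)) (proj₂ (proj₁ x)) (proj₁ (proj₁ y))

-- The result has at most one entry: a list serves as an optional value.
minimal : List ⟦ trialT ⟧ → List ⟦ trialT ⟧
minimal = foldr (λ x best → if all (smaller x) best then x ∷ [] else best) []

logCut : List ℕ × List ⟦ cutT ⟧ → List ⟦ cutT ⟧ → List ℕ × List ⟦ cutT ⟧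
logCut s = foldr (λ c _ → without (proj₁ (proj₂ c)) (proj₁ s) , c ∷ proj₂ s) s

module _ (p q : ℕ) where

  passes : ℕ → ℕ → List ⟦ edgeT ⟧ → List ℕ → ⟦ trialT ⟧ → Bool
  passes N K es R x = q * trialSize N es R x ∸ (p * K * N + (N ∸ 1)) ≡ᵇ 0

  best : ℕ → ℕ → List ⟦ edgeT ⟧ → List ℕ → List ⟦ trialT ⟧
  best N K es R = minimal (filterᵇ (passes N K es R) (trials N es R))

  newCut : ℕ → List ⟦ edgeT ⟧ → List ℕ → ⟦ trialT ⟧ → ⟦ cutT ⟧
  newCut N es R x = proj₁ x , (proj₂ x , trialTree N es R x)

  newCuts : ℕ → ℕ → List ⟦ edgeT ⟧ → List ℕ → List ⟦ cutT ⟧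
  newCuts N K es R = map (newCut N es R) (best N K es R)

  round : ℕ → ℕ → List ⟦ edgeT ⟧ → List ℕ × List ⟦ cutT ⟧ → List ℕ × List ⟦ cutT ⟧
  round N K es s = logCut s (newCuts N K es (proj₁ s))

  rounds : ℕ → ℕ → List ⟦ edgeT ⟧ → List ℕ → List ⟦ cutT ⟧
  rounds N K es R = proj₂ (iter (length R ∸ 1) (round N K es) (R , []))

separates : ⟦ cutT ⟧ → ⟦ arcT ⟧ → Bool
separates x α = visited (proj₁ (proj₂ x)) (proj₂ (proj₂ x)) (proj₁ α) xor visited (proj₁ (proj₂ x)) (proj₂ (proj₂ x)) (proj₂ α)

-- An edge that one cut keeps because of its level may still be removed on behalf of another, whose
-- threshold differs.
selected : ℕ → List ⟦ cutT ⟧ → ⟦ edgeT ⟧ → Bool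
selected N cuts e = any (λ x → separates x (proj₁ e) ∧ not (level N (proj₁ x) (proj₂ e) ≡ᵇ N)) cuts

-- The value of a bijective numeral is cut off at n, since k may be
-- exponential in the size of the input.
unary : ℕ → List Bool → ℕ
unary n = foldr (λ d v → n ⊓ (if d then suc (v + v) else suc (suc (v + v)))) 0

rawEdgeT inputT : Ty
rawEdgeT = (bitsT ⊗ bitsT) ⊗ costT
inputT   = bitsT ⊗ (list rawEdgeT ⊗ bitsT)

readEdge : ℕ → ⟦ rawEdgeT ⟧ → ⟦ edgeT ⟧
readEdge n e = (unary n (proj₁ (proj₁ e)) , unary n (proj₂ (proj₁ e))) , proj₂ e

terminals : List Bool → List ℕ
terminals T = filterᵇ (λ v → firstBit (iter v rest T)) (map pred (range (length T)))

module _ (p q : ℕ) where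

  scaleN : ℕ → ℕ
  scaleN m = suc (suc (p * m))

  solution : ℕ → ℕ → List ⟦ edgeT ⟧ → List ℕ → List Bool
  solution N K es R = map (selected N (rounds p q N K es R)) es

  algorithm : ⟦ inputT ⟧ → List Bool
  algorithm i = solution (scaleN m) (unary (suc m) (proj₂ (proj₂ i)) ∸ 1)
                      (map (readEdge (length (proj₁ i))) (proj₁ (proj₂ i))) (terminals (proj₁ i))
    where m = length (proj₁ (proj₂ i))

-- Programs for the algorithm

levelᴾ : ∀ {Γ N μ c} → PT Γ nat N → PT Γ candidateT μ → PT Γ costT c → PT Γ nat (λ ρ → level (N ρ) (μ ρ) (c ρ))
levelᴾ {N = N} {μ} {c} Nᴾ M C = iterᴾ Nᴾ (constᴾ 0)
  (ifᴾ (costLessᴾ sndᴾ (fstᴾ ∘ᴾ wk M) (sndᴾ ∘ᴾ wk M) (wk C)) (sucᴾ sndᴾ) sndᴾ) (con 2) grows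
  where
  grows : ∀ a v → sz nat (if costLess v (proj₁ (μ a)) (proj₂ (μ a)) (c a) then suc v else v) ≤ sz nat v + 2
  grows a v with costLess v (proj₁ (μ a)) (proj₂ (μ a)) (c a)
  ... | true  = ≤-reflexive (+-comm 2 (sz nat v))
  ... | false = m≤m+n _ 2

replicateᴾ : ∀ {Γ A n x} → PT Γ nat n → PT Γ A x → PT Γ (list A) (λ ρ → replicate (n ρ) (x ρ))
replicateᴾ {n = n} {x} N P = PT-ext (λ a → List.map-replicate (λ _ → x a) (n a) tt) (mapᴾ (onesᴾ N) (wk P))

networkᴾ : ∀ {Γ N μ es} → PT Γ nat N → PT Γ candidateT μ → PT Γ (list edgeT) es →
           PT Γ (list arcT) (λ ρ → network (N ρ) (μ ρ) (es ρ))
networkᴾ N M E = concatMapᴾ E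
  (replicateᴾ lv (fstᴾ ∘ᴾ sndᴾ) ++ᴾ replicateᴾ lv (swapArcᴾ (fstᴾ ∘ᴾ sndᴾ)))
  where lv = levelᴾ (wk N) (wk M) (sndᴾ ∘ᴾ sndᴾ)

sz-⊓ : ∀ n k → sz nat (n ⊓ k) ≤ sz nat n
sz-⊓ n k = subst₂ _≤_ (sym (sz-nat (n ⊓ k))) (sym (sz-nat n)) (+-monoʳ-≤ 1 (*-monoˡ-≤ 2 (m⊓n≤m n k)))

rangeᴾ : ∀ {Γ n} → PT Γ nat n → PT Γ (list nat) (λ ρ → range (n ρ))
rangeᴾ {Γ} {n} N = iterᴾ N (constᴾ []) (sucᴾ (wk N ⊓ᴾ lengthᴾ sndᴾ) ∷ᴾ sndᴾ) (con 3 ⊞ bound N)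
  λ a acc → ≤-trans (≤-reflexive (sz-∷ nat (suc (n a ⊓ length acc)) acc)) (+-monoʳ-≤ (sz (list nat) acc) (+-monoʳ-≤ 3
    (≤-trans (sz-⊓ (n a) (length acc)) (small N a))))

withoutᴾ : ∀ {Γ t R} → PT Γ nat t → PT Γ (list nat) R → PT Γ (list nat) (λ ρ → without (t ρ) (R ρ))
withoutᴾ T Rs = filterᴾ Rs (notᴾ (sndᴾ ≡ᵇᴾ wk T))

module _ {Γ N es R} (Nᴾ : PT Γ nat N) (E : PT Γ (list edgeT) es) (Rs : PT Γ (list nat) R) where

  trialTreeᴾ : ∀ {x} → PT Γ trialT x → PT Γ (list arcT) (λ ρ → trialTree (N ρ) (es ρ) (R ρ) (x ρ))
  trialTreeᴾ P = cutTreeᴾ (sndᴾ ∘ᴾ P) (withoutᴾ (sndᴾ ∘ᴾ P) Rs) (networkᴾ Nᴾ (fstᴾ ∘ᴾ P) E)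

  trialSizeᴾ : ∀ {x} → PT Γ trialT x → PT Γ nat (λ ρ → trialSize (N ρ) (es ρ) (R ρ) (x ρ))
  trialSizeᴾ P = lengthᴾ (filterᴾ (networkᴾ Nᴾ (fstᴾ ∘ᴾ P) E)
    (visitedᴾ (wk (sndᴾ ∘ᴾ P)) (wk (trialTreeᴾ P)) (fstᴾ ∘ᴾ sndᴾ)
      ∧ᴾ notᴾ (visitedᴾ (wk (sndᴾ ∘ᴾ P)) (wk (trialTreeᴾ P)) (sndᴾ ∘ᴾ sndᴾ))))

  candidatesᴾ : PT Γ (list candidateT) (λ ρ → candidates (N ρ) (es ρ))
  candidatesᴾ = constᴾ (zeroCost , 1) ∷ᴾ concatMapᴾ E (mapᴾ (rangeᴾ (wk Nᴾ ∸ᴾ constᴾ 1)) ((sndᴾ ∘ᴾ wk sndᴾ) ,ᴾ sndᴾ))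

  trialsᴾ : PT Γ (list trialT) (λ ρ → trials (N ρ) (es ρ) (R ρ))
  trialsᴾ = concatMapᴾ candidatesᴾ (mapᴾ (wk Rs) (wk sndᴾ ,ᴾ sndᴾ))

smallerᴾ : ∀ {Γ x y} → PT Γ trialT x → PT Γ trialT y → PT Γ bool (λ ρ → smaller (x ρ) (y ρ))
smallerᴾ P Q = costLessᴾ (sndᴾ ∘ᴾ fstᴾ ∘ᴾ Q) (fstᴾ ∘ᴾ fstᴾ ∘ᴾ P) (sndᴾ ∘ᴾ fstᴾ ∘ᴾ P) (fstᴾ ∘ᴾ fstᴾ ∘ᴾ Q)

minimalᴾ : ∀ {Γ xs} → PT Γ (list trialT) xs → PT Γ (list trialT) (λ ρ → minimal (xs ρ))
minimalᴾ {Γ} P = foldrᴾ P (constᴾ [])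
  (ifᴾ (allᴾ sndᴾ (smallerᴾ (wk (wk sndᴾ)) sndᴾ)) (wk sndᴾ ∷ᴾ constᴾ []) sndᴾ) (con 2 ⊞ arg) grows
  where
  grows : ∀ (a : ⟦ Γ ⟧) x acc → sz (list trialT) (if all (smaller x) acc then x ∷ [] else acc) ≤ sz (list trialT) acc + (2 + (sz Γ a + sz trialT x))
  grows a x acc with all (smaller x) acc
  ... | true  = ≤-trans (s≤s (≤-trans (≤-reflexive (+-comm (sz trialT x) 1)) (s≤s (m≤n+m (sz trialT x) (sz Γ a))))) (m≤n+m _ (sz (list trialT) acc))
  ... | false = m≤m+n _ _

module _ (p q : ℕ) {Γ N K es} (Nᴾ : PT Γ nat N) (Kᴾ : PT Γ nat K) (E : PT Γ (list edgeT) es) where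

  bestᴾ : ∀ {R} → PT Γ (list nat) R → PT Γ (list trialT) (λ ρ → best p q (N ρ) (K ρ) (es ρ) (R ρ))
  bestᴾ Rs = minimalᴾ (filterᴾ (trialsᴾ Nᴾ E Rs)
    ((constᴾ q *ᴾ trialSizeᴾ (wk Nᴾ) (wk E) (wk Rs) sndᴾ) ≤ᵇᴾ (constᴾ p *ᴾ wk Kᴾ *ᴾ wk Nᴾ +ᴾ (wk Nᴾ ∸ᴾ constᴾ 1))))

  newCutᴾ : ∀ {R x} → PT Γ (list nat) R → PT Γ trialT x → PT Γ cutT (λ ρ → newCut p q (N ρ) (es ρ) (R ρ) (x ρ))
  newCutᴾ Rs P = (fstᴾ ∘ᴾ P) ,ᴾ ((sndᴾ ∘ᴾ P) ,ᴾ trialTreeᴾ Nᴾ E Rs P)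

module _ (p q : ℕ) {Γ N K es} (Nᴾ : PT Γ nat N) (Kᴾ : PT Γ nat K) (E : PT Γ (list edgeT) es) where

  abstract
    newCutsᴾ : ∀ {R} → PT Γ (list nat) R → PT Γ (list cutT) (λ ρ → newCuts p q (N ρ) (K ρ) (es ρ) (R ρ))
    newCutsᴾ {R} Rs = mapᴾ {h = λ ρ → newCut p q (N (proj₁ ρ)) (es (proj₁ ρ)) (R (proj₁ ρ)) (proj₂ ρ)}
      (bestᴾ p q Nᴾ Kᴾ E Rs) (newCutᴾ p q (wk Nᴾ) (wk Kᴾ) (wk E) (wk Rs) sndᴾ)

sz-logCut : ∀ s cs →
  sz (list nat ⊗ list cutT) (logCut s cs) ≤ sz (list nat ⊗ list cutT) s + sz (list cutT) cs
  × sz (list nat) (proj₁ (logCut s cs)) ≤ sz (list nat) (proj₁ s)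
sz-logCut s         []       = m≤m+n _ 1 , ≤-refl
sz-logCut (R , log) (c ∷ cs) = (begin
    suc (sz (list nat) (without t R) + suc (sz cutT c + sz (list cutT) log))
      ≤⟨ s≤s (+-mono-≤ (sz-filter nat _ R) (≤-reflexive (sz-∷ cutT c log))) ⟩
    suc (sz (list nat) R + (sz (list cutT) log + suc (sz cutT c))) ≡⟨ cong suc (+-assoc (sz (list nat) R) _ _) ⟨
    suc (sz (list nat) R + sz (list cutT) log) + suc (sz cutT c) ≤⟨ +-monoʳ-≤ (suc (sz (list nat) R + sz (list cutT) log)) (s≤s (m≤m+n _ _)) ⟩
    suc (sz (list nat) R + sz (list cutT) log) + sz (list cutT) (c ∷ cs) ∎) , sz-filter nat _ R
  where
  open ≤-Reasoning
  t = proj₁ (proj₂ c)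

module _ (p q : ℕ) {Γ N K es} (Nᴾ : PT Γ nat N) (Kᴾ : PT Γ nat K) (E : PT Γ (list edgeT) es) where

  roundᴾ : ∀ {s} → PT Γ (list nat ⊗ list cutT) s →
           PT Γ (list nat ⊗ list cutT) (λ ρ → round p q (N ρ) (K ρ) (es ρ) (s ρ))
  roundᴾ {s} S = headOrᴾ {h = λ ρ → without (proj₁ (proj₂ (proj₂ ρ))) (proj₁ (s (proj₁ ρ))) , proj₂ ρ ∷ proj₂ (s (proj₁ ρ))}
    (newCutsᴾ p q Nᴾ Kᴾ E (fstᴾ ∘ᴾ S)) S
    (withoutᴾ (fstᴾ ∘ᴾ sndᴾ ∘ᴾ sndᴾ) (fstᴾ ∘ᴾ wk S) ,ᴾ (sndᴾ ∷ᴾ (sndᴾ ∘ᴾ wk S)))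

module _ (p q : ℕ) {Γ N K es R} (Nᴾ : PT Γ nat N) (Kᴾ : PT Γ nat K) (E : PT Γ (list edgeT) es) (Rs : PT Γ (list nat) R) where

  -- The program is formed over an arbitrary list `R′` only for its size bound. As the list of
  -- active terminals never outgrows the original one, the bound is uniform over all rounds, and the
  -- log grows additively.
  newCuts-small : Σ[ r ∈ Poly ] (∀ a R′ → sz (list nat) R′ ≤ at (bound Rs) (sz Γ a) →
                  sz (list cutT) (newCuts p q (N a) (K a) (es a) R′) ≤ at r (sz Γ a))
  newCuts-small = bound fresh ⟪ con 1 ⊞ arg ⊞ bound Rs ⟫ , λ a R′ R≤ →
    ≤-trans (small fresh (a , R′)) (at-comp (bound fresh) (con 1 ⊞ arg ⊞ bound Rs) (+-monoʳ-≤ (suc (sz Γ a)) R≤))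
    where
    fresh : PT (Γ ⊗ list nat) (list cutT) (λ ρ → newCuts p q (N (proj₁ ρ)) (K (proj₁ ρ)) (es (proj₁ ρ)) (proj₂ ρ))
    fresh = newCutsᴾ p q (wk Nᴾ) (wk Kᴾ) (wk E) sndᴾ

  roundsᴾ : PT Γ (list cutT) (λ ρ → rounds p q (N ρ) (K ρ) (es ρ) (R ρ))
  roundsᴾ = sndᴾ ∘ᴾ iter-measureᴾ {h = λ ρ → round p q (N (proj₁ ρ)) (K (proj₁ ρ)) (es (proj₁ ρ)) (proj₂ ρ)}
    (lengthᴾ Rs ∸ᴾ constᴾ 1) (Rs ,ᴾ constᴾ [])
    (roundᴾ p q (wk Nᴾ) (wk Kᴾ) (wk E) sndᴾ)
    (con 2 ⊞ bound Rs) (proj₁ cuts-small)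
    (sz (list nat ⊗ list cutT)) (λ _ → ≤-refl) (λ a s → sz (list nat) (proj₁ s) ≤ at (bound Rs) (sz Γ a))
    (λ a → small Rs a , s≤s (≤-trans (≤-reflexive (+-comm (sz (list nat) (R a)) 1)) (s≤s (small Rs a))))
    λ a s R≤ → ≤-trans (proj₂ (sz-logCut s (newCuts p q (N a) (K a) (es a) (proj₁ s)))) R≤
      , ≤-trans (proj₁ (sz-logCut s (newCuts p q (N a) (K a) (es a) (proj₁ s))))
                (+-monoʳ-≤ (sz (list nat ⊗ list cutT) s) (proj₂ cuts-small a (proj₁ s) R≤))
    where cuts-small = newCuts-small

  solutionᴾ : PT Γ bitsT (λ ρ → solution p q (N ρ) (K ρ) (es ρ) (R ρ))
  solutionᴾ = mapᴾ E (anyᴾ (wk roundsᴾ)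
    ((side (fstᴾ ∘ᴾ fstᴾ ∘ᴾ wk sndᴾ) xorᴾ side (sndᴾ ∘ᴾ fstᴾ ∘ᴾ wk sndᴾ))
      ∧ᴾ notᴾ (levelᴾ (wk (wk Nᴾ)) (fstᴾ ∘ᴾ sndᴾ) (sndᴾ ∘ᴾ wk sndᴾ) ≡ᵇᴾ wk (wk Nᴾ))))
    where
    side : ∀ {v} → PT ((Γ ⊗ edgeT) ⊗ cutT) nat v →
           PT ((Γ ⊗ edgeT) ⊗ cutT) bool (λ ρ → visited (proj₁ (proj₂ (proj₂ ρ))) (proj₂ (proj₂ (proj₂ ρ))) (v ρ))
    side V = visitedᴾ (fstᴾ ∘ᴾ sndᴾ ∘ᴾ sndᴾ) (sndᴾ ∘ᴾ sndᴾ ∘ᴾ sndᴾ) V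

unaryᴾ : ∀ {Γ n ds} → PT Γ nat n → PT Γ bitsT ds → PT Γ nat (λ ρ → unary (n ρ) (ds ρ))
unaryᴾ {Γ} {n} N D = foldrᴾ D (constᴾ 0)
  (wk (wk N) ⊓ᴾ ifᴾ (wk sndᴾ) (sucᴾ (sndᴾ +ᴾ sndᴾ)) (sucᴾ (sucᴾ (sndᴾ +ᴾ sndᴾ)))) (bound N)
  λ a d v → ≤-trans (sz-⊓ (n a) _) (≤-trans (≤-trans (small N a) (at-mono (bound N) (m≤m+n (sz Γ a) (sz bool d)))) (m≤n+m _ (sz nat v)))

terminalsᴾ : ∀ {Γ T} → PT Γ bitsT T → PT Γ (list nat) (λ ρ → terminals (T ρ))
terminalsᴾ {Γ} {T} P = filterᴾ (mapᴾ (rangeᴾ (lengthᴾ P)) (predᴾ sndᴾ))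
  (firstBitᴾ (iterᴾ sndᴾ (wk P) (restᴾ sndᴾ) (con 0) λ a acc → ≤-trans (sz-rest bool acc) (m≤m+n _ 0)))

abstract
  algorithmᴾ : ∀ p q → PT inputT bitsT (algorithm p q)
  algorithmᴾ p q = solutionᴾ p q (sucᴾ (sucᴾ (constᴾ p *ᴾ m))) (unaryᴾ (sucᴾ m) (sndᴾ ∘ᴾ sndᴾ) ∸ᴾ constᴾ 1)
    (mapᴾ (fstᴾ ∘ᴾ sndᴾ)
      ((unaryᴾ (wk n) (fstᴾ ∘ᴾ fstᴾ ∘ᴾ sndᴾ) ,ᴾ unaryᴾ (wk n) (sndᴾ ∘ᴾ fstᴾ ∘ᴾ sndᴾ)) ,ᴾ (sndᴾ ∘ᴾ sndᴾ)))
    (terminalsᴾ fstᴾ)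
    where
    n : PT inputT nat (λ i → length (proj₁ i))
    n = lengthᴾ fstᴾ
    m : PT inputT nat (λ i → length (proj₁ (proj₂ i)))
    m = lengthᴾ (fstᴾ ∘ᴾ sndᴾ)

-- Correctness of the arithmetic

bitsValue : List Bool → ℕ
bitsValue []       = 0
bitsValue (b ∷ bs) = indicator b + (bitsValue bs + bitsValue bs)

digitsValue : List Bool → ℕ
digitsValue []       = 0
digitsValue (d ∷ ds) = (if d then 1 else 2) + (digitsValue ds + digitsValue ds)

bits-split : ∀ ys → bitsValue ys ≡ indicator (firstBit ys) + (bitsValue (rest ys) + bitsValue (rest ys))
bits-split []       = refl
bits-split (y ∷ ys) = refl

length-rest : ∀ (ys : List Bool) {n} → length ys ≤ suc n → length (rest ys) ≤ n
length-rest []       _       = z≤n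
length-rest (y ∷ ys) (s≤s p) = p

value-pad : ∀ xs ys → bitsValue (pad xs ys) ≡ bitsValue xs
value-pad (x ∷ xs) ys       = cong (λ n → indicator x + (n + n)) (value-pad xs ys)
value-pad []       []       = refl
value-pad []       (y ∷ ys) = cong (λ n → n + n) (value-pad [] ys)

length-pad : ∀ xs ys → length ys ≤ length (pad xs ys)
length-pad xs ys = ≤-trans (≤-reflexive (sym (List.length-map (λ _ → false) ys)))
  (≤-trans (m≤n+m _ (length xs)) (≤-reflexive (sym (List.length-++ xs))))

-- The value of a numeral whose low bits are `out`, the most significant first, and whose remaining
-- high part has value `v`.
prepend : List Bool → ℕ → ℕ
prepend out v = foldl (λ v b → indicator b + (v + v)) v out

value-reverse : ∀ out r → bitsValue (reverse out ++ r) ≡ prepend out (bitsValue r)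
value-reverse []        r = refl
value-reverse (b ∷ out) r = trans
  (cong bitsValue (trans (cong (_++ r) (List.unfold-reverse b out)) (List.++-assoc (reverse out) (b ∷ []) r)))
  (value-reverse out (b ∷ r))

full-adder : ∀ x y c → indicator (x xor (y xor c)) + (indicator (if x then y ∨ c else y ∧ c) + indicator (if x then y ∨ c else y ∧ c))
                     ≡ indicator x + indicator y + indicator c
full-adder true  true  true  = refl
full-adder true  true  false = refl
full-adder true  false true  = refl
full-adder true  false false = refl
full-adder false true  true  = refl
full-adder false true  false = refl
full-adder false false true  = refl
full-adder false false false = refl

addBits-spec : ∀ xs ys c out → length ys ≤ length xs →
  prepend (proj₂ (proj₂ (foldl addBit (ys , (c , out)) xs))) (indicator (proj₁ (proj₂ (foldl addBit (ys , (c , out)) xs))))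
  ≡ prepend out (bitsValue xs + bitsValue ys + indicator c)
addBits-spec []       []       c out _  = refl
addBits-spec (x ∷ xs) ys       c out le = trans
  (addBits-spec xs (rest ys) _ _ (length-rest ys le))
  (cong (prepend out) (begin
    s + (X + Y + c′ + (X + Y + c′)) ≡⟨ shape₁ s c′ X Y ⟩
    (s + (c′ + c′)) + ((X + X) + (Y + Y)) ≡⟨ cong (_+ ((X + X) + (Y + Y))) (full-adder x y c) ⟩
    (indicator x + indicator y + indicator c) + ((X + X) + (Y + Y)) ≡⟨ shape₂ (indicator x) (indicator y) (indicator c) (X + X) (Y + Y) ⟩
    indicator x + (X + X) + (indicator y + (Y + Y)) + indicator c ≡⟨ cong (λ n → indicator x + (X + X) + n + indicator c) (bits-split ys) ⟨
    indicator x + (X + X) + bitsValue ys + indicator c ∎))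
  where
  open ≡-Reasoning
  y = firstBit ys
  X = bitsValue xs
  Y = bitsValue (rest ys)
  s = indicator (x xor (y xor c))
  c′ = indicator (if x then y ∨ c else y ∧ c)
  shape₁ : ∀ s c x y → s + (x + y + c + (x + y + c)) ≡ (s + (c + c)) + ((x + x) + (y + y))
  shape₁ = solve-∀
  shape₂ : ∀ a b c d e → (a + b + c) + (d + e) ≡ a + d + (b + e) + c
  shape₂ = solve-∀

value-add : ∀ xs ys → bitsValue (add xs ys) ≡ bitsValue xs + bitsValue ys
value-add xs ys = begin
  bitsValue (add xs ys) ≡⟨ value-reverse (proj₂ (proj₂ s)) (proj₁ (proj₂ s) ∷ []) ⟩
  prepend (proj₂ (proj₂ s)) (indicator (proj₁ (proj₂ s)) + 0) ≡⟨ cong (prepend (proj₂ (proj₂ s))) (+-identityʳ _) ⟩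
  prepend (proj₂ (proj₂ s)) (indicator (proj₁ (proj₂ s))) ≡⟨ addBits-spec (pad xs ys) ys false [] (length-pad xs ys) ⟩
  bitsValue (pad xs ys) + bitsValue ys + 0 ≡⟨ +-identityʳ _ ⟩
  bitsValue (pad xs ys) + bitsValue ys ≡⟨ cong (_+ bitsValue ys) (value-pad xs ys) ⟩
  bitsValue xs + bitsValue ys ∎
  where
  open ≡-Reasoning
  s = foldl addBit (ys , (false , [])) (pad xs ys)

double-<ᵇ : ∀ m n → (m + m <ᵇ n + n) ≡ (m <ᵇ n)
double-<ᵇ zero    zero    = refl
double-<ᵇ zero    (suc n) = refl
double-<ᵇ (suc m) zero    = refl
double-<ᵇ (suc m) (suc n) rewrite +-suc m m | +-suc n n = double-<ᵇ m n

odd-<ᵇ : ∀ m n → (suc (m + m) <ᵇ n + n) ≡ (m <ᵇ n)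
odd-<ᵇ zero    zero    = refl
odd-<ᵇ zero    (suc n) rewrite +-suc n n = refl
odd-<ᵇ (suc m) zero    = refl
odd-<ᵇ (suc m) (suc n) rewrite +-suc m m | +-suc n n = odd-<ᵇ m n

<ᵇ-odd : ∀ m n → (m + m <ᵇ suc (n + n)) ≡ (m <ᵇ suc n)
<ᵇ-odd zero    n       = refl
<ᵇ-odd (suc m) zero    = refl
<ᵇ-odd (suc m) (suc n) rewrite +-suc m m | +-suc n n = <ᵇ-odd m n

compare-bit : ∀ x y c m n → (m <ᵇ n + indicator (if x xor y then y else c))
                          ≡ (indicator x + (m + m) <ᵇ indicator y + (n + n) + indicator c)
compare-bit false false false m n rewrite +-identityʳ n | +-identityʳ (n + n) = sym (double-<ᵇ m n)
compare-bit false false true  m n rewrite +-comm n 1 | +-comm (n + n) 1 = sym (<ᵇ-odd m n)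
compare-bit false true  false m n rewrite +-comm n 1 | +-identityʳ (n + n) = sym (<ᵇ-odd m n)
compare-bit false true  true  m n rewrite +-comm n 1 | +-comm (n + n) 1 =
  sym (trans (cong (λ k → m + m <ᵇ suc k) (sym (+-suc n n))) (double-<ᵇ m (suc n)))
compare-bit true  false false m n rewrite +-identityʳ n | +-identityʳ (n + n) = sym (odd-<ᵇ m n)
compare-bit true  false true  m n rewrite +-identityʳ n | +-comm (n + n) 1 = sym (double-<ᵇ m n)
compare-bit true  true  false m n rewrite +-identityʳ n | +-identityʳ (n + n) = sym (double-<ᵇ m n)
compare-bit true  true  true  m n rewrite +-comm n 1 | +-comm (n + n) 1 = sym (<ᵇ-odd m n)

-- The verdict on the lower bits acts like a carry: if they are already smaller, the higher parts
-- need only satisfy `≤`, which is `<` after adding 1 on the right.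
lessBit-spec : ∀ xs ys c → length ys ≤ length xs →
  proj₂ (foldl lessBit (ys , c) xs) ≡ (bitsValue xs <ᵇ bitsValue ys + indicator c)
lessBit-spec []       []       false _  = refl
lessBit-spec []       []       true  _  = refl
lessBit-spec (x ∷ xs) ys       c     le = trans
  (lessBit-spec xs (rest ys) _ (length-rest ys le))
  (trans (compare-bit x (firstBit ys) c (bitsValue xs) (bitsValue (rest ys)))
         (cong (λ n → indicator x + (bitsValue xs + bitsValue xs) <ᵇ n + indicator c) (sym (bits-split ys))))

lessBits-spec : ∀ xs ys → lessBits xs ys ≡ (bitsValue xs <ᵇ bitsValue ys)
lessBits-spec xs ys = trans (lessBit-spec (pad xs ys) ys false (length-pad xs ys))
  (cong₂ _<ᵇ_ (value-pad xs ys) (+-identityʳ (bitsValue ys)))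

value-mul : ∀ ds ys → bitsValue (mul ds ys) ≡ digitsValue ds * bitsValue ys
value-mul []       ys = refl
value-mul (d ∷ ds) ys = trans (value-add (if d then ys else false ∷ ys) (false ∷ mul ds ys))
  (trans (cong (bitsValue (if d then ys else false ∷ ys) +_) (cong (λ n → n + n) (value-mul ds ys))) (digit d))
  where
  shape₁ : ∀ v y → y + (v * y + v * y) ≡ (1 + (v + v)) * y
  shape₁ = solve-∀
  shape₂ : ∀ v y → (y + y) + (v * y + v * y) ≡ (2 + (v + v)) * y
  shape₂ = solve-∀
  digit : ∀ d → bitsValue (if d then ys else false ∷ ys) + (digitsValue ds * bitsValue ys + digitsValue ds * bitsValue ys)
              ≡ ((if d then 1 else 2) + (digitsValue ds + digitsValue ds)) * bitsValue ys
  digit true  = shape₁ (digitsValue ds) (bitsValue ys)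
  digit false = shape₂ (digitsValue ds) (bitsValue ys)

value-scale : ∀ i ys → bitsValue (scale i ys) ≡ i * bitsValue ys
value-scale zero    ys = refl
value-scale (suc i) ys = trans (value-add ys (scale i ys)) (cong (bitsValue ys +_) (value-scale i ys))

numerator denominator : ⟦ costT ⟧ → ℕ
numerator   c = digitsValue (proj₁ c)
denominator c = digitsValue (proj₂ c)

costLess-spec : ∀ i c j c′ → costLess i c j c′ ≡ (i * (numerator c * denominator c′) <ᵇ j * (numerator c′ * denominator c))
costLess-spec i c j c′ = trans (lessBits-spec (scale i (crossMul c c′)) (scale j (crossMul c′ c)))
                               (cong₂ _<ᵇ_ (side i c c′) (side j c′ c))
  where
  side : ∀ i c c′ → bitsValue (scale i (crossMul c c′)) ≡ i * (numerator c * denominator c′)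
  side i c c′ = trans (value-scale i (crossMul c c′)) (cong (i *_) (trans (value-mul (proj₁ c) (mul (proj₂ c′) (true ∷ [])))
    (cong (numerator c *_) (trans (value-mul (proj₂ c′) (true ∷ [])) (*-identityʳ _)))))

<ᵇ-true : ∀ {m n} → m < n → (m <ᵇ n) ≡ true
<ᵇ-true m<n = T⇒true (<⇒<ᵇ m<n)

true-<ᵇ : ∀ {m n} → (m <ᵇ n) ≡ true → m < n
true-<ᵇ {m} {n} eq = <ᵇ⇒< m n (true⇒T eq)

false-<ᵇ : ∀ {m n} → (m <ᵇ n) ≡ false → n ≤ m
false-<ᵇ eq = ≮⇒≥ (λ m<n → true≢false (<ᵇ-true m<n) eq)

<ᵇ-cong : ∀ {m n m′ n′} → (m < n → m′ < n′) → (m′ < n′ → m < n) → (m <ᵇ n) ≡ (m′ <ᵇ n′)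
<ᵇ-cong {m} {n} {m′} {n′} f g with m <ᵇ n in eq | m′ <ᵇ n′ in eq′
... | true  | true  = refl
... | false | false = refl
... | true  | false = ⊥-elim (true≢false (<ᵇ-true (f (true-<ᵇ eq))) eq′)
... | false | true  = ⊥-elim (true≢false (<ᵇ-true (g (true-<ᵇ eq′))) eq)

-- C is the cost c measured in units of 1/D.
Priced : ℕ → ⟦ costT ⟧ → ℕ → Set
Priced D c C = 0 < denominator c × numerator c * D ≡ C * denominator c

-- The cross products multiplied by `D` equal the integer prices multiplied by both denominators;
-- these factors are positive and can be cancelled.
costLess-priced : ∀ {D c C c′ C′} → 0 < D → Priced D c C → Priced D c′ C′ → ∀ i j →
                  costLess i c j c′ ≡ (i * C <ᵇ j * C′)
costLess-priced {D} {c} {C} {c′} {C′} D>0 (den>0 , eq) (den′>0 , eq′) i j =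
  trans (costLess-spec i c j c′) (<ᵇ-cong to from)
  where
  instance
    D≢0 : NonZero D
    D≢0 = >-nonZero D>0
    prod≢0 : NonZero (denominator c * denominator c′)
    prod≢0 = >-nonZero (*-mono-≤ den>0 den′>0)
  shape₁ : ∀ i n d D → i * (n * d) * D ≡ i * d * (n * D)
  shape₁ = solve-∀
  shape₂ : ∀ i C d d′ → i * d′ * (C * d) ≡ i * C * (d * d′)
  shape₂ = solve-∀
  shape₃ : ∀ i C d d′ → i * d * (C * d′) ≡ i * C * (d * d′)
  shape₃ = solve-∀
  left : i * (numerator c * denominator c′) * D ≡ i * C * (denominator c * denominator c′)
  left = trans (shape₁ i (numerator c) (denominator c′) D)
    (trans (cong (i * denominator c′ *_) eq) (shape₂ i C (denominator c) (denominator c′)))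
  right : j * (numerator c′ * denominator c) * D ≡ j * C′ * (denominator c * denominator c′)
  right = trans (shape₁ j (numerator c′) (denominator c) D)
    (trans (cong (j * denominator c *_) eq′) (shape₃ j C′ (denominator c) (denominator c′)))
  to : i * (numerator c * denominator c′) < j * (numerator c′ * denominator c) → i * C < j * C′
  to lt = *-cancelʳ-< (denominator c * denominator c′) _ _ (subst₂ _<_ left right (*-monoˡ-< D lt))
  from : i * C < j * C′ → i * (numerator c * denominator c′) < j * (numerator c′ * denominator c)
  from lt = *-cancelʳ-< D _ _ (subst₂ _<_ (sym left) (sym right) (*-monoˡ-< (denominator c * denominator c′) lt))

-- Rounding up to multiples of x / i: by `level-lo` one level less would be too low, while
-- `level-up` is restricted to levels below `N` because of the truncation.
record IsLevel (N x i C u : ℕ) : Set where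
  field
    level≤   : u ≤ N
    level-up : u < N → i * C ≤ u * x
    level-lo : ∀ {w} → u ≡ suc w → w * x < i * C

levelℕ : ℕ → ℕ → ℕ → ℕ → ℕ
levelℕ N x i C = iter N (λ v → if v * x <ᵇ i * C then suc v else v) 0

levelℕ-spec : ∀ N x i C → IsLevel N x i C (levelℕ N x i C)
levelℕ-spec zero x i C = record { level≤ = z≤n ; level-up = λ () ; level-lo = λ () }
levelℕ-spec (suc N) x i C with levelℕ N x i C | levelℕ-spec N x i C
... | v | ih with v * x <ᵇ i * C in lt
...   | true  = record
  { level≤   = s≤s (level≤ ih)
  -- A counter already behind the number of iterations has stopped, so its test would have failed
  -- again.
  ; level-up = λ sv<sN → contradiction (true-<ᵇ {v * x} {i * C} lt) (≤⇒≯ (level-up ih (s≤s⁻¹ sv<sN)))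
  ; level-lo = λ { refl → true-<ᵇ lt }
  }
  where open IsLevel
...   | false = record
  { level≤   = m≤n⇒m≤1+n (level≤ ih)
  ; level-up = λ _ → false-<ᵇ {v * x} {i * C} lt
  ; level-lo = level-lo ih
  }
  where open IsLevel

level≡levelℕ : ∀ {D μ x c C} N → 0 < D → Priced D (proj₁ μ) x → Priced D c C → level N μ c ≡ levelℕ N x (proj₂ μ) C
level≡levelℕ zero D>0 μ-ok c-ok = refl
level≡levelℕ {D} {μ} {x} {c} {C} (suc N) D>0 μ-ok c-ok = trans
  (cong (λ v → if costLess v (proj₁ μ) (proj₂ μ) c then suc v else v) (level≡levelℕ {D} {μ} {x} {c} {C} N D>0 μ-ok c-ok))
  (cong (λ b → if b then suc v else v) (costLess-priced {D} {proj₁ μ} {x} {c} {C} D>0 μ-ok c-ok v (proj₂ μ)))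
  where v = levelℕ N x (proj₂ μ) C

level-spec : ∀ {D μ x c C} N → 0 < D → Priced D (proj₁ μ) x → Priced D c C → IsLevel N x (proj₂ μ) C (level N μ c)
level-spec {μ = μ} {x} {c} {C} N D>0 μ-ok c-ok =
  subst (IsLevel N x (proj₂ μ) C) (sym (level≡levelℕ {μ = μ} {x} {c} {C} N D>0 μ-ok c-ok)) (levelℕ-spec N x (proj₂ μ) C)

-- One round

sameArc-sound : ∀ {α β} → sameArc α β ≡ true → α ≡ β
sameArc-sound {a , b} {c , d} eq with ∧-true {a ≡ᵇ c} eq
... | eq₁ , eq₂ = cong₂ _,_ (≡ᵇ-true eq₁) (≡ᵇ-true eq₂)

sameArc-refl : ∀ α → sameArc α α ≡ true
sameArc-refl (a , b) rewrite ≡ᵇ-refl a = ≡ᵇ-refl b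

module Net = FlowProperties {⟦ arcT ⟧} proj₁ proj₂ swapArc sameArc (λ _ → refl) (λ _ → refl)
               (λ {α} {β} → sameArc-sound {α} {β}) sameArc-refl

≡ᵇ-false : ∀ {m n} → m ≢ n → (m ≡ᵇ n) ≡ false
≡ᵇ-false {m} {n} m≢n with m ≡ᵇ n in eq
... | false = refl
... | true  = contradiction (≡ᵇ-true eq) m≢n

false-≡ᵇ : ∀ {m n} → (m ≡ᵇ n) ≡ false → m ≢ n
false-≡ᵇ {m} eq refl = true≢false (≡ᵇ-refl m) eq

∈-without⁻ : ∀ {t v} R → v ∈ without t R → v ∈ R × v ≢ t
∈-without⁻ {t} R v∈ with ∈-filterᵇ⁻ (λ v → not (v ≡ᵇ t)) {xs = R} v∈
... | v∈R , ne = v∈R , false-≡ᵇ (not-true ne)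

∈-without⁺ : ∀ {t v R} → v ∈ R → v ≢ t → v ∈ without t R
∈-without⁺ {t} v∈ v≢t = ∈-filterᵇ⁺ (λ v → not (v ≡ᵇ t)) v∈ (cong not (≡ᵇ-false v≢t))

without-∉ : ∀ {t} R → t ∉ R → without t R ≡ R
without-∉ []      t∉ = refl
without-∉ {t} (v ∷ R) t∉ rewrite ≡ᵇ-false {v} {t} (λ { refl → t∉ (here refl) }) =
  cong (v ∷_) (without-∉ R λ t∈ → t∉ (there t∈))

length-without : ∀ {t R} → Unique R → t ∈ R → suc (length (without t R)) ≡ length R
length-without {t} {_ ∷ R} (t≢ ∷ uniq) (here refl) rewrite ≡ᵇ-refl t =
  cong (λ xs → suc (length xs)) (without-∉ R λ t∈ → All.lookup t≢ t∈ refl)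
length-without {t} {v ∷ R} (v≢ ∷ uniq) (there t∈) rewrite ≡ᵇ-false {v} {t} (All.lookup v≢ t∈) =
  cong suc (length-without uniq t∈)

unique-without : ∀ {t R} → Unique R → Unique (without t R)
unique-without {t} = Unique.filter⁺ (λ v → T? (not (v ≡ᵇ t)))

Isolates : List ℕ → ℕ → (ℕ → Bool) → Set
Isolates R t Y = Y t ≡ true × (∀ v → v ∈ R → v ≢ t → Y v ≡ false)

splits : (ℕ → Bool) → ⟦ arcT ⟧ → Bool
splits Y α = Y (proj₁ α) xor Y (proj₂ α)

module _ (N : ℕ) (es : List ⟦ edgeT ⟧) where

  weight : ⟦ candidateT ⟧ → (ℕ → Bool) → ℕ
  weight μ Y = total (λ e → indicator (splits Y (proj₁ e)) * level N μ (proj₂ e)) es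

  out-replicate : ∀ Y n α → Net.out Y (replicate n α) ≡ n * indicator (Net.leaves Y α)
  out-replicate Y zero    α = refl
  out-replicate Y (suc n) α = cong (indicator (Net.leaves Y α) +_) (out-replicate Y n α)

out-network : ∀ N μ Y es → Net.out Y (network N μ es) ≡ weight N es μ Y
out-network N μ Y []       = refl
out-network N μ Y (e ∷ es) = trans (total-++ _ (replicate n α ++ replicate n (swapArc α)) (network N μ es))
  (cong₂ _+_ (trans (total-++ _ (replicate n α) _)
               (trans (cong₂ _+_ (out-replicate N es Y n α) (out-replicate N es Y n (swapArc α)))
                      (both (Y (proj₁ α)) (Y (proj₂ α)))))
             (out-network N μ Y es))
  where
  n = level N μ (proj₂ e)
  α = proj₁ e
  both : ∀ b c → n * indicator (b ∧ not c) + n * indicator (c ∧ not b) ≡ indicator (b xor c) * n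
  both true  true  = cong₂ _+_ (*-zeroʳ n) (*-zeroʳ n)
  both true  false = trans (cong₂ _+_ (*-identityʳ n) (*-zeroʳ n)) refl
  both false true  = trans (cong₂ _+_ (*-zeroʳ n) (*-identityʳ n)) (sym (+-identityʳ n))
  both false false = cong₂ _+_ (*-zeroʳ n) (*-zeroʳ n)

module _ (N : ℕ) (es : List ⟦ edgeT ⟧) (R : List ℕ) (x : ⟦ trialT ⟧) where

  private
    t = proj₂ x
    sink = isSink (without t R)
    A = network N (proj₁ x) es

    sink-ok : sink t ≡ false
    sink-ok with sink t in eq
    ... | false = refl
    ... | true with any⁻ (λ v → v ≡ᵇ t) (without t R) eq
    ...   | v , v∈ , eq′ = contradiction (≡ᵇ-true eq′) (proj₂ (∈-without⁻ R v∈))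

    open Net.MinCut t sink sink-ok (λ _ → ⊤) (λ _ _ _ → tt)

  trial-isolates : Isolates R t (trialSide N es R x)
  trial-isolates = proj₁ in-cut , λ v v∈ v≢t →
      proj₂ in-cut v (any⁺ (λ w → w ≡ᵇ v) (∈-without⁺ v∈ v≢t) (≡ᵇ-refl v))
    where
    in-cut : IsCut (trialSide N es R x)
    in-cut = proj₁ (proj₂ (residual-spec A tt))

  trialSize≡weight : trialSize N es R x ≡ weight N es (proj₁ x) (trialSide N es R x)
  trialSize≡weight = trans (length-filterᵇ _ A) (out-network N (proj₁ x) (trialSide N es R x) es)

  trialSize-minimal : ∀ Y → Isolates R t Y → trialSize N es R x ≤ weight N es (proj₁ x) Y
  trialSize-minimal Y (Yt , Yother) = begin
    trialSize N es R x ≡⟨ length-filterᵇ _ A ⟩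
    Net.out (side A) A ≤⟨ minimum-cut A tt Y (Yt , sinks) ⟩
    Net.out Y A ≡⟨ out-network N (proj₁ x) Y es ⟩
    weight N es (proj₁ x) Y ∎
    where
    open ≤-Reasoning
    sinks : ∀ v → sink v ≡ true → Y v ≡ false
    sinks v sunk with any⁻ (λ w → w ≡ᵇ v) (without t R) sunk
    ... | w , w∈ , eq with ≡ᵇ-true {w} {v} eq
    ...   | refl with ∈-without⁻ R w∈
    ...     | w∈R , w≢t = Yother w w∈R w≢t

range-spec : ∀ n → range n ≡ map suc (downFrom n)
range-spec n = go n ≤-refl
  where
  go : ∀ k → k ≤ n → iter k (λ is → suc (n ⊓ length is) ∷ is) [] ≡ map suc (downFrom k)
  go zero    _  = refl
  go (suc k) k<n rewrite go k (<⇒≤ k<n) | List.length-map suc (downFrom k) | List.length-downFrom k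
                       | m≥n⇒m⊓n≡n (<⇒≤ k<n) = refl

∈-range : ∀ {n i} → 0 < i → i ≤ n → i ∈ range n
∈-range {n} {suc i} _ i≤n = subst (suc i ∈_) (sym (range-spec n)) (∈-map⁺ suc (∈-downFrom⁺ i≤n))

range-positive : ∀ {n i} → i ∈ range n → 0 < i
range-positive {n} i∈ with ∈-map⁻ suc (subst (_ ∈_) (range-spec n) i∈)
... | j , _ , refl = s≤s z≤n

length-filter-split : ∀ {A : Set} (p : A → Bool) xs → length (filterᵇ p xs) + length (filterᵇ (λ x → not (p x)) xs) ≡ length xs
length-filter-split p []       = refl
length-filter-split p (x ∷ xs) with p x
... | true  = cong suc (length-filter-split p xs)
... | false = trans (+-suc (length (filterᵇ p xs)) _) (cong suc (length-filter-split p xs))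

∈⇒length>0 : ∀ {A : Set} {x : A} {xs} → x ∈ xs → 0 < length xs
∈⇒length>0 (here _)  = s≤s z≤n
∈⇒length>0 (there _) = s≤s z≤n

-- Splitting along cuts of at most K edges, one for each of the length R ∸ 1
-- splits, until every part contains a single terminal.
module Labelling {I : Set} (Is : List I) (ends : I → ⟦ arcT ⟧) (counted : I → Bool) (K : ℕ) (R₀ : List ℕ)
  (pairCut : ∀ s t → s ∈ R₀ → t ∈ R₀ → s ≢ t →
    ∃[ Y ] Y s ≡ true × Y t ≡ false × total (λ e → indicator (counted e ∧ splits Y (ends e))) Is ≤ K)
  where

  differ : (ℕ → ℕ) → ⟦ arcT ⟧ → Bool
  differ L α = not (L (proj₁ α) ≡ᵇ L (proj₂ α))

  IsLabelling : List ℕ → (ℕ → ℕ) → Set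
  IsLabelling R L = (∀ v → L v ∈ R) × (∀ {t} → t ∈ R → L t ≡ t)
    × total (λ e → indicator (counted e ∧ differ L (ends e))) Is ≤ (length R ∸ 1) * K

  -- Both recursive calls label the whole vertex set, and each labelling is used on its own side of
  -- `Y`. An edge between different labels crosses `Y` or is counted by one of the calls, and
  -- `1 + (r₁ − 1) + (r₂ − 1)` is one less than the number of terminals. The number `n` only bounds
  -- the recursion.
  labelling : ∀ n R → length R ≤ n → 0 < length R → Unique R → All (_∈ R₀) R → ∃[ L ] IsLabelling R L
  labelling n       []       _  () _ _
  labelling n       (t ∷ []) _  _ uniq R⊆ = (λ _ → t) , (λ _ → here refl) , (λ { (here refl) → refl })
    , ≤-reflexive (total-0 Is λ e _ → none e)
    where
    none : ∀ e → indicator (counted e ∧ not (t ≡ᵇ t)) ≡ 0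
    none e rewrite ≡ᵇ-refl t with counted e
    ... | true  = refl
    ... | false = refl
  labelling zero    (s ∷ t ∷ R) () _ _ _
  labelling (suc n) (s ∷ t ∷ R) R≤ _ uniq@((s≢t ∷ _) ∷ _) R⊆@(s∈ ∷ t∈ ∷ _) with pairCut s t s∈ t∈ s≢t
  ... | Y , Ys , Yt , small with labelling n R₁ (shrink {R₁} {R₂} t∈R₂ sum₁) (∈⇒length>0 s∈R₁) (Unique.filter⁺ (λ v → T? (Y v)) uniq) (keep Y)
                               | labelling n R₂ (shrink {R₂} {R₁} s∈R₁ sum₂) (∈⇒length>0 t∈R₂) (Unique.filter⁺ (λ v → T? (not (Y v))) uniq) (keep (λ v → not (Y v)))
    where
    full = s ∷ t ∷ R
    R₁ = filterᵇ Y full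
    R₂ = filterᵇ (λ v → not (Y v)) full
    s∈R₁ : s ∈ R₁
    s∈R₁ = ∈-filterᵇ⁺ Y {xs = full} (here refl) Ys
    t∈R₂ : t ∈ R₂
    t∈R₂ = ∈-filterᵇ⁺ (λ v → not (Y v)) {xs = full} (there (here refl)) (cong not Yt)
    sum₁ : length R₁ + length R₂ ≡ length full
    sum₁ = length-filter-split Y full
    sum₂ : length R₂ + length R₁ ≡ length full
    sum₂ = trans (+-comm (length R₂) _) sum₁
    shrink : ∀ {A B : List ℕ} {x} → x ∈ B → length A + length B ≡ length full → length A ≤ n
    shrink {A} {B} x∈ eq = s≤s⁻¹ (≤-trans (≤-reflexive (+-comm 1 (length A)))
      (≤-trans (+-monoʳ-≤ (length A) (∈⇒length>0 x∈)) (≤-trans (≤-reflexive eq) R≤)))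
    keep : ∀ f → All (_∈ R₀) (filterᵇ f full)
    keep f = All.tabulate λ v∈ → All.lookup R⊆ (proj₁ (∈-filterᵇ⁻ f {xs = full} v∈))
  ... | L₁ , into₁ , fix₁ , few₁ | L₂ , into₂ , fix₂ , few₂ = L , intoL , fixL , few
    where
    full = s ∷ t ∷ R
    r₁ = length (filterᵇ Y full)
    r₂ = length (filterᵇ (λ v → not (Y v)) full)
    L : ℕ → ℕ
    L v = if Y v then L₁ v else L₂ v
    intoL : ∀ v → L v ∈ full
    intoL v with Y v
    ... | true  = proj₁ (∈-filterᵇ⁻ Y {xs = full} (into₁ v))
    ... | false = proj₁ (∈-filterᵇ⁻ (λ v → not (Y v)) {xs = full} (into₂ v))
    fixL : ∀ {v} → v ∈ full → L v ≡ v
    fixL {v} v∈ with Y v in eq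
    ... | true  = fix₁ (∈-filterᵇ⁺ Y v∈ eq)
    ... | false = fix₂ (∈-filterᵇ⁺ (λ v → not (Y v)) v∈ (cong not eq))
    cases : ∀ c a b → indicator (c ∧ differ L (a , b))
      ≤ indicator (c ∧ splits Y (a , b)) + (indicator (c ∧ differ L₁ (a , b)) + indicator (c ∧ differ L₂ (a , b)))
    cases false a b = z≤n
    cases true  a b with Y a | Y b
    ... | true  | true  = m≤m+n _ _
    ... | false | false = m≤n+m _ (indicator (differ L₁ (a , b)))
    ... | true  | false = ≤-trans (indicator≤1 (not (L₁ a ≡ᵇ L₂ b))) (m≤m+n 1 _)
    ... | false | true  = ≤-trans (indicator≤1 (not (L₂ a ≡ᵇ L₁ b))) (m≤m+n 1 _)
    few : total (λ e → indicator (counted e ∧ differ L (ends e))) Is ≤ (length full ∸ 1) * K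
    few = begin
      total (λ e → indicator (counted e ∧ differ L (ends e))) Is
        ≤⟨ total-mono Is (λ e _ → cases (counted e) (proj₁ (ends e)) (proj₂ (ends e))) ⟩
      total (λ e → cut e + (one₁ e + one₂ e)) Is ≡⟨ trans (total-+ cut _ Is) (cong (total cut Is +_) (total-+ one₁ one₂ Is)) ⟩
      total cut Is + (total one₁ Is + total one₂ Is) ≤⟨ +-mono-≤ small (+-mono-≤ few₁ few₂) ⟩
      K + ((r₁ ∸ 1) * K + (r₂ ∸ 1) * K) ≡⟨ cong (K +_) (*-distribʳ-+ K (r₁ ∸ 1) (r₂ ∸ 1)) ⟨
      K + ((r₁ ∸ 1) + (r₂ ∸ 1)) * K ≡⟨ cong (_* K) (parts r₁ r₂ (∈⇒length>0 s∈₁) (∈⇒length>0 t∈₂) (length-filter-split Y full)) ⟩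
      (length full ∸ 1) * K ∎
      where
      open ≤-Reasoning
      cut one₁ one₂ : I → ℕ
      cut e  = indicator (counted e ∧ splits Y (ends e))
      one₁ e = indicator (counted e ∧ differ L₁ (ends e))
      one₂ e = indicator (counted e ∧ differ L₂ (ends e))
      s∈₁ = ∈-filterᵇ⁺ Y {xs = full} (here refl) Ys
      t∈₂ = ∈-filterᵇ⁺ (λ v → not (Y v)) {xs = full} (there (here refl)) (cong not Yt)
      parts : ∀ a b {l} → 0 < a → 0 < b → a + b ≡ l → suc ((a ∸ 1) + (b ∸ 1)) ≡ l ∸ 1
      parts (suc a) (suc b) _ _ refl = sym (+-suc a b)

-- Double counting, averages and comparison of fractions

total-swap : ∀ {A B : Set} (f : A → B → ℕ) xs ys → total (λ x → total (f x) ys) xs ≡ total (λ y → total (λ x → f x y) xs) ys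
total-swap f []       ys = sym (total-0 ys λ _ _ → refl)
total-swap f (x ∷ xs) ys = trans (cong (total (f x) ys +_) (total-swap f xs ys)) (sym (total-+ (f x) _ ys))

total-*ʳ : ∀ {A : Set} (f : A → ℕ) k xs → total (λ x → f x * k) xs ≡ total f xs * k
total-*ʳ f k []       = refl
total-*ʳ f k (x ∷ xs) = trans (cong (f x * k +_) (total-*ʳ f k xs)) (sym (*-distribʳ-+ k (f x) _))

total-const : ∀ {A : Set} k (xs : List A) → total (λ _ → k) xs ≡ length xs * k
total-const k []       = refl
total-const k (x ∷ xs) = cong (k +_) (total-const k xs)

occurrences≤1 : ∀ v {R} → Unique R → total (λ t → indicator (v ≡ᵇ t)) R ≤ 1
occurrences≤1 v []          = z≤n
occurrences≤1 v {t ∷ R} (t≢ ∷ uniq) with v ≡ᵇ t in eq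
... | false = occurrences≤1 v uniq
... | true  = ≤-reflexive (cong suc (total-0 R λ w w∈ → cong indicator (≡ᵇ-false λ v≡w →
                All.lookup t≢ w∈ (trans (sym (≡ᵇ-true {v} eq)) v≡w))))

least : ∀ {A : Set} (w : A → ℕ) x xs → ∃[ y ] y ∈ x ∷ xs × (∀ z → z ∈ x ∷ xs → w y ≤ w z)
least w x []        = x , here refl , λ { z (here refl) → ≤-refl }
least w x (x′ ∷ xs) with least w x′ xs
... | y , y∈ , min with ≤-total (w x) (w y)
...   | inj₁ x≤y = x , here refl , λ { z (here refl) → ≤-refl ; z (there z∈) → ≤-trans x≤y (min z z∈) }
...   | inj₂ y≤x = y , there y∈ , λ { z (here refl) → y≤x ; z (there z∈) → min z z∈ }

below-average : ∀ {A : Set} (w : A → ℕ) x xs → ∃[ y ] y ∈ x ∷ xs × length (x ∷ xs) * w y ≤ total w (x ∷ xs)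
below-average w x xs with least w x xs
... | y , y∈ , min = y , y∈ , ≤-trans (≤-reflexive (sym (total-const (w y) (x ∷ xs)))) (total-mono (x ∷ xs) min)

≼-trans : ∀ x i y j z k → 0 < j → x * j ≤ y * i → y * k ≤ z * j → x * k ≤ z * i
≼-trans x i y j z k j>0 le le′ = *-cancelʳ-≤ (x * k) (z * i) j {{>-nonZero j>0}} (begin
  x * k * j ≡⟨ shape₁ x k j ⟩
  x * j * k ≤⟨ *-monoˡ-≤ k le ⟩
  y * i * k ≡⟨ shape₁ y i k ⟩
  y * k * i ≤⟨ *-monoˡ-≤ i le′ ⟩
  z * j * i ≡⟨ shape₁ z j i ⟩
  z * i * j ∎)
  where
  open ≤-Reasoning
  shape₁ : ∀ a b c → a * b * c ≡ a * c * b
  shape₁ = solve-∀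

-- Analysis of a cut

module Analysis (p q d : ℕ) (p≡ : p ≡ d + 2 * q) (q>0 : 0 < q)
  {I : Set} (Is : List I) (dat : I → ⟦ edgeT ⟧) (D : ℕ) (D>0 : 0 < D)
  (price : ⟦ costT ⟧ → ℕ) (priced : ∀ e → Priced D (proj₂ (dat e)) (price (proj₂ (dat e))))
  (zero-priced : Priced D zeroCost (price zeroCost)) (K N : ℕ) (N≡ : N ≡ suc (suc (p * length Is))) where

  es : List ⟦ edgeT ⟧
  es = map dat Is

  m Θ : ℕ
  m = length Is
  Θ = p * K * N + (N ∸ 1)

  C : I → ℕ
  C e = price (proj₂ (dat e))

  ends : I → ⟦ arcT ⟧
  ends e = proj₁ (dat e)

  lev : ⟦ candidateT ⟧ → I → ℕ
  lev μ e = level N μ (proj₂ (dat e))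

  Good : ⟦ candidateT ⟧ → Set
  Good μ = Priced D (proj₁ μ) (price (proj₁ μ)) × 0 < proj₂ μ

  value : ⟦ candidateT ⟧ → ℕ
  value μ = price (proj₁ μ)

  infix 4 _≼_
  _≼_ : ⟦ candidateT ⟧ → ℕ × ℕ → Set
  μ ≼ z = value μ * proj₂ z ≤ proj₁ z * proj₂ μ

  frac : ⟦ candidateT ⟧ → ℕ × ℕ
  frac μ = value μ , proj₂ μ

  weight-sum : ∀ μ Y → weight N es μ Y ≡ total (λ e → indicator (splits Y (ends e)) * lev μ e) Is
  weight-sum μ Y = total-map _ dat Is

  lev-spec : ∀ {μ} → Good μ → ∀ e → IsLevel N (value μ) (proj₂ μ) (C e) (lev μ e)
  lev-spec {μ} good e = level-spec {D} {μ} {value μ} {proj₂ (dat e)} {C e} N D>0 (proj₁ good) (priced e)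

  candidates-good : ∀ {μ} → μ ∈ candidates N es → Good μ
  candidates-good (here refl) = zero-priced , s≤s z≤n
  candidates-good (there μ∈) with concatMap⁻ es μ∈
    where
    concatMap⁻ : ∀ {μ} xs → μ ∈ concatMap (λ e → map (λ i → proj₂ e , i) (range (N ∸ 1))) xs →
                 ∃[ e ] e ∈ xs × ∃[ i ] 0 < i × μ ≡ (proj₂ e , i)
    concatMap⁻ (e ∷ xs) μ∈ with ∈-++⁻ (map (λ i → proj₂ e , i) (range (N ∸ 1))) μ∈
    ... | inj₂ μ∈′ with concatMap⁻ xs μ∈′
    ...   | e′ , e∈ , res = e′ , there e∈ , res
    concatMap⁻ (e ∷ xs) μ∈ | inj₁ μ∈′ with ∈-map⁻ (λ i → proj₂ e , i) μ∈′
    ...   | i , i∈ , refl = e , here refl , i , range-positive {N ∸ 1} i∈ , refl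
  ... | e , e∈ , i , i>0 , refl with ∈-map⁻ dat e∈
  ...   | j , _ , refl = priced j , i>0

  ∈-candidates : ∀ {e v} → e ∈ Is → 0 < v → v < N → (proj₂ (dat e) , v) ∈ candidates N es
  ∈-candidates {e} {v} e∈ v>0 v<N = there (concatMap⁺ (∈-map⁺ dat e∈))
    where
    concatMap⁺ : ∀ {x xs} → x ∈ xs → (proj₂ x , v) ∈ concatMap (λ e → map (λ i → proj₂ e , i) (range (N ∸ 1))) xs
    concatMap⁺ (here refl) = ∈-++⁺ˡ (∈-map⁺ _ (∈-range {N ∸ 1} v>0 (∸-monoˡ-≤ 1 v<N)))
    concatMap⁺ {x} {y ∷ xs} (there x∈) = ∈-++⁺ʳ (map (λ i → proj₂ y , i) (range (N ∸ 1))) (concatMap⁺ x∈)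

  smaller-spec : ∀ {x y} → Good (proj₁ x) → Good (proj₁ y) →
    smaller x y ≡ (proj₂ (proj₁ y) * value (proj₁ x) <ᵇ proj₂ (proj₁ x) * value (proj₁ y))
  smaller-spec {(c , i) , _} {(c′ , j) , _} gx gy =
    costLess-priced {D} {c} {price c} {c′} {price c′} D>0 (proj₁ gx) (proj₁ gy) j i

  minimal-spec : ∀ xs → All (λ x → Good (proj₁ x)) xs → (minimal xs ≡ [] × xs ≡ [])
    ⊎ (∃[ z ] minimal xs ≡ z ∷ [] × z ∈ xs × (∀ {y} → y ∈ xs → proj₁ z ≼ frac (proj₁ y)))
  minimal-spec []       [] = inj₁ (refl , refl)
  minimal-spec (x ∷ xs) (gx ∷ good) = extend-min (minimal-spec xs good)
    where
    Least : List ⟦ trialT ⟧ → Set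
    Least best = ∃[ z ] best ≡ z ∷ [] × z ∈ x ∷ xs × (∀ {y} → y ∈ x ∷ xs → proj₁ z ≼ frac (proj₁ y))
    choose : ∀ z b → smaller x z ≡ b → z ∈ xs → (∀ {y} → y ∈ xs → proj₁ z ≼ frac (proj₁ y)) →
             Least (if b ∧ true then x ∷ [] else z ∷ [])
    choose z true eq z∈ min = x , refl , here refl , λ
      { (here refl) → ≤-refl
      ; {y} (there y∈) → ≼-trans (value (proj₁ x)) _ (value (proj₁ z)) (proj₂ (proj₁ z)) (value (proj₁ y)) _
          (proj₂ (All.lookup good z∈)) x≼z (min y∈) }
      where
      x≼z : value (proj₁ x) * proj₂ (proj₁ z) ≤ value (proj₁ z) * proj₂ (proj₁ x)
      x≼z = subst₂ _≤_ (*-comm (proj₂ (proj₁ z)) _) (*-comm (proj₂ (proj₁ x)) _)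
              (<⇒≤ (true-<ᵇ (trans (sym (smaller-spec {x} {z} gx (All.lookup good z∈))) eq)))
    choose z false eq z∈ min = z , refl , there z∈ , λ { (here refl) → z≼x ; (there y∈) → min y∈ }
      where
      z≼x : value (proj₁ z) * proj₂ (proj₁ x) ≤ value (proj₁ x) * proj₂ (proj₁ z)
      z≼x = subst₂ _≤_ (*-comm (proj₂ (proj₁ x)) _) (*-comm (proj₂ (proj₁ z)) _)
              (false-<ᵇ {proj₂ (proj₁ z) * value (proj₁ x)} (trans (sym (smaller-spec {x} {z} gx (All.lookup good z∈))) eq))
    extend-min : (minimal xs ≡ [] × xs ≡ [])
        ⊎ (∃[ z ] minimal xs ≡ z ∷ [] × z ∈ xs × (∀ {y} → y ∈ xs → proj₁ z ≼ frac (proj₁ y))) →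
      (minimal (x ∷ xs) ≡ [] × x ∷ xs ≡ []) ⊎ Least (minimal (x ∷ xs))
    extend-min (inj₁ (none , refl)) = inj₂ (x , refl , here refl , λ { (here refl) → ≤-refl })
    extend-min (inj₂ (z , eq , z∈ , min)) = inj₂ (subst (λ best → Least (if all (smaller x) best then x ∷ [] else best))
      (sym eq) (choose z (smaller x z) refl z∈ min))

  largest-below : ∀ z μ cs → Good μ → All Good cs → μ ≼ z →
    ∃[ ν ] ν ∈ μ ∷ cs × Good ν × ν ≼ z × (∀ {κ} → κ ∈ μ ∷ cs → κ ≼ z → κ ≼ frac ν)
  largest-below z μ [] gμ _ μ≼ = μ , here refl , gμ , μ≼ , λ { (here refl) _ → ≤-refl }
  largest-below z μ (κ ∷ cs) gμ (gκ ∷ good) μ≼ with value κ * proj₂ z ≤? proj₁ z * proj₂ κ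
  ... | no κ⋠ with largest-below z μ cs gμ good μ≼
  ...   | ν , ν∈ , gν , ν≼ , max = ν , skip ν∈ , gν , ν≼ , λ
    { (here refl) κ≼ → max (here refl) κ≼
    ; (there (here refl)) κ≼ → contradiction κ≼ κ⋠
    ; (there (there κ∈)) κ≼ → max (there κ∈) κ≼ }
    where
    skip : ∀ {ν} → ν ∈ μ ∷ cs → ν ∈ μ ∷ κ ∷ cs
    skip (here eq)  = here eq
    skip (there ν∈) = there (there ν∈)
  largest-below z μ (κ ∷ cs) gμ (gκ ∷ good) μ≼ | yes κ≼ with ≤-total (value μ * proj₂ κ) (value κ * proj₂ μ)
  ...   | inj₁ μ≼κ with largest-below z κ cs gκ good κ≼
  ...     | ν , ν∈ , gν , ν≼ , max = ν , there ν∈ , gν , ν≼ , λ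
    { (here refl) _ → ≼-trans (value μ) _ (value κ) (proj₂ κ) (value ν) _ (proj₂ gκ) μ≼κ (max (here refl) κ≼)
    ; (there κ∈) κ≼ → max κ∈ κ≼ }
  largest-below z μ (κ ∷ cs) gμ (gκ ∷ good) μ≼ | yes κ≼ | inj₂ κ≼μ with largest-below z μ cs gμ good μ≼
  ...     | ν , ν∈ , gν , ν≼ , max = ν , skip ν∈ , gν , ν≼ , λ
    { (here refl) κ≼ → max (here refl) κ≼
    ; (there (here refl)) _ → ≼-trans (value κ) _ (value μ) (proj₂ μ) (value ν) _ (proj₂ gμ) κ≼μ (max (here refl) μ≼)
    ; (there (there κ∈)) κ≼ → max (there κ∈) κ≼ }
    where
    skip : ∀ {ν} → ν ∈ μ ∷ cs → ν ∈ μ ∷ κ ∷ cs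
    skip (here eq)  = here eq
    skip (there ν∈) = there (there ν∈)

  price-zero : price zeroCost ≡ 0
  price-zero = sym (trans (proj₂ zero-priced) (*-identityʳ (price zeroCost)))

  -- Levels only change at the candidates, so rounding a threshold down to the
  -- next candidate raises none of them.
  rounding : ∀ x⋆ i⋆ → 0 < i⋆ → ∃[ μ ] μ ∈ candidates N es × μ ≼ (x⋆ , i⋆)
    × (∀ e → e ∈ Is → lev μ e ≤ levelℕ N x⋆ i⋆ (C e))
  -- The threshold 0 lies below every target, so a largest candidate below it exists.
  rounding x⋆ i⋆ i⋆>0 with largest-below (x⋆ , i⋆) (zeroCost , 1) _ (candidates-good (here refl))
      (All.tabulate (λ κ∈ → candidates-good (there κ∈))) (subst (λ n → n * i⋆ ≤ x⋆ * 1) (sym price-zero) z≤n)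
  ... | μ , μ∈ , good , μ≼ , max = μ , μ∈ , μ≼ , lev≤
    where
    open IsLevel
    lev≤ : ∀ e → e ∈ Is → lev μ e ≤ levelℕ N x⋆ i⋆ (C e)
    lev≤ e e∈ with lev μ e | lev-spec good e | levelℕ N x⋆ i⋆ (C e) | levelℕ-spec N x⋆ i⋆ (C e)
    ... | u | isU | v | isV with u ≤? v
    ...   | yes u≤v = u≤v
    lev≤ e e∈ | zero  | isU | v | isV | no u≰v = contradiction z≤n u≰v
    lev≤ e e∈ | suc w | isU | v | isV | no u≰v with ≰⇒> u≰v
    ...   | v<u with level-lo isU refl | level-up isV (≤-trans v<u (level≤ isU))
    -- Level 0 at the target forces the cost to be 0, which has level 0 at every threshold.
    lev≤ e e∈ | suc w | isU | zero | isV | no _ | v<u | lo | up = contradiction lo (≤⇒≯ (≤-trans (≤-reflexive nil≡) z≤n))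
      where
      nil≡ : proj₂ μ * C e ≡ 0
      nil≡ = trans (cong (proj₂ μ *_) (n≤0⇒n≡0 (*-cancelˡ-≤ i⋆ {{>-nonZero i⋆>0}} (≤-trans up (≤-reflexive (sym (*-zeroʳ i⋆)))))))
                   (*-zeroʳ (proj₂ μ))
    -- The quotient of the cost by `suc v` is a candidate below the target, hence at most `μ`. Then
    -- level `suc v` already suffices at `μ`, contrary to the larger level found there.
    lev≤ e e∈ | suc w | isU | suc v | isV | no _ | v<u | lo | up = contradiction lo (≤⇒≯ (begin
      proj₂ μ * C e ≡⟨ *-comm (proj₂ μ) (C e) ⟩
      C e * proj₂ μ ≤⟨ max (∈-candidates e∈ (s≤s z≤n) (≤-trans v<u (level≤ isU)))
                              (subst₂ _≤_ (*-comm i⋆ (C e)) (*-comm (suc v) x⋆) up) ⟩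
      value μ * suc v ≤⟨ *-monoʳ-≤ (value μ) (s≤s⁻¹ v<u) ⟩
      value μ * w ≡⟨ *-comm (value μ) w ⟩
      w * value μ ∎))
      where open ≤-Reasoning

  -- What is left of `Θ` for the edges of F⋆: `Θ − 2qKN − qm`, after the kept edges on both
  -- boundaries and the loss by rounding.
  quota : ℕ
  quota = d * K * N + ((d + q) * m + 1)

  -- With γ = p/q and d = p − 2q, rounding the levels costs qm in the analysis
  -- of a cut and N = pm + 2 leaves room for it.
  Θ≡ : Θ ≡ (d + 2 * q) * K * N + suc ((d + 2 * q) * m)
  Θ≡ = cong₂ _+_ (cong (λ n → n * K * N) p≡) (trans (cong (_∸ 1) N≡) (cong (λ n → suc (n * m)) p≡))

  -- The source of γ / (γ - 2) = p / d. The terms in `K` agree on both sides; `N` is large enough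
  -- for the remaining terms to leave the surplus `pqm + 2q`.
  threshold-ratio : d * Θ ≤ p * quota
  threshold-ratio = begin
    d * Θ ≡⟨ cong (d *_) Θ≡ ⟩
    d * ((d + 2 * q) * K * N + suc ((d + 2 * q) * m)) ≤⟨ m≤m+n _ ((d + 2 * q) * q * m + 2 * q) ⟩
    d * ((d + 2 * q) * K * N + suc ((d + 2 * q) * m)) + ((d + 2 * q) * q * m + 2 * q)
        ≡⟨ shape d q K N m ⟩
    (d + 2 * q) * quota ≡⟨ cong (_* quota) p≡ ⟨
    p * quota ∎
    where
    open ≤-Reasoning
    shape : ∀ d q K N m → d * ((d + 2 * q) * K * N + suc ((d + 2 * q) * m)) + ((d + 2 * q) * q * m + 2 * q)
                        ≡ (d + 2 * q) * (d * K * N + ((d + q) * m + 1))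
    shape = solve-∀

  quota>0 : 0 < quota
  quota>0 = ≤-trans (m≤n+m 1 ((d + q) * m)) (m≤n+m _ (d * K * N))

  kept : ⟦ cutT ⟧ → I → Bool
  kept c e = separates c (ends e) ∧ (lev (proj₁ c) e ≡ᵇ N)

  dropped : ⟦ cutT ⟧ → I → Bool
  dropped c e = separates c (ends e) ∧ not (lev (proj₁ c) e ≡ᵇ N)

  cutCost : ⟦ cutT ⟧ → ℕ
  cutCost c = total (λ e → if dropped c e then C e else 0) Is

  fromTrial : List ℕ → ⟦ trialT ⟧ → ⟦ cutT ⟧
  fromTrial R x = newCut p q N es R x

  passes⁻ : ∀ R x → passes p q N K es R x ≡ true → q * trialSize N es R x ≤ Θ
  passes⁻ R x eq = m∸n≡0⇒m≤n (≡ᵇ-true eq)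

  trialSize-sum : ∀ R x → trialSize N es R x
    ≡ total (λ e → indicator (separates (fromTrial R x) (ends e)) * lev (proj₁ x) e) Is
  trialSize-sum R x = trans (trialSize≡weight N es R x) (weight-sum (proj₁ x) (trialSide N es R x))

  kept-charge : ∀ b n → N * indicator (b ∧ (n ≡ᵇ N)) ≤ indicator b * n
  kept-charge false n = ≤-trans (≤-reflexive (*-zeroʳ N)) z≤n
  kept-charge true  n with n ≡ᵇ N in eq
  ... | false = ≤-trans (≤-reflexive (*-zeroʳ N)) z≤n
  ... | true  = ≤-reflexive (trans (*-identityʳ N) (trans (sym (≡ᵇ-true eq)) (sym (+-identityʳ n))))

  dropped-charge : ∀ v i b n Ce → IsLevel N v i Ce n → i * (if b ∧ not (n ≡ᵇ N) then Ce else 0) ≤ v * (indicator b * n)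
  dropped-charge v i false n Ce isL = ≤-trans (≤-reflexive (*-zeroʳ i)) z≤n
  dropped-charge v i true n Ce isL with n ≡ᵇ N in eq
  ... | true  = ≤-trans (≤-reflexive (*-zeroʳ i)) z≤n
  ... | false = ≤-trans (IsLevel.level-up isL (≤∧≢⇒< (IsLevel.level≤ isL) (false-≡ᵇ eq)))
                        (≤-reflexive (trans (*-comm n v) (cong (v *_) (sym (+-identityʳ n)))))

  -- A kept edge contributes a full `N` to the size of the cut, so the excess `N ∸ 1` granted by
  -- `passes` disappears in the integer division by `N`.
  few-kept : ∀ R x → passes p q N K es R x ≡ true →
             q * total (λ e → indicator (kept (fromTrial R x) e)) Is ≤ p * K
  few-kept R x ok = s≤s⁻¹ (*-cancelʳ-< N _ _ (begin
    suc (q * k * N) ≡⟨ cong suc (shape q k N) ⟩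
    suc (q * (N * k)) ≤⟨ s≤s (*-monoʳ-≤ q charged) ⟩
    suc (q * trialSize N es R x) ≤⟨ s≤s (passes⁻ R x ok) ⟩
    suc (p * K * N + (N ∸ 1)) ≡⟨ +-suc (p * K * N) (N ∸ 1) ⟨
    p * K * N + suc (N ∸ 1) ≡⟨ cong (p * K * N +_) (cong suc (cong (_∸ 1) N≡)) ⟩
    p * K * N + suc (suc (p * m)) ≡⟨ cong (p * K * N +_) N≡ ⟨
    p * K * N + N ≡⟨ +-comm (p * K * N) N ⟩
    suc (p * K) * N ∎))
    where
    open ≤-Reasoning
    k = total (λ e → indicator (kept (fromTrial R x) e)) Is
    shape : ∀ q k n → q * k * n ≡ q * (n * k)
    shape = solve-∀
    charged : N * k ≤ trialSize N es R x
    charged = ≤-trans (≤-reflexive (sym (total-*ˡ N _ Is)))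
      (≤-trans (total-mono Is λ e _ → kept-charge (separates (fromTrial R x) (ends e)) (lev (proj₁ x) e))
        (≤-reflexive (sym (trialSize-sum R x))))

  cost≤size : ∀ R x → Good (proj₁ x) →
              proj₂ (proj₁ x) * cutCost (fromTrial R x) ≤ value (proj₁ x) * trialSize N es R x
  cost≤size R x good = begin
    i * cutCost c ≡⟨ total-*ˡ i _ Is ⟨
    total (λ e → i * (if dropped c e then C e else 0)) Is ≤⟨ total-mono Is (λ e _ → dropped-charge v i (separates c (ends e)) (lev (proj₁ x) e) (C e) (lev-spec good e)) ⟩
    total (λ e → v * (indicator (separates c (ends e)) * lev (proj₁ x) e)) Is ≡⟨ total-*ˡ v _ Is ⟩
    v * total (λ e → indicator (separates c (ends e)) * lev (proj₁ x) e) Is ≡⟨ cong (v *_) (trialSize-sum R x) ⟨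
    v * trialSize N es R x ∎
    where
    open ≤-Reasoning
    c = fromTrial R x
    i = proj₂ (proj₁ x)
    v = value (proj₁ x)

  -- Four estimates with their denominators cleared: the cost is at most the threshold times the
  -- size, the size at most Θ / q, the threshold at most 2q · opt / (r · quota), and Θ / quota at
  -- most p / d.
  round-cost : ∀ R x opt → Good (proj₁ x) → passes p q N K es R x ≡ true →
    proj₁ x ≼ (2 * q * opt , length R * quota) → d * (length R * cutCost (fromTrial R x)) ≤ 2 * p * opt
  round-cost R x opt good ok below = *-cancelˡ-≤ (q * i * quota) {{>-nonZero (*-mono-≤ (*-mono-≤ q>0 (proj₂ good)) quota>0)}} (begin
    q * i * quota * (d * (r * k)) ≡⟨ shape₁ q i quota d r k ⟩
    d * (q * (i * k)) * (r * quota) ≤⟨ *-monoˡ-≤ (r * quota) (*-monoʳ-≤ d (*-monoʳ-≤ q (cost≤size R x good))) ⟩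
    d * (q * (v * z)) * (r * quota) ≡⟨ shape₂ d q v z (r * quota) ⟩
    d * (q * z) * (v * (r * quota)) ≤⟨ *-mono-≤ (*-monoʳ-≤ d (passes⁻ R x ok)) below ⟩
    d * Θ * (2 * q * opt * i) ≤⟨ *-monoˡ-≤ (2 * q * opt * i) threshold-ratio ⟩
    p * quota * (2 * q * opt * i) ≡⟨ shape₃ p quota q opt i ⟩
    q * i * quota * (2 * p * opt) ∎)
    where
    open ≤-Reasoning
    r = length R
    i = proj₂ (proj₁ x)
    v = value (proj₁ x)
    k = cutCost (fromTrial R x)
    z = trialSize N es R x
    shape₁ : ∀ q i j d r k → q * i * j * (d * (r * k)) ≡ d * (q * (i * k)) * (r * j)
    shape₁ = solve-∀
    shape₂ : ∀ d q v z s → d * (q * (v * z)) * s ≡ d * (q * z) * (v * s)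
    shape₂ = solve-∀
    shape₃ : ∀ p j q o i → p * j * (2 * q * o * i) ≡ q * i * j * (2 * p * o)
    shape₃ = solve-∀

  trials⁻ : ∀ R {x} → x ∈ trials N es R → Good (proj₁ x) × proj₂ x ∈ R
  trials⁻ R {x} x∈ = go (candidates N es) candidates-good x∈
    where
    go : ∀ cs → (∀ {μ} → μ ∈ cs → Good μ) → x ∈ concatMap (λ μ → map (λ t → μ , t) R) cs → Good (proj₁ x) × proj₂ x ∈ R
    go (μ ∷ cs) good x∈ with ∈-++⁻ (map (λ t → μ , t) R) x∈
    ... | inj₂ x∈′ = go cs (λ μ∈ → good (there μ∈)) x∈′
    ... | inj₁ x∈′ with ∈-map⁻ (λ t → μ , t) x∈′
    ...   | t , t∈ , refl = good (here refl) , t∈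

  NextTrial : List ℕ → ℕ × ℕ → Set
  NextTrial R z = ∃[ y ] best p q N K es R ≡ y ∷ [] × Good (proj₁ y) × proj₂ y ∈ R × passes p q N K es R y ≡ true × proj₁ y ≼ z

  -- The algorithm does not know `z`, which depends on the optimum. It takes the least successful
  -- threshold, and one success below `z` is enough to place that below `z` as well.
  best-spec : ∀ R z x → x ∈ trials N es R → passes p q N K es R x ≡ true → proj₁ x ≼ z →
    NextTrial R z
  best-spec R z x x∈ ok x≼ = found (minimal-spec passing good)
    where
    passing = filterᵇ (passes p q N K es R) (trials N es R)
    passing⁻ : ∀ {y} → y ∈ passing → y ∈ trials N es R × passes p q N K es R y ≡ true
    passing⁻ = ∈-filterᵇ⁻ (passes p q N K es R)
    good : All (λ y → Good (proj₁ y)) passing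
    good = All.tabulate λ y∈ → proj₁ (trials⁻ R (proj₁ (passing⁻ y∈)))
    x∈passing : x ∈ passing
    x∈passing = ∈-filterᵇ⁺ (passes p q N K es R) x∈ ok
    found : (minimal passing ≡ [] × passing ≡ [])
      ⊎ (∃[ y ] minimal passing ≡ y ∷ [] × y ∈ passing × (∀ {y′} → y′ ∈ passing → proj₁ y ≼ frac (proj₁ y′))) →
      NextTrial R z
    found (inj₁ (_ , none)) = contradiction (subst (x ∈_) none x∈passing) ∉[]
    found (inj₂ (y , eq , y∈ , min)) = y , eq , proj₁ gy , proj₂ gy , proj₂ (passing⁻ y∈)
      , ≼-trans (value (proj₁ y)) _ (value (proj₁ x)) (proj₂ (proj₁ x)) (proj₁ z) (proj₂ z)
          (proj₂ (proj₁ (trials⁻ R x∈))) (min x∈passing) x≼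
      where gy = trials⁻ R (proj₁ (passing⁻ y∈))

  module Averaging (inF : I → Bool) (R : List ℕ) (R≥2 : 2 ≤ length R) (uniq : Unique R)
    (L : ℕ → ℕ) (labelled : (∀ v → L v ∈ R) × (∀ {t} → t ∈ R → L t ≡ t)
      × total (λ e → indicator (not (inF e) ∧ not (L (proj₁ (ends e)) ≡ᵇ L (proj₂ (ends e))))) Is ≤ (length R ∸ 1) * K)
    where

    r OPT x⋆ i⋆ : ℕ
    r   = length R
    OPT = total (λ e → if inF e then C e else 0) Is
    x⋆  = 2 * q * OPT
    i⋆  = r * quota

    i⋆>0 : 0 < i⋆
    i⋆>0 = *-mono-≤ (≤-trans (s≤s z≤n) R≥2) quota>0

    u : I → ℕ
    u e = levelℕ N x⋆ i⋆ (C e)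

    U : ℕ
    U = total (λ e → if inF e then u e else 0) Is

    part : ℕ → ℕ → Bool
    part t v = L v ≡ᵇ t

    differ : I → Bool
    differ e = not (L (proj₁ (ends e)) ≡ᵇ L (proj₂ (ends e)))

    w : ℕ → ℕ
    w t = total (λ e → indicator (splits (part t) (ends e)) * u e) Is

    -- Rounding up adds at most one level per edge, whence the term in `m`. The proof cancels `OPT`;
    -- if this is 0, the edges of F⋆ are free and have level 0.
    removed-levels : 2 * q * U ≤ i⋆ + 2 * q * m
    removed-levels with OPT ≟ 0
    ... | yes OPT≡0 = ≤-trans (≤-reflexive (trans (cong (2 * q *_) U≡0) (*-zeroʳ (2 * q)))) z≤n
      where
      total≡0 : ∀ {A : Set} (f : A → ℕ) xs {x} → total f xs ≡ 0 → x ∈ xs → f x ≡ 0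
      total≡0 f (x ∷ xs) eq (here refl) = m+n≡0⇒m≡0 (f x) eq
      total≡0 f (x ∷ xs) eq (there x∈)  = total≡0 f xs (m+n≡0⇒n≡0 (f x) eq) x∈
      U≡0 : U ≡ 0
      U≡0 = total-0 Is λ e e∈ → none e (total≡0 (λ e → if inF e then C e else 0) Is OPT≡0 e∈)
        where
        none : ∀ e → (if inF e then C e else 0) ≡ 0 → (if inF e then u e else 0) ≡ 0
        none e eq with inF e
        ... | false = refl
        ... | true with u e | levelℕ-spec N x⋆ i⋆ (C e)
        ...   | zero  | _   = refl
        ...   | suc v | isL = contradiction (IsLevel.level-lo isL refl)
                  (≤⇒≯ (≤-trans (≤-reflexive (trans (cong (i⋆ *_) eq) (*-zeroʳ i⋆))) z≤n))
    ... | no OPT≢0 = *-cancelˡ-≤ OPT {{≢-nonZero OPT≢0}} (begin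
      OPT * (2 * q * U) ≡⟨ shape₁ OPT q U ⟩
      x⋆ * U ≡⟨ total-*ˡ x⋆ _ Is ⟨
      total (λ e → x⋆ * (if inF e then u e else 0)) Is ≤⟨ total-mono Is (λ e _ → each e) ⟩
      total (λ e → i⋆ * (if inF e then C e else 0) + x⋆) Is ≡⟨ total-+ _ _ Is ⟩
      total (λ e → i⋆ * (if inF e then C e else 0)) Is + total (λ _ → x⋆) Is ≡⟨ cong₂ _+_ (total-*ˡ i⋆ _ Is) (total-const x⋆ Is) ⟩
      i⋆ * OPT + m * x⋆ ≡⟨ shape₂ i⋆ OPT m q ⟩
      OPT * (i⋆ + 2 * q * m) ∎)
      where
      open ≤-Reasoning
      shape₁ : ∀ o q u → o * (2 * q * u) ≡ 2 * q * o * u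
      shape₁ = solve-∀
      shape₂ : ∀ i o m q → i * o + m * (2 * q * o) ≡ o * (i + 2 * q * m)
      shape₂ = solve-∀
      each : ∀ e → x⋆ * (if inF e then u e else 0) ≤ i⋆ * (if inF e then C e else 0) + x⋆
      each e with inF e
      ... | false = ≤-trans (≤-reflexive (*-zeroʳ x⋆)) z≤n
      ... | true with u e | levelℕ-spec N x⋆ i⋆ (C e)
      ...   | zero  | _   = ≤-trans (≤-reflexive (*-zeroʳ x⋆)) z≤n
      ...   | suc v | isL = ≤-trans (≤-reflexive (trans (*-suc x⋆ v) (+-comm x⋆ _)))
                (+-monoˡ-≤ x⋆ (≤-trans (≤-reflexive (*-comm x⋆ v)) (<⇒≤ (IsLevel.level-lo isL refl))))

    -- An edge between two parts lies on the boundary of these two only. This is the 2 in 2γ / (γ -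
    -- 2) as well as the 2 that γ has to exceed.
    parts-containing : ∀ a b → total (λ t → indicator ((L a ≡ᵇ t) xor (L b ≡ᵇ t))) R ≤ 2 * indicator (not (L a ≡ᵇ L b))
    parts-containing a b with L a ≡ᵇ L b in eq
    ... | true  = ≤-reflexive (total-0 R λ t _ → none t)
      where
      none : ∀ t → indicator ((L a ≡ᵇ t) xor (L b ≡ᵇ t)) ≡ 0
      none t rewrite ≡ᵇ-true {L a} {L b} eq with L b ≡ᵇ t
      ... | true  = refl
      ... | false = refl
    ... | false = ≤-trans (total-mono R λ t _ → each (L a ≡ᵇ t) (L b ≡ᵇ t))
        (≤-trans (≤-reflexive (total-+ _ _ R)) (+-mono-≤ (occurrences≤1 (L a) uniq) (≤-trans (occurrences≤1 (L b) uniq) (m≤m+n 1 0))))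
      where
      each : ∀ b c → indicator (b xor c) ≤ indicator b + indicator c
      each true  true  = z≤n
      each true  false = ≤-refl
      each false true  = ≤-refl
      each false false = ≤-refl

    parts-weight : total w R ≤ 2 * (N * ((r ∸ 1) * K) + U)
    parts-weight = begin
      total w R ≡⟨ total-swap (λ t e → indicator (splits (part t) (ends e)) * u e) R Is ⟩
      total (λ e → total (λ t → indicator (splits (part t) (ends e)) * u e) R) Is
        ≤⟨ total-mono Is (λ e _ → each e) ⟩
      total (λ e → 2 * (N * stays e + del e)) Is ≡⟨ total-*ˡ 2 _ Is ⟩
      2 * total (λ e → N * stays e + del e) Is ≡⟨ cong (2 *_) (trans (total-+ _ _ Is) (cong (_+ U) (total-*ˡ N stays Is))) ⟩
      2 * (N * total stays Is + U) ≤⟨ *-monoʳ-≤ 2 (+-monoˡ-≤ U (*-monoʳ-≤ N (proj₂ (proj₂ labelled)))) ⟩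
      2 * (N * ((r ∸ 1) * K) + U) ∎
      where
      open ≤-Reasoning
      stays del : I → ℕ
      stays e = indicator (not (inF e) ∧ differ e)
      del e  = if inF e then u e else 0
      charge : ∀ e → indicator (differ e) * u e ≤ N * stays e + del e
      charge e with inF e | differ e
      ... | true  | true  = ≤-trans (≤-reflexive (+-identityʳ (u e))) (m≤n+m _ (N * 0))
      ... | true  | false = z≤n
      ... | false | true  = ≤-trans (≤-reflexive (+-identityʳ (u e)))
                              (≤-trans (IsLevel.level≤ (levelℕ-spec N x⋆ i⋆ (C e)))
                                (≤-trans (≤-reflexive (sym (*-identityʳ N))) (m≤m+n (N * 1) 0)))
      ... | false | false = z≤n
      each : ∀ e → total (λ t → indicator (splits (part t) (ends e)) * u e) R ≤ 2 * (N * stays e + del e)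
      each e = ≤-trans (≤-reflexive (total-*ʳ _ (u e) R))
        (≤-trans (*-monoˡ-≤ (u e) (parts-containing (proj₁ (ends e)) (proj₂ (ends e))))
          (≤-trans (≤-reflexive (*-assoc 2 (indicator (differ e)) (u e))) (*-monoʳ-≤ 2 (charge e))))

    cheap-part : ∃[ t ] t ∈ R × q * w t ≤ Θ
    cheap-part = light R refl
      where
      light : ∀ R′ → R ≡ R′ → ∃[ t ] t ∈ R × q * w t ≤ Θ
      light []       refl = contradiction R≥2 λ ()
      light (a ∷ R′) refl with below-average w a R′
      ... | t , t∈ , avg = t , t∈ , *-cancelˡ-≤ r {{>-nonZero (≤-trans (s≤s z≤n) R≥2)}} (begin
        r * (q * w t) ≡⟨ shape₁ r q (w t) ⟩
        q * (r * w t) ≤⟨ *-monoʳ-≤ q (≤-trans avg parts-weight) ⟩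
        q * (2 * (N * ((r ∸ 1) * K) + U)) ≡⟨ shape₂ q N (r ∸ 1) K U ⟩
        (r ∸ 1) * (2 * q * K * N) + 2 * q * U ≤⟨ +-mono-≤ (*-monoˡ-≤ (2 * q * K * N) (m∸n≤m r 1)) removed-levels ⟩
        r * (2 * q * K * N) + (i⋆ + 2 * q * m) ≡⟨ cong (λ n → r * (2 * q * K * N) + (i⋆ + n)) (*-assoc 2 q m) ⟩
        -- With at least two active terminals the rounding loss `2qm`, shared among them, is at most
        -- `qm` each, as allowed for in `quota`.
        r * (2 * q * K * N) + (i⋆ + 2 * (q * m)) ≤⟨ +-monoʳ-≤ (r * (2 * q * K * N)) (+-monoʳ-≤ i⋆ (*-monoˡ-≤ (q * m) R≥2)) ⟩
        r * (2 * q * K * N) + (r * quota + r * (q * m)) ≡⟨ shape₃ r q d K N m ⟩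
        r * ((d + 2 * q) * K * N + suc ((d + 2 * q) * m)) ≡⟨ cong (r *_) Θ≡ ⟨
        r * Θ ∎)
        where
        open ≤-Reasoning
        shape₁ : ∀ r q w → r * (q * w) ≡ q * (r * w)
        shape₁ = solve-∀
        shape₂ : ∀ q N r K U → q * (2 * (N * (r * K) + U)) ≡ r * (2 * q * K * N) + 2 * q * U
        shape₂ = solve-∀
        shape₃ : ∀ r q d K N m → r * (2 * q * K * N) + (r * (d * K * N + ((d + q) * m + 1)) + r * (q * m))
                               ≡ r * ((d + 2 * q) * K * N + suc ((d + 2 * q) * m))
        shape₃ = solve-∀

    part-isolates : ∀ {t} → t ∈ R → Isolates R t (part t)
    part-isolates {t} t∈ = subst (λ v → (v ≡ᵇ t) ≡ true) (sym (proj₁ (proj₂ labelled) t∈)) (≡ᵇ-refl t)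
      , λ v v∈ v≢t → ≡ᵇ-false λ Lv≡t → v≢t (trans (sym (proj₁ (proj₂ labelled) v∈)) Lv≡t)

    small-cut : ∀ {t μ} → t ∈ R → q * w t ≤ Θ → (∀ e → e ∈ Is → lev μ e ≤ u e) → q * trialSize N es R (μ , t) ≤ Θ
    small-cut {t} {μ} t∈ cheap lower = begin
      q * trialSize N es R (μ , t) ≤⟨ *-monoʳ-≤ q (trialSize-minimal N es R (μ , t) (part t) (part-isolates t∈)) ⟩
      q * weight N es μ (part t) ≡⟨ cong (q *_) (weight-sum μ (part t)) ⟩
      q * total (λ e → indicator (splits (part t) (ends e)) * lev μ e) Is
        ≤⟨ *-monoʳ-≤ q (total-mono Is λ e e∈ → *-monoʳ-≤ (indicator (splits (part t) (ends e))) (lower e e∈)) ⟩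
      q * w t ≤⟨ cheap ⟩
      Θ ∎
      where open ≤-Reasoning

    passes⁺ : ∀ x → q * trialSize N es R x ≤ Θ → passes p q N K es R x ≡ true
    passes⁺ x le = cong (_≡ᵇ 0) (m≤n⇒m∸n≡0 le)

    ∈-trials : ∀ {μ t} → μ ∈ candidates N es → t ∈ R → (μ , t) ∈ trials N es R
    ∈-trials {μ} {t} μ∈ t∈ = go μ∈
      where
      go : ∀ {cs} → μ ∈ cs → (μ , t) ∈ concatMap (λ μ → map (λ t → μ , t) R) cs
      go (here refl) = ∈-++⁺ˡ (∈-map⁺ (λ t → μ , t) t∈)
      go {κ ∷ cs} (there μ∈) = ∈-++⁺ʳ (map (λ t → κ , t) R) (go μ∈)

    successful-trial : ∃[ x ] (x ∈ trials N es R × passes p q N K es R x ≡ true) × proj₁ x ≼ (x⋆ , i⋆)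
    successful-trial = combine cheap-part (rounding x⋆ i⋆ i⋆>0)
      where
      combine : ∃[ t ] t ∈ R × q * w t ≤ Θ →
        ∃[ μ ] μ ∈ candidates N es × μ ≼ (x⋆ , i⋆) × (∀ e → e ∈ Is → lev μ e ≤ u e) →
        ∃[ x ] (x ∈ trials N es R × passes p q N K es R x ≡ true) × proj₁ x ≼ (x⋆ , i⋆)
      combine (t , t∈ , cheap) (μ , μ∈ , μ≼ , lower) =
        (μ , t) , (∈-trials μ∈ t∈ , passes⁺ (μ , t) (small-cut {t} {μ} t∈ cheap lower)) , μ≼

  -- The sequence of rounds

  module Run (inF : I → Bool) (R₀ : List ℕ)
    (pairCut : ∀ s t → s ∈ R₀ → t ∈ R₀ → s ≢ t →
      ∃[ Y ] Y s ≡ true × Y t ≡ false × total (λ e → indicator (not (inF e) ∧ splits Y (ends e))) Is ≤ K)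
    (unique₀ : Unique R₀) where

    optimum : ℕ
    optimum = total (λ e → if inF e then C e else 0) Is

    -- Schedule r log: the last cut was made among suc r terminals, the one
    -- before it among suc (suc r), and so on.
    Schedule : ℕ → List ⟦ cutT ⟧ → Set
    Schedule r []        = ⊤
    Schedule r (c ∷ log) = d * (suc r * cutCost c) ≤ 2 * p * optimum × Schedule (suc r) log

    Separated : List ⟦ cutT ⟧ → ℕ → ℕ → Set
    Separated log s t = ∃[ c ] c ∈ log × separates c (s , t) ≡ true

    record State (R : List ℕ) (log : List ⟦ cutT ⟧) : Set where
      field
        uniq     : Unique R
        sub      : All (_∈ R₀) R
        covered  : ∀ {s t} → s ∈ R₀ → t ∈ R₀ → s ≢ t → (s ∈ R × t ∈ R) ⊎ Separated log s t
        few      : All (λ c → q * total (λ e → indicator (kept c e)) Is ≤ p * K) log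
        sched    : Schedule (length R) log
        lengths  : length R + length log ≡ length R₀

    open State

    next-cut : ∀ R → 2 ≤ length R → Unique R → All (_∈ R₀) R →
      NextTrial R (2 * q * optimum , length R * quota)
    next-cut R R≥2 uniqR R⊆ = from-labelling
      (Labelling.labelling Is ends (λ e → not (inF e)) K R₀ pairCut (length R) R ≤-refl (≤-trans (s≤s z≤n) R≥2) uniqR R⊆)
      where
      from-trial : ∃[ x ] (x ∈ trials N es R × passes p q N K es R x ≡ true) × proj₁ x ≼ (2 * q * optimum , length R * quota) → NextTrial R (2 * q * optimum , length R * quota)
      from-trial (x , (x∈ , ok) , x≼) = best-spec R (2 * q * optimum , length R * quota) x x∈ ok x≼
      from-labelling : ∃[ L ] Labelling.IsLabelling Is ends (λ e → not (inF e)) K R₀ pairCut R L → NextTrial R (2 * q * optimum , length R * quota)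
      from-labelling (L , labelled) = from-trial (Averaging.successful-trial inF R R≥2 uniqR L labelled)

    cutSide : ⟦ cutT ⟧ → ℕ → Bool
    cutSide c = visited (proj₁ (proj₂ c)) (proj₂ (proj₂ c))

    extend : ∀ R log v c → State R log → v ∈ R → Isolates R v (cutSide c) →
      q * total (λ e → indicator (kept c e)) Is ≤ p * K → d * (length R * cutCost c) ≤ 2 * p * optimum →
      State (without v R) (c ∷ log)
    extend R log v c st v∈ isolated few-c cost-c = record
      { uniq    = unique-without (uniq st)
      ; sub     = All.tabulate λ w∈ → All.lookup (sub st) (proj₁ (∈-without⁻ R w∈))
      ; covered = λ s∈ t∈ s≢t → cover s≢t (covered st s∈ t∈ s≢t)
      ; few     = few-c ∷ few st
      ; sched   = subst (λ r → d * (r * cutCost c) ≤ 2 * p * optimum) (sym shorter) cost-c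
                  , subst (λ r → Schedule r log) (sym shorter) (sched st)
      ; lengths = trans (+-suc (length (without v R)) (length log)) (trans (cong (_+ length log) shorter) (lengths st))
      }
      where
      shorter : suc (length (without v R)) ≡ length R
      shorter = length-without (uniq st) v∈
      cover : ∀ {s t} → s ≢ t → (s ∈ R × t ∈ R) ⊎ Separated log s t →
              (s ∈ without v R × t ∈ without v R) ⊎ Separated (c ∷ log) s t
      cover s≢t (inj₂ (c′ , c∈ , sep)) = inj₂ (c′ , there c∈ , sep)
      cover {s} {t} s≢t (inj₁ (s∈ , t∈)) = by-cases (s ≟ v) (t ≟ v)
        where
        by-cases : Dec (s ≡ v) → Dec (t ≡ v) → (s ∈ without v R × t ∈ without v R) ⊎ Separated (c ∷ log) s t
        by-cases (yes refl) _          = inj₂ (c , here refl , cong₂ _xor_ (proj₁ isolated) (proj₂ isolated t t∈ (λ eq → s≢t (sym eq))))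
        by-cases (no s≢v)   (yes refl) = inj₂ (c , here refl , cong₂ _xor_ (proj₂ isolated s s∈ s≢t) (proj₁ isolated))
        by-cases (no s≢v)   (no t≢v)   = inj₁ (∈-without⁺ s∈ s≢v , ∈-without⁺ t∈ t≢v)

    NextState : List ℕ → List ⟦ cutT ⟧ → Set
    NextState R log = ∃[ R′ ] ∃[ log′ ] round p q N K es (R , log) ≡ (R′ , log′) × suc (length R′) ≡ length R × State R′ log′

    round-step : ∀ R log → 2 ≤ length R → State R log →
      NextState R log
    round-step R log R≥2 st = step-with (next-cut R R≥2 (uniq st) (sub st))
      where
      step-with : NextTrial R (2 * q * optimum , length R * quota) →
        NextState R log
      step-with (y , eq , good , y∈ , ok , y≼) = without (proj₂ y) R , fromTrial R y ∷ log
        , cong (λ ys → logCut (R , log) (map (newCut p q N es R) ys)) eq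
        , length-without (uniq st) y∈
        , extend R log (proj₂ y) (fromTrial R y) st y∈ (trial-isolates N es R y) (few-kept R y ok) (round-cost R y optimum good ok y≼)

    initial-state : State R₀ []
    initial-state = record
      { uniq = unique₀ ; sub = All.tabulate id ; covered = λ s∈ t∈ _ → inj₁ (s∈ , t∈) ; few = [] ; sched = tt
      ; lengths = +-identityʳ (length R₀) }

    StateAfter : ℕ → Set
    StateAfter k = ∃[ R ] ∃[ log ] iter k (round p q N K es) (R₀ , []) ≡ (R , log) × length R + k ≡ length R₀ × State R log

    iterate : ∀ k → k ≤ length R₀ ∸ 1 →
      StateAfter k
    iterate zero    _  = R₀ , [] , refl , +-identityʳ (length R₀) , initial-state
    iterate (suc k) k< = next (iterate k (<⇒≤ k<))
      where
      next : StateAfter k →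
        StateAfter (suc k)
      next (R , log , eq , len , st) = finish (round-step R log R≥2 st)
        where
        R≥2 : 2 ≤ length R
        R≥2 = +-cancelʳ-≤ k 2 (length R) (≤-trans (s≤s k<) (≤-trans (≤-reflexive (suc-pred′ (length R₀) k<)) (≤-reflexive (sym len))))
          where
          suc-pred′ : ∀ n → suc k ≤ n ∸ 1 → suc (n ∸ 1) ≡ n
          suc-pred′ (suc n) _ = refl
        finish : NextState R log →
          StateAfter (suc k)
        finish (R′ , log′ , eq′ , len′ , st′) = R′ , log′ , trans (cong (round p q N K es) eq) eq′
          , trans (+-suc (length R′) k) (trans (cong (_+ k) len′) len) , st′

    result : ∃[ R ] State R (rounds p q N K es R₀) × length R ≤ 1
    result = extract (iterate (length R₀ ∸ 1) ≤-refl)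
      where
      extract : StateAfter (length R₀ ∸ 1) →
        ∃[ R ] State R (rounds p q N K es R₀) × length R ≤ 1
      extract (R , log , eq , len , st) = R , subst (State R) (sym (cong proj₂ eq)) st
        , short (length R₀) len
        where
        short : ∀ n → length R + (n ∸ 1) ≡ n → length R ≤ 1
        short zero    len = ≤-trans (m≤m+n _ 0) (≤-trans (≤-reflexive len) z≤n)
        short (suc n) len = ≤-reflexive (+-cancelʳ-≡ n (length R) 1 len)

    chosen : List ⟦ cutT ⟧ → I → Bool
    chosen log e = selected N log (dat e)

    chosen-dropped : ∀ {c e log} → c ∈ log → dropped c e ≡ true → chosen log e ≡ true
    chosen-dropped {c} {e} c∈ drop = any⁺ (λ c → dropped c e) c∈ drop

    -- At most one terminal is still active, so some logged cut separates the pair. An edge across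
    -- it that survives the whole solution was not dropped by it, hence is among the few that it
    -- kept.
    separation : ∀ R log → State R log → length R ≤ 1 → ∀ {s t} → s ∈ R₀ → t ∈ R₀ → s ≢ t →
      ∃[ Y ] (Y s xor Y t) ≡ true × q * total (λ e → indicator (not (chosen log e) ∧ splits Y (ends e))) Is ≤ p * K
    separation R log st short {s} {t} s∈ t∈ s≢t with covered st s∈ t∈ s≢t
    ... | inj₁ (s∈R , t∈R) = contradiction (single R short s∈R t∈R) s≢t
      where
      single : ∀ R → length R ≤ 1 → s ∈ R → t ∈ R → s ≡ t
      single (v ∷ [])    _        (here refl) (here refl) = refl
      single (v ∷ w ∷ R) (s≤s ()) _           _
    ... | inj₂ (c , c∈ , sep) = cutSide c , sep
      , ≤-trans (*-monoʳ-≤ q (total-mono Is λ e _ → indicator-mono (stays e))) (All.lookup (few st) c∈)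
      where
      stays : ∀ e → not (chosen log e) ∧ separates c (ends e) ≡ true → kept c e ≡ true
      stays e eq = by-level (lev (proj₁ c) e ≡ᵇ N) refl
        where
        unchosen = proj₁ (∧-true {not (chosen log e)} eq)
        crossing = proj₂ (∧-true {not (chosen log e)} eq)
        by-level : ∀ b → (lev (proj₁ c) e ≡ᵇ N) ≡ b → kept c e ≡ true
        by-level true  atN = cong₂ _∧_ crossing atN
        by-level false atN = ⊥-elim (true≢false
          (chosen-dropped {c} {e} c∈ (cong₂ (λ b l → b ∧ not l) crossing atN)) (not-true unchosen))

    chosen-cost : ∀ log → total (λ e → if selected N log (dat e) then C e else 0) Is ≤ total cutCost log
    chosen-cost log = ≤-trans (total-mono Is λ e _ → pay e log)
      (≤-reflexive (total-swap (λ e c → if dropped c e then C e else 0) Is log))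
      where
      pay : ∀ e log → (if any (λ c → dropped c e) log then C e else 0) ≤ total (λ c → if dropped c e then C e else 0) log
      pay e []        = z≤n
      pay e (c ∷ log) with dropped c e
      ... | true  = m≤m+n (C e) _
      ... | false = pay e log

-- Rational numbers

ℕ→ℚ-raw : ∀ n → ℚ.toℚᵘ (ℕ→ℚ n) ℚᵘ.≃ ℚᵘ.mkℚᵘ (ℤ.+ n) 0
ℕ→ℚ-raw n = ℚ.toℚᵘ-fromℚᵘ (ℚᵘ.mkℚᵘ (ℤ.+ n) 0)

ℕ→ℚ-+ : ∀ m n → ℕ→ℚ (m + n) ≡ ℕ→ℚ m ℚ.+ ℕ→ℚ n
ℕ→ℚ-+ m n = ℚ.toℚᵘ-injective (begin
  ℚ.toℚᵘ (ℕ→ℚ (m + n)) ≈⟨ ℕ→ℚ-raw (m + n) ⟩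
  ℚᵘ.mkℚᵘ (ℤ.+ (m + n)) 0 ≈⟨ ℚᵘ.*≡* (cong (ℤ._* ℤ.1ℤ) (sym (cong₂ ℤ._+_ (ℤ.*-identityʳ (ℤ.+ m)) (ℤ.*-identityʳ (ℤ.+ n))))) ⟩
  ℚᵘ.mkℚᵘ (ℤ.+ m) 0 ℚᵘ.+ ℚᵘ.mkℚᵘ (ℤ.+ n) 0 ≈⟨ ℚᵘ.+-cong (ℕ→ℚ-raw m) (ℕ→ℚ-raw n) ⟨
  ℚ.toℚᵘ (ℕ→ℚ m) ℚᵘ.+ ℚ.toℚᵘ (ℕ→ℚ n) ≈⟨ ℚ.toℚᵘ-homo-+ (ℕ→ℚ m) (ℕ→ℚ n) ⟨
  ℚ.toℚᵘ (ℕ→ℚ m ℚ.+ ℕ→ℚ n) ∎)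
  where open import Relation.Binary.Reasoning.Setoid ℚᵘ.≃-setoid

ℕ→ℚ-* : ∀ m n → ℕ→ℚ (m * n) ≡ ℕ→ℚ m ℚ.* ℕ→ℚ n
ℕ→ℚ-* m n = ℚ.toℚᵘ-injective (begin
  ℚ.toℚᵘ (ℕ→ℚ (m * n)) ≈⟨ ℕ→ℚ-raw (m * n) ⟩
  ℚᵘ.mkℚᵘ (ℤ.+ (m * n)) 0 ≈⟨ ℚᵘ.*≡* (cong (ℤ._* ℤ.1ℤ) (ℤ.pos-* m n)) ⟩
  ℚᵘ.mkℚᵘ (ℤ.+ m) 0 ℚᵘ.* ℚᵘ.mkℚᵘ (ℤ.+ n) 0 ≈⟨ ℚᵘ.*-cong (ℕ→ℚ-raw m) (ℕ→ℚ-raw n) ⟨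
  ℚ.toℚᵘ (ℕ→ℚ m) ℚᵘ.* ℚ.toℚᵘ (ℕ→ℚ n) ≈⟨ ℚ.toℚᵘ-homo-* (ℕ→ℚ m) (ℕ→ℚ n) ⟨
  ℚ.toℚᵘ (ℕ→ℚ m ℚ.* ℕ→ℚ n) ∎)
  where open import Relation.Binary.Reasoning.Setoid ℚᵘ.≃-setoid

ℕ→ℚ-mono : ∀ {m n} → m ≤ n → ℕ→ℚ m ℚ.≤ ℕ→ℚ n
ℕ→ℚ-mono {m} {n} m≤n = ℚ.toℚᵘ-cancel-≤ (ℚᵘ.≤-respˡ-≃ (ℚᵘ.≃-sym (ℕ→ℚ-raw m)) (ℚᵘ.≤-respʳ-≃ (ℚᵘ.≃-sym (ℕ→ℚ-raw n))
  (ℚᵘ.*≤* (ℤ.*-monoʳ-≤-nonNeg ℤ.1ℤ (ℤ.+≤+ m≤n)))))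

ℕ→ℚ-cancel : ∀ {m n} → ℕ→ℚ m ℚ.≤ ℕ→ℚ n → m ≤ n
ℕ→ℚ-cancel {m} {n} le with ℚᵘ.≤-respˡ-≃ (ℕ→ℚ-raw m) (ℚᵘ.≤-respʳ-≃ (ℕ→ℚ-raw n) (ℚ.toℚᵘ-mono-≤ le))
... | ℚᵘ.*≤* le′ = ℤ.drop‿+≤+ (ℤ.*-cancelʳ-≤-pos (ℤ.+ m) (ℤ.+ n) ℤ.1ℤ le′)

ℕ→ℚ≥0 : ∀ n → 0ℚ ℚ.≤ ℕ→ℚ n
ℕ→ℚ≥0 n = ℕ→ℚ-mono {0} {n} z≤n

ℕ→ℚ-pos : ∀ {n} → 0 < n → ℚ.Positive (ℕ→ℚ n)
ℕ→ℚ-pos {n} n>0 = ℚ.positive (ℚ.≰⇒> λ n≤0 → <⇒≱ n>0 (ℕ→ℚ-cancel {n} {0} n≤0))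

ℕ→ℚ-nonNeg : ∀ n → ℚ.NonNegative (ℕ→ℚ n)
ℕ→ℚ-nonNeg n = ℚ.nonNegative (ℕ→ℚ≥0 n)

*-denominator : ∀ x → 0ℚ ℚ.≤ x → x ℚ.* ℕ→ℚ (↧ₙ x) ≡ ℕ→ℚ (ℤ.∣ ↥ x ∣)
*-denominator x@(mkℚ (ℤ.+ n) d-1 _) _ = ℚ.toℚᵘ-injective (begin
  ℚ.toℚᵘ (x ℚ.* ℕ→ℚ (suc d-1)) ≈⟨ ℚ.toℚᵘ-homo-* x (ℕ→ℚ (suc d-1)) ⟩
  ℚ.toℚᵘ x ℚᵘ.* ℚ.toℚᵘ (ℕ→ℚ (suc d-1)) ≈⟨ ℚᵘ.*-congˡ {ℚ.toℚᵘ x} (ℕ→ℚ-raw (suc d-1)) ⟩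
  ℚᵘ.mkℚᵘ (ℤ.+ n) d-1 ℚᵘ.* ℚᵘ.mkℚᵘ (ℤ.+ suc d-1) 0 ≈⟨ ℚᵘ.*≡* (trans (ℤ.*-identityʳ _)
                                                           (cong (ℤ.+ n ℤ.*_) (cong (λ k → ℤ.+ suc k) (sym (*-identityʳ d-1))))) ⟩
  ℚᵘ.mkℚᵘ (ℤ.+ n) 0 ≈⟨ ℕ→ℚ-raw n ⟨
  ℚ.toℚᵘ (ℕ→ℚ n) ∎)
  where open import Relation.Binary.Reasoning.Setoid ℚᵘ.≃-setoid
*-denominator (mkℚ ℤ.-[1+ n ] d-1 _) (ℚ.*≤* ())

unit-fraction : ∀ r → (ℤ.+ 1 ℚ./ suc r) ℚ.* ℕ→ℚ (suc r) ≡ 1ℚ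
unit-fraction r = ℚ.toℚᵘ-injective (begin
  ℚ.toℚᵘ ((ℤ.+ 1 ℚ./ suc r) ℚ.* ℕ→ℚ (suc r)) ≈⟨ ℚ.toℚᵘ-homo-* (ℤ.+ 1 ℚ./ suc r) (ℕ→ℚ (suc r)) ⟩
  ℚ.toℚᵘ (ℤ.+ 1 ℚ./ suc r) ℚᵘ.* ℚ.toℚᵘ (ℕ→ℚ (suc r)) ≈⟨ ℚᵘ.*-cong (ℚ.toℚᵘ-fromℚᵘ (ℚᵘ.mkℚᵘ (ℤ.+ 1) r)) (ℕ→ℚ-raw (suc r)) ⟩
  ℚᵘ.mkℚᵘ (ℤ.+ 1) r ℚᵘ.* ℚᵘ.mkℚᵘ (ℤ.+ suc r) 0 ≈⟨ ℚᵘ.*≡* (cong ℤ.+_ (shape r)) ⟩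
  ℚᵘ.1ℚᵘ ∎)
  where
  open import Relation.Binary.Reasoning.Setoid ℚᵘ.≃-setoid
  shape : ∀ r → suc ((r + 0) * 1) ≡ suc (r * 1 + 0)
  shape = solve-∀

sum-scaled : ∀ {A : Set} D n (f : Fin n → A) (g : Fin n → ℚ) (h : A → ℕ) →
  (∀ e → g e ℚ.* ℕ→ℚ D ≡ ℕ→ℚ (h (f e))) → sum g ℚ.* ℕ→ℚ D ≡ ℕ→ℚ (total h (tabulate f))
sum-scaled D zero    f g h eq = ℚ.*-zeroˡ (ℕ→ℚ D)
sum-scaled D (suc n) f g h eq = trans (ℚ.*-distribʳ-+ (ℕ→ℚ D) (g Fin.zero) _)
  (trans (cong₂ ℚ._+_ (eq Fin.zero) (sum-scaled D n (λ e → f (Fin.suc e)) (λ e → g (Fin.suc e)) h (λ e → eq (Fin.suc e))))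
         (sym (ℕ→ℚ-+ (h (f Fin.zero)) _)))

harmonic≥0 : ∀ r → 0ℚ ℚ.≤ harmonic r
harmonic≥0 zero    = ℚ.≤-refl
harmonic≥0 (suc r) = ℚ.+-mono-≤ (harmonic≥0 r) (ℚ.*-cancelʳ-≤-pos (ℕ→ℚ (suc r)) {{ℕ→ℚ-pos {suc r} (s≤s z≤n)}}
  (subst₂ ℚ._≤_ (sym (ℚ.*-zeroˡ (ℕ→ℚ (suc r)))) (sym (unit-fraction r)) (ℕ→ℚ≥0 1)))

module Ratio (γ : ℚ) (2<γ : 2ℚ ℚ.< γ) where

  p q d : ℕ
  p = ℤ.∣ ↥ γ ∣
  q = ↧ₙ γ
  d = p ∸ 2 * q

  ratio : ℚ
  ratio = ((2ℚ ℚ.* γ) ℚ.÷ (γ ℚ.- 2ℚ)) {{γ-2-nonZero 2<γ}}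

  γ≥0 : 0ℚ ℚ.≤ γ
  γ≥0 = ℚ.≤-trans (ℕ→ℚ≥0 2) (ℚ.<⇒≤ 2<γ)

  q>0 : 0 < q
  q>0 = s≤s z≤n

  γq≡p : γ ℚ.* ℕ→ℚ q ≡ ℕ→ℚ p
  γq≡p = *-denominator γ γ≥0

  2q<p : 2 * q < p
  2q<p = ≰⇒> λ p≤2q → ℚ.<-irrefl refl (ℚ.<-≤-trans 2<γ (ℚ.*-cancelʳ-≤-pos (ℕ→ℚ q) {{ℕ→ℚ-pos q>0}}
    (subst₂ ℚ._≤_ (sym γq≡p) (ℕ→ℚ-* 2 q) (ℕ→ℚ-mono p≤2q))))

  p≡ : p ≡ d + 2 * q
  p≡ = sym (m∸n+n≡m (<⇒≤ 2q<p))

  d>0 : 0 < d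
  d>0 = m<n⇒0<n∸m 2q<p

  ratio-d : ratio ℚ.* ℕ→ℚ d ≡ ℕ→ℚ (2 * p)
  ratio-d = begin
    ratio ℚ.* ℕ→ℚ d ≡⟨ cong (ratio ℚ.*_) gap ⟨
    ratio ℚ.* ((γ ℚ.- 2ℚ) ℚ.* ℕ→ℚ q) ≡⟨ rearrange (2ℚ ℚ.* γ) (ℚ.1/ (γ ℚ.- 2ℚ)) (γ ℚ.- 2ℚ) (ℕ→ℚ q) ⟩
    (2ℚ ℚ.* γ) ℚ.* (ℚ.1/ (γ ℚ.- 2ℚ) ℚ.* (γ ℚ.- 2ℚ)) ℚ.* ℕ→ℚ q ≡⟨ cong (λ x → (2ℚ ℚ.* γ) ℚ.* x ℚ.* ℕ→ℚ q) (ℚ.*-inverseˡ (γ ℚ.- 2ℚ)) ⟩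
    (2ℚ ℚ.* γ) ℚ.* 1ℚ ℚ.* ℕ→ℚ q ≡⟨ cong (ℚ._* ℕ→ℚ q) (ℚ.*-identityʳ (2ℚ ℚ.* γ)) ⟩
    (2ℚ ℚ.* γ) ℚ.* ℕ→ℚ q ≡⟨ ℚ.*-assoc 2ℚ γ (ℕ→ℚ q) ⟩
    2ℚ ℚ.* (γ ℚ.* ℕ→ℚ q) ≡⟨ cong (2ℚ ℚ.*_) γq≡p ⟩
    2ℚ ℚ.* ℕ→ℚ p ≡⟨ ℕ→ℚ-* 2 p ⟨
    ℕ→ℚ (2 * p) ∎
    where
    open ≡-Reasoning
    open ℚ.+-*-Solver
    instance
      gap≢0 : ℚ.NonZero (γ ℚ.- 2ℚ)
      gap≢0 = γ-2-nonZero 2<γ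
    rearrange : ∀ a b c e → (a ℚ.* b) ℚ.* (c ℚ.* e) ≡ a ℚ.* (b ℚ.* c) ℚ.* e
    rearrange = solve 4 (λ a b c e → (a :* b) :* (c :* e) := a :* (b :* c) :* e) refl
    gap : (γ ℚ.- 2ℚ) ℚ.* ℕ→ℚ q ≡ ℕ→ℚ d
    gap = begin
      (γ ℚ.- 2ℚ) ℚ.* ℕ→ℚ q ≡⟨ solve 3 (λ g t k → (g :- t) :* k := g :* k :- t :* k) refl γ 2ℚ (ℕ→ℚ q) ⟩
      γ ℚ.* ℕ→ℚ q ℚ.- 2ℚ ℚ.* ℕ→ℚ q ≡⟨ cong₂ ℚ._-_ (trans γq≡p (trans (cong ℕ→ℚ p≡) (ℕ→ℚ-+ d (2 * q)))) (sym (ℕ→ℚ-* 2 q)) ⟩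
      (ℕ→ℚ d ℚ.+ ℕ→ℚ (2 * q)) ℚ.- ℕ→ℚ (2 * q) ≡⟨ solve 2 (λ a b → (a :+ b) :- b := a) refl (ℕ→ℚ d) (ℕ→ℚ (2 * q)) ⟩
      ℕ→ℚ d ∎

  ratio≥0 : 0ℚ ℚ.≤ ratio
  ratio≥0 = ℚ.*-cancelʳ-≤-pos (ℕ→ℚ d) {{ℕ→ℚ-pos d>0}}
    (subst₂ ℚ._≤_ (sym (ℚ.*-zeroˡ (ℕ→ℚ d))) (sym ratio-d) (ℕ→ℚ≥0 (2 * p)))

  round-share : ∀ r c opt → d * (suc r * c) ≤ 2 * p * opt →
    ℕ→ℚ c ℚ.≤ ratio ℚ.* ℕ→ℚ opt ℚ.* (ℤ.+ 1 ℚ./ suc r)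
  round-share r c opt le = ℚ.*-cancelʳ-≤-pos (ℕ→ℚ (suc r)) {{ℕ→ℚ-pos {suc r} (s≤s z≤n)}}
    (ℚ.*-cancelʳ-≤-pos (ℕ→ℚ d) {{ℕ→ℚ-pos d>0}} (subst₂ ℚ._≤_ left right (ℕ→ℚ-mono le)))
    where
    open ℚ.+-*-Solver
    left : ℕ→ℚ (d * (suc r * c)) ≡ ℕ→ℚ c ℚ.* ℕ→ℚ (suc r) ℚ.* ℕ→ℚ d
    left = trans (ℕ→ℚ-* d (suc r * c)) (trans (cong (ℕ→ℚ d ℚ.*_) (ℕ→ℚ-* (suc r) c))
      (solve 3 (λ d r c → d :* (r :* c) := c :* r :* d) refl (ℕ→ℚ d) (ℕ→ℚ (suc r)) (ℕ→ℚ c)))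
    right : ℕ→ℚ (2 * p * opt) ≡ ratio ℚ.* ℕ→ℚ opt ℚ.* (ℤ.+ 1 ℚ./ suc r) ℚ.* ℕ→ℚ (suc r) ℚ.* ℕ→ℚ d
    right = begin
      ℕ→ℚ (2 * p * opt) ≡⟨ ℕ→ℚ-* (2 * p) opt ⟩
      ℕ→ℚ (2 * p) ℚ.* ℕ→ℚ opt ≡⟨ cong (ℚ._* ℕ→ℚ opt) ratio-d ⟨
      ratio ℚ.* ℕ→ℚ d ℚ.* ℕ→ℚ opt ≡⟨ ℚ.*-identityʳ _ ⟨
      ratio ℚ.* ℕ→ℚ d ℚ.* ℕ→ℚ opt ℚ.* 1ℚ ≡⟨ cong (ratio ℚ.* ℕ→ℚ d ℚ.* ℕ→ℚ opt ℚ.*_) (unit-fraction r) ⟨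
      ratio ℚ.* ℕ→ℚ d ℚ.* ℕ→ℚ opt ℚ.* ((ℤ.+ 1 ℚ./ suc r) ℚ.* ℕ→ℚ (suc r))
        ≡⟨ solve 5 (λ b d o u s → b :* d :* o :* (u :* s) := b :* o :* u :* s :* d) refl
             ratio (ℕ→ℚ d) (ℕ→ℚ opt) (ℤ.+ 1 ℚ./ suc r) (ℕ→ℚ (suc r)) ⟩
      ratio ℚ.* ℕ→ℚ opt ℚ.* (ℤ.+ 1 ℚ./ suc r) ℚ.* ℕ→ℚ (suc r) ℚ.* ℕ→ℚ d ∎
      where open ≡-Reasoning

-- Encoding of instances

digitsOf : ℕᵇ → List Bool
digitsOf Bin.zero     = []
digitsOf Bin.2[1+ b ] = false ∷ digitsOf b
digitsOf Bin.1+[2 b ] = true ∷ digitsOf b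

encode-digits : ∀ b → enc bitsT (digitsOf b) ≡ encodeℕᵇ b
encode-digits Bin.zero     = refl
encode-digits Bin.2[1+ b ] = cong (encodeBool false ∙_) (encode-digits b)
encode-digits Bin.1+[2 b ] = cong (encodeBool true ∙_) (encode-digits b)

value-digitsOf : ∀ b → digitsValue (digitsOf b) ≡ Bin.toℕ b
value-digitsOf Bin.zero     = refl
value-digitsOf Bin.2[1+ b ] rewrite value-digitsOf b = shape (Bin.toℕ b)
  where
  shape : ∀ n → 2 + (n + n) ≡ 2 * suc n
  shape = solve-∀
value-digitsOf Bin.1+[2 b ] rewrite value-digitsOf b = shape (Bin.toℕ b)
  where
  shape : ∀ n → 1 + (n + n) ≡ suc (2 * n)
  shape = solve-∀

digits : ℕ → List Bool
digits n = digitsOf (Bin.fromℕ n)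

value-digits : ∀ n → digitsValue (digits n) ≡ n
value-digits n = trans (value-digitsOf (Bin.fromℕ n)) (Bin.toℕ-fromℕ n)

-- Capping after every digit agrees with capping once at the end: when the higher digits have
-- reached `n`, doubling cannot bring the value below `n` again.
unary-value : ∀ n ds → unary n ds ≡ n ⊓ digitsValue ds
unary-value n []       = sym (⊓-zeroʳ n)
unary-value n (d ∷ ds) = trans (step-value d) (capped (if d then 1 else 2))
  where
  v = digitsValue ds
  step-value : ∀ d → n ⊓ (if d then suc (unary n ds + unary n ds) else suc (suc (unary n ds + unary n ds)))
                   ≡ n ⊓ ((if d then 1 else 2) + ((n ⊓ v) + (n ⊓ v)))
  step-value true  = cong (λ u → n ⊓ suc (u + u)) (unary-value n ds)
  step-value false = cong (λ u → n ⊓ suc (suc (u + u))) (unary-value n ds)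
  capped : ∀ c → n ⊓ (c + ((n ⊓ v) + (n ⊓ v))) ≡ n ⊓ (c + (v + v))
  capped c with ≤-total n v
  ... | inj₂ v≤n = cong (λ u → n ⊓ (c + (u + u))) (m≥n⇒m⊓n≡n v≤n)
  ... | inj₁ n≤v = trans (m≤n⇒m⊓n≡m (subst (λ u → n ≤ c + (u + u)) (sym (m≤n⇒m⊓n≡m n≤v)) (≤-trans (m≤m+n n n) (m≤n+m _ c))))
                         (sym (m≤n⇒m⊓n≡m (≤-trans n≤v (≤-trans (m≤m+n v v) (m≤n+m _ c)))))

position : List Bool → ℕ → Bool
position xs v = firstBit (iter v rest xs)

iter-shift : ∀ {A : Set} (f : A → A) v x → iter (suc v) f x ≡ iter v f (f x)
iter-shift f zero    x = refl
iter-shift f (suc v) x = cong f (iter-shift f v x)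

position-suc : ∀ x xs v → position (x ∷ xs) (suc v) ≡ position xs v
position-suc x xs v = cong firstBit (iter-shift rest v (x ∷ xs))

position-lookup : ∀ {n} (S : Subset.Subset n) v → position (toList S) (toℕ v) ≡ lookup S v
position-lookup (b Vec.∷ S) Fin.zero    = refl
position-lookup (b Vec.∷ S) (Fin.suc v) = trans (position-suc b (toList S) (toℕ v)) (position-lookup S v)

terminals-downFrom : ∀ xs → terminals xs ≡ filterᵇ (position xs) (downFrom (length xs))
terminals-downFrom xs = cong (filterᵇ (position xs)) (trans (cong (map pred) (range-spec (length xs)))
  (trans (sym (List.map-∘ (downFrom (length xs)))) (List.map-id (downFrom (length xs)))))

downFrom-suc : ∀ n → downFrom (suc n) ≡ map suc (downFrom n) ++ 0 ∷ []
downFrom-suc zero    = refl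
downFrom-suc (suc n) = cong (suc n ∷_) (downFrom-suc n)

length-terminals : ∀ {n} (S : Subset.Subset n) → length (terminals (toList S)) ≡ Subset.∣ S ∣
length-terminals S = trans (cong length (terminals-downFrom (toList S)))
  (trans (length-filterᵇ (position (toList S)) (downFrom (length (toList S)))) (count S))
  where
  count : ∀ {n} (S : Subset.Subset n) →
    total (λ v → indicator (position (toList S) v)) (downFrom (length (toList S))) ≡ Subset.∣ S ∣
  count Vec.[]       = refl
  count (b Vec.∷ S) = begin
    total f (downFrom (suc l)) ≡⟨ cong (total f) (downFrom-suc l) ⟩
    total f (map suc (downFrom l) ++ 0 ∷ []) ≡⟨ total-++ f (map suc (downFrom l)) (0 ∷ []) ⟩
    total f (map suc (downFrom l)) + (indicator b + 0) ≡⟨ cong₂ _+_ (total-map f suc (downFrom l)) (+-identityʳ (indicator b)) ⟩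
    total (λ v → f (suc v)) (downFrom l) + indicator b
      ≡⟨ cong (_+ indicator b) (trans (total-cong (downFrom l) λ v _ → cong indicator (position-suc b (toList S) v)) (count S)) ⟩
    Subset.∣ S ∣ + indicator b ≡⟨ head-count b ⟩
    Subset.∣ b Vec.∷ S ∣ ∎
    where
    open ≡-Reasoning
    l = length (toList S)
    f : ℕ → ℕ
    f v = indicator (position (b ∷ toList S) v)
    head-count : ∀ b → Subset.∣ S ∣ + indicator b ≡ Subset.∣ b Vec.∷ S ∣
    head-count true  = +-comm Subset.∣ S ∣ 1
    head-count false = +-identityʳ Subset.∣ S ∣

unique-terminals : ∀ xs → Unique (terminals xs)
unique-terminals xs = subst Unique (sym (terminals-downFrom xs))
  (Unique.filter⁺ (λ v → T? (position xs v)) (Unique.downFrom⁺ (length xs)))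

∈-terminals⁺ : ∀ {n} (S : Subset.Subset n) {v} → v Subset.∈ S → toℕ v ∈ terminals (toList S)
∈-terminals⁺ S {v} v∈ = subst (toℕ v ∈_) (sym (terminals-downFrom (toList S)))
  (∈-filterᵇ⁺ (position (toList S)) (∈-downFrom⁺ (subst (toℕ v <_) (sym (Vec.length-toList S)) (Fin.toℕ<n v)))
    (trans (position-lookup S v) (Vec.[]=⇒lookup v∈)))

∈-terminals⁻ : ∀ {n} (S : Subset.Subset n) {x} → x ∈ terminals (toList S) → ∃[ v ] toℕ v ≡ x × v Subset.∈ S
∈-terminals⁻ S {x} x∈ with ∈-filterᵇ⁻ (position (toList S)) (subst (x ∈_) (terminals-downFrom (toList S)) x∈)
... | x∈downFrom , marked = v , toℕ-v , lookup⇒[]= v S (trans (sym (position-lookup S v)) (trans (cong (position (toList S)) toℕ-v) marked))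
  where
  x<n = subst (x <_) (Vec.length-toList S) (∈-downFrom⁻ x∈downFrom)
  v = Fin.fromℕ< x<n
  toℕ-v : toℕ v ≡ x
  toℕ-v = Fin.toℕ-fromℕ< x<n

toList-tabulate : ∀ {A : Set} {n} (f : Fin n → A) → toList (Vec.tabulate f) ≡ map f (allFin n)
toList-tabulate {n = n} f = trans (go n f) (sym (List.map-tabulate id f))
  where
  go : ∀ n (f : Fin n → _) → toList (Vec.tabulate f) ≡ tabulate f
  go zero    f = refl
  go (suc n) f = cong (f Fin.zero ∷_) (go n (λ i → f (Fin.suc i)))

total-filterᵇ : ∀ {A : Set} (p r : A → Bool) xs →
  total (λ x → indicator (r x)) (filterᵇ p xs) ≡ total (λ x → indicator (p x ∧ r x)) xs
total-filterᵇ p r []       = refl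
total-filterᵇ p r (x ∷ xs) with p x
... | true  = cong (indicator (r x) +_) (total-filterᵇ p r xs)
... | false = total-filterᵇ p r xs

injection-count : ∀ {n ℓ} (p : Fin n → Bool) (g : Fin ℓ → Fin n) → (∀ {i j} → g i ≡ g j → i ≡ j) →
  (∀ i → p (g i) ≡ true) → ℓ ≤ total (λ e → indicator (p e)) (allFin n)
injection-count {n} {ℓ} p g inj ok with unique-⊆⇒↭ (Unique.map⁺ inj (Unique.allFin⁺ ℓ)) (All.tabulate inside)
  where
  inside : ∀ {e} → e ∈ map g (allFin ℓ) → e ∈ filterᵇ p (allFin n)
  inside e∈ with ∈-map⁻ g e∈
  ... | i , _ , refl = ∈-filterᵇ⁺ p (∈-allFin (g i)) (ok i)
... | zs , perm = begin
  ℓ ≡⟨ List.length-tabulate {n = ℓ} id ⟨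
  length (allFin ℓ) ≡⟨ List.length-map g (allFin ℓ) ⟨
  length (map g (allFin ℓ)) ≤⟨ m≤m+n _ (length zs) ⟩
  length (map g (allFin ℓ)) + length zs ≡⟨ List.length-++ (map g (allFin ℓ)) ⟨
  length (map g (allFin ℓ) ++ zs) ≡⟨ Perm.↭-length perm ⟨
  length (filterᵇ p (allFin n)) ≡⟨ length-filterᵇ p (allFin n) ⟩
  total (λ e → indicator (p e)) (allFin n) ∎
  where open ≤-Reasoning

quotient : ℕ → ℕ → ℕ
quotient a zero    = 0
quotient a (suc b) = a / suc b

quotient-exact : ∀ {a b} → 0 < b → b ∣ a → quotient a b * b ≡ a
quotient-exact {a} {suc b} _ b∣a = m/n*n≡m b∣a

-- An instance as seen by the algorithm

module Problem (I : Instance) where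
  open Instance I hiding (T)

  S : Subset.Subset #V
  S = Instance.T I

  rawEdge : Fin #E → ⟦ rawEdgeT ⟧
  rawEdge e = (digits (toℕ (proj₁ (ends e))) , digits (toℕ (proj₂ (ends e))))
            , (digits ℤ.∣ ↥ cost e ∣ , digits (↧ₙ cost e))

  rawInput : ⟦ inputT ⟧
  rawInput = toList S , (map rawEdge (allFin #E) , digits k)

  encode-map : ∀ {A : Set} {B} {f : ⟦ B ⟧ → Tree} {f′ : A → Tree} (g : A → ⟦ B ⟧) → (∀ x → f (g x) ≡ f′ x) →
    ∀ xs → encodeList f (map g xs) ≡ encodeList f′ xs
  encode-map g eq []       = refl
  encode-map {B = B} g eq (x ∷ xs) = cong₂ _∙_ (eq x) (encode-map {B = B} g eq xs)

  encode-input : enc inputT rawInput ≡ encodeInstance I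
  encode-input = cong (encodeSubset S ∙_) (cong₂ _∙_
    (encode-map {B = rawEdgeT} rawEdge (λ e → cong₂ _∙_
      (cong₂ _∙_ (number (toℕ (proj₁ (ends e)))) (number (toℕ (proj₂ (ends e)))))
      (cong₂ _∙_ (number ℤ.∣ ↥ cost e ∣) (number (↧ₙ cost e)))) (allFin #E))
    (number k))
    where
    number : ∀ n → enc bitsT (digits n) ≡ encodeℕ n
    number n = encode-digits (Bin.fromℕ n)

  edgeIds : List (Fin #E)
  edgeIds = allFin #E

  dat : Fin #E → ⟦ edgeT ⟧
  dat e = readEdge (length (toList S)) (rawEdge e)

  vertex-read : ∀ v → unary (length (toList S)) (digits (toℕ v)) ≡ toℕ {#V} v
  vertex-read v = trans (unary-value (length (toList S)) (digits (toℕ v)))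
    (trans (cong (length (toList S) ⊓_) (value-digits (toℕ v)))
      (m≥n⇒m⊓n≡n (<⇒≤ (subst (toℕ v <_) (sym (Vec.length-toList S)) (Fin.toℕ<n v)))))

  dat-ends : ∀ e → proj₁ (dat e) ≡ (toℕ (proj₁ (ends e)) , toℕ (proj₂ (ends e)))
  dat-ends e = cong₂ _,_ (vertex-read (proj₁ (ends e))) (vertex-read (proj₂ (ends e)))

  -- A common denominator that turns all costs into integers; it occurs in the analysis only.
  D : ℕ
  D = product (map (λ e → ↧ₙ cost e) edgeIds)

  D>0 : 0 < D
  D>0 = >-nonZero⁻¹ D {{product≢0 (All.tabulate den≢0)}}
    where
    den≢0 : ∀ {n} → n ∈ map (λ e → ↧ₙ cost e) edgeIds → NonZero n
    den≢0 n∈ with ∈-map⁻ (λ e → ↧ₙ cost e) n∈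
    ... | e , _ , refl = _

  denominator-∣ : ∀ e → ↧ₙ cost e ∣ D
  denominator-∣ e = ∈⇒∣product (∈-map⁺ (λ e → ↧ₙ cost e) (∈-allFin e))

  price : ⟦ costT ⟧ → ℕ
  price c = numerator c * quotient D (denominator c)

  priced-∣ : ∀ c → 0 < denominator c → denominator c ∣ D → Priced D c (price c)
  priced-∣ c pos den∣D = pos , trans (cong (numerator c *_) (sym (quotient-exact pos den∣D)))
                                     (sym (*-assoc (numerator c) (quotient D (denominator c)) (denominator c)))

  priced : ∀ e → Priced D (proj₂ (dat e)) (price (proj₂ (dat e)))
  priced e = priced-∣ (proj₂ (dat e)) (subst (0 <_) (sym den) (s≤s z≤n)) (subst (_∣ D) (sym den) (denominator-∣ e))
    where
    den : denominator (proj₂ (dat e)) ≡ ↧ₙ cost e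
    den = value-digits (↧ₙ cost e)

  zero-priced : Priced D zeroCost (price zeroCost)
  zero-priced = s≤s z≤n , refl

  cost-scaled : ∀ e → cost e ℚ.* ℕ→ℚ D ≡ ℕ→ℚ (price (proj₂ (dat e)))
  cost-scaled e = begin
    cost e ℚ.* ℕ→ℚ D ≡⟨ cong (λ n → cost e ℚ.* ℕ→ℚ n) (trans (sym (quotient-exact (s≤s z≤n) (denominator-∣ e))) (*-comm (quotient D den) den)) ⟩
    cost e ℚ.* ℕ→ℚ (den * quotient D den) ≡⟨ cong (cost e ℚ.*_) (ℕ→ℚ-* den (quotient D den)) ⟩
    cost e ℚ.* (ℕ→ℚ den ℚ.* ℕ→ℚ (quotient D den)) ≡⟨ ℚ.*-assoc (cost e) (ℕ→ℚ den) (ℕ→ℚ (quotient D den)) ⟨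
    cost e ℚ.* ℕ→ℚ den ℚ.* ℕ→ℚ (quotient D den) ≡⟨ cong (ℚ._* ℕ→ℚ (quotient D den)) (*-denominator (cost e) (cost≥0 e)) ⟩
    ℕ→ℚ num ℚ.* ℕ→ℚ (quotient D den) ≡⟨ ℕ→ℚ-* num (quotient D den) ⟨
    ℕ→ℚ (num * quotient D den) ≡⟨ cong₂ (λ a b → ℕ→ℚ (a * quotient D b)) (value-digits num) (value-digits den) ⟨
    ℕ→ℚ (price (proj₂ (dat e))) ∎
    where
    open ≡-Reasoning
    num = ℤ.∣ ↥ cost e ∣
    den = ↧ₙ cost e

  R₀ : List ℕ
  R₀ = terminals (toList S)

  -- Capping `k` at one more than the number of edges caps `k ∸ 1` at the number of edges, which no
  -- cut can exceed anyway.
  K : ℕ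
  K = unary (suc (length (map rawEdge edgeIds))) (digits k) ∸ 1

  K≡ : K ≡ #E ⊓ (k ∸ 1)
  K≡ = trans (cong (_∸ 1) (trans (unary-value _ (digits k)) (cong₂ (λ a b → suc a ⊓ b)
         (trans (List.length-map rawEdge edgeIds) (List.length-tabulate {n = #E} id)) (value-digits k))))
       (pred-⊓ k)
    where
    pred-⊓ : ∀ k → (suc #E ⊓ k) ∸ 1 ≡ #E ⊓ (k ∸ 1)
    pred-⊓ zero    = sym (⊓-zeroʳ #E)
    pred-⊓ (suc k) = refl

  K≤ : K ≤ k ∸ 1
  K≤ = ≤-trans (≤-reflexive K≡) (m⊓n≤n #E (k ∸ 1))

  splits-dat : ∀ Y e → splits Y (proj₁ (dat e)) ≡ Y (toℕ (proj₁ (ends e))) xor Y (toℕ (proj₂ (ends e)))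
  splits-dat Y e = cong (splits Y) (dat-ends e)

  PairCut : (Fin #E → Bool) → Set
  PairCut inF = ∀ s t → s ∈ R₀ → t ∈ R₀ → s ≢ t →
    ∃[ Y ] Y s ≡ true × Y t ≡ false × total (λ e → indicator (not (inF e) ∧ splits Y (proj₁ (dat e)))) edgeIds ≤ K

  -- When all edges are removed nothing is left to cross a cut. This instance supplies the path
  -- bound, which involves no comparison of costs.
  everything-cuts : PairCut (λ _ → true)
  everything-cuts s t _ _ s≢t = (_≡ᵇ s) , ≡ᵇ-refl s , ≡ᵇ-false (λ t≡s → s≢t (sym t≡s))
    , ≤-trans (≤-reflexive (total-0 edgeIds λ _ _ → refl)) z≤n

  -- Feasibility rules out `k` disjoint paths, so Menger's theorem yields a cut with at most `k ∸ 1`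
  -- remaining edges; the number of all edges gives the other half of the minimum `K`.
  feasible-cuts : ∀ F → Feasible I F → PairCut (lookup F)
  feasible-cuts F feasible s t s∈ t∈ s≢t with ∈-terminals⁻ S s∈ | ∈-terminals⁻ S t∈
  ... | u , refl , u∈ | v , refl , v∈ = from-menger (Menger.menger graph (Subset.∁ F) u≢v (k ∸ 1))
    where
    u≢v : u ≢ v
    u≢v u≡v = s≢t (cong toℕ u≡v)
    from-menger : _ → ∃[ Y ] Y (toℕ u) ≡ true × Y (toℕ v) ≡ false
      × total (λ e → indicator (not (lookup F e) ∧ splits Y (proj₁ (dat e)))) edgeIds ≤ K
    from-menger (inj₂ (P , disjoint)) = contradiction
      (ℕ→ℚ-cancel {suc (k ∸ 1)} {k ∸ 1} (feasible u v u∈ v∈ u≢v (suc (k ∸ 1)) P disjoint)) 1+n≰n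
    from-menger (inj₁ (Y , Yu , Yv , few)) = Y , Yu , Yv
      , ≤-trans (⊓-glb (≤-trans (total≤length _ edgeIds) (≤-reflexive (List.length-tabulate {n = #E} id))) (≤-trans (≤-reflexive same) few))
                (≤-reflexive (sym K≡))
      where
      same : total (λ e → indicator (not (lookup F e) ∧ splits Y (proj₁ (dat e)))) edgeIds
           ≡ total (λ e → indicator (Menger.crosses graph (Subset.∁ F) Y e)) (Menger.present graph (Subset.∁ F))
      same = trans (total-cong edgeIds λ e _ → cong indicator (cong₂ _∧_ (sym (Vec.lookup-map e not F)) (splits-dat Y e)))
                   (sym (total-filterᵇ (lookup (Subset.∁ F)) (Menger.crosses graph (Subset.∁ F) Y) edgeIds))

  xor-irrefl : ∀ b → b xor b ≡ false
  xor-irrefl true  = refl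
  xor-irrefl false = refl

  xor-comm : ∀ b c → b xor c ≡ c xor b
  xor-comm true  true  = refl
  xor-comm true  false = refl
  xor-comm false true  = refl
  xor-comm false false = refl

  walk-crosses : ∀ {A} (Y : ℕ → Bool) {u v} (w : Walk graph A u v) → (Y (toℕ u) xor Y (toℕ v)) ≡ true →
    ∃[ e ] e ∈ edges graph w × e Subset.∈ A × splits Y (proj₁ (dat e)) ≡ true
  walk-crosses Y {u} stop eq = ⊥-elim (true≢false eq (xor-irrefl (Y (toℕ u))))
  walk-crosses {A} Y {u} {v} (step {v = x} e e∈ joins w) eq = by-side (Y (toℕ u) xor Y (toℕ x)) refl
    where
    crossed : ∀ {x} → Joins graph e u x → splits Y (proj₁ (dat e)) ≡ Y (toℕ u) xor Y (toℕ x)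
    crossed (inj₁ refl) = splits-dat Y e
    crossed {x} (inj₂ refl) = trans (splits-dat Y e) (xor-comm (Y (toℕ x)) (Y (toℕ u)))
    same-side : ∀ {b c d} → b xor c ≡ false → b xor d ≡ true → c xor d ≡ true
    same-side {true}  {true}  _ eq = eq
    same-side {false} {false} _ eq = eq
    by-side : ∀ b → (Y (toℕ u) xor Y (toℕ x)) ≡ b →
      ∃[ e′ ] e′ ∈ e ∷ edges graph w × e′ Subset.∈ A × splits Y (proj₁ (dat e′)) ≡ true
    by-side true  side = e , here refl , e∈ , trans (crossed joins) side
    by-side false side with walk-crosses Y w (same-side {Y (toℕ u)} side eq)
    ... | e′ , e′∈ , e′∈A , cross = e′ , there e′∈ , e′∈A , cross

  -- The easy half of Menger's theorem: each path crosses `Y` somewhere, and edge-disjoint paths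
  -- cross at different edges.
  few-paths : ∀ F Y {s t} → (Y (toℕ s) xor Y (toℕ t)) ≡ true → ∀ ℓ (P : Fin ℓ → Path graph (Subset.∁ F) s t) →
    EdgeDisjoint graph P → ℓ ≤ total (λ e → indicator (not (lookup F e) ∧ splits Y (proj₁ (dat e)))) edgeIds
  few-paths F Y sep ℓ P disjoint = injection-count (λ e → not (lookup F e) ∧ splits Y (proj₁ (dat e))) g injective ok
    where
    crossing : ∀ i → ∃[ e ] e ∈ edges graph (proj₁ (P i)) × e Subset.∈ Subset.∁ F × splits Y (proj₁ (dat e)) ≡ true
    crossing i = walk-crosses Y (proj₁ (P i)) sep
    g : Fin ℓ → Fin #E
    g i = proj₁ (crossing i)
    injective : ∀ {i j} → g i ≡ g j → i ≡ j
    injective {i} {j} eq with i Fin.≟ j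
    ... | yes i≡j = i≡j
    ... | no i≢j  = ⊥-elim (disjoint i j i≢j
      (proj₁ (proj₂ (crossing i)) , subst (_∈ edges graph (proj₁ (P j))) (sym eq) (proj₁ (proj₂ (crossing j)))))
    ok : ∀ i → not (lookup F (g i)) ∧ splits Y (proj₁ (dat (g i))) ≡ true
    ok i = cong₂ _∧_ (trans (sym (Vec.lookup-map (g i) not F)) (Vec.[]=⇒lookup (proj₁ (proj₂ (proj₂ (crossing i))))))
                     (proj₂ (proj₂ (proj₂ (crossing i))))

solution-map : ∀ {A B : Set} p q N K R (g : B → ⟦ edgeT ⟧) (f : A → B) xs →
  solution p q N K (map g (map f xs)) R ≡ map (λ x → selected N (rounds p q N K (map (λ x → g (f x)) xs) R) (g (f x))) xs
solution-map p q N K R g f xs = trans (cong (λ es → solution p q N K es R) (sym (List.map-∘ xs)))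
                                      (sym (List.map-∘ xs))

-- The approximation guarantee

module Solution (I : Instance) (γ : ℚ) (2<γ : 2ℚ ℚ.< γ) where
  open Instance I using (graph; #E; #V; cost; k; #terminals)
  open Problem I
  open Ratio γ 2<γ

  N : ℕ
  N = scaleN p q (length (map rawEdge edgeIds))

  N≡ : N ≡ suc (suc (p * length edgeIds))
  N≡ = cong (λ m → suc (suc (p * m))) (List.length-map rawEdge edgeIds)

  module A = Analysis p q d p≡ q>0 edgeIds dat D D>0 price priced zero-priced K N N≡

  cuts : List ⟦ cutT ⟧
  cuts = rounds p q N K A.es R₀

  F : Subset.Subset #E
  F = Vec.tabulate (λ e → selected N cuts (dat e))

  lookup-F : ∀ e → lookup F e ≡ selected N cuts (dat e)
  lookup-F e = Vec.lookup∘tabulate (λ e → selected N cuts (dat e)) e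

  output : enc bitsT (algorithm p q rawInput) ≡ encodeSubset F
  output = cong (enc bitsT) (trans (solution-map p q N K R₀ (readEdge (length (toList S))) rawEdge edgeIds)
                                   (sym (toList-tabulate (λ e → selected N cuts (dat e)))))

  separation : ∀ {s t} → s ∈ R₀ → t ∈ R₀ → s ≢ t → ∃[ Y ] (Y s xor Y t) ≡ true
    × q * total (λ e → indicator (not (selected N cuts (dat e)) ∧ splits Y (proj₁ (dat e)))) edgeIds ≤ p * K
  separation s∈ t∈ s≢t = from-result Run₀.result
    where
    module Run₀ = A.Run (λ _ → true) R₀ everything-cuts (unique-terminals (toList S))
    from-result : ∃[ R ] Run₀.State R cuts × length R ≤ 1 → _
    from-result (R , st , short) = Run₀.separation R cuts st short s∈ t∈ s≢t

  path-bound : LeavesAtMost I (γ ℚ.* ℕ→ℚ (k ∸ 1)) F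
  path-bound s t s∈ t∈ s≢t ℓ P disjoint = from-separation
    (separation (∈-terminals⁺ S s∈) (∈-terminals⁺ S t∈) (λ eq → s≢t (Fin.toℕ-injective eq)))
    where
    from-separation : ∃[ Y ] (Y (toℕ s) xor Y (toℕ t)) ≡ true
      × q * total (λ e → indicator (not (selected N cuts (dat e)) ∧ splits Y (proj₁ (dat e)))) edgeIds ≤ p * K →
      ℕ→ℚ ℓ ℚ.≤ γ ℚ.* ℕ→ℚ (k ∸ 1)
    from-separation (Y , sep , few) = ℚ.*-cancelʳ-≤-pos (ℕ→ℚ q) {{ℕ→ℚ-pos q>0}}
      (subst₂ ℚ._≤_ (ℕ→ℚ-* ℓ q) right (ℕ→ℚ-mono {ℓ * q} {p * (k ∸ 1)} bounded))
      where
      bounded : ℓ * q ≤ p * (k ∸ 1)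
      bounded = begin
        ℓ * q ≡⟨ *-comm ℓ q ⟩
        q * ℓ ≤⟨ *-monoʳ-≤ q (few-paths F Y sep ℓ P disjoint) ⟩
        q * total (λ e → indicator (not (lookup F e) ∧ splits Y (proj₁ (dat e)))) edgeIds
        ≡⟨ cong (q *_) (total-cong edgeIds λ e _ → cong (λ b → indicator (not b ∧ splits Y (proj₁ (dat e)))) (lookup-F e)) ⟩
        q * total (λ e → indicator (not (selected N cuts (dat e)) ∧ splits Y (proj₁ (dat e)))) edgeIds ≤⟨ few ⟩
        p * K ≤⟨ *-monoʳ-≤ p K≤ ⟩
        p * (k ∸ 1) ∎
        where open ≤-Reasoning
      right : ℕ→ℚ (p * (k ∸ 1)) ≡ γ ℚ.* ℕ→ℚ (k ∸ 1) ℚ.* ℕ→ℚ q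
      right = begin
        ℕ→ℚ (p * (k ∸ 1)) ≡⟨ ℕ→ℚ-* p (k ∸ 1) ⟩
        ℕ→ℚ p ℚ.* ℕ→ℚ (k ∸ 1) ≡⟨ cong (ℚ._* ℕ→ℚ (k ∸ 1)) γq≡p ⟨
        γ ℚ.* ℕ→ℚ q ℚ.* ℕ→ℚ (k ∸ 1) ≡⟨ trans (ℚ.*-assoc γ _ _) (trans (cong (γ ℚ.*_) (ℚ.*-comm (ℕ→ℚ q) (ℕ→ℚ (k ∸ 1)))) (sym (ℚ.*-assoc γ _ _))) ⟩
        γ ℚ.* ℕ→ℚ (k ∸ 1) ℚ.* ℕ→ℚ q ∎
        where open ≡-Reasoning

  cost-of : ∀ F′ (f : Fin #E → Bool) → (∀ e → lookup F′ e ≡ f e) →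
    totalCost I F′ ℚ.* ℕ→ℚ D ≡ ℕ→ℚ (total (λ e → if f e then A.C e else 0) edgeIds)
  cost-of F′ f same = sum-scaled D #E id (λ e → if lookup F′ e then cost e else 0ℚ) (λ e → if f e then A.C e else 0) each
    where
    by-flag : ∀ e b → (if b then cost e else 0ℚ) ℚ.* ℕ→ℚ D ≡ ℕ→ℚ (if b then A.C e else 0)
    by-flag e true  = cost-scaled e
    by-flag e false = ℚ.*-zeroˡ (ℕ→ℚ D)
    each : ∀ e → (if lookup F′ e then cost e else 0ℚ) ℚ.* ℕ→ℚ D ≡ ℕ→ℚ (if f e then A.C e else 0)
    each e = trans (cong (λ b → (if b then cost e else 0ℚ) ℚ.* ℕ→ℚ D) (same e)) (by-flag e (f e))

  module Against (F⋆ : Subset.Subset #E) (feasible : Feasible I F⋆) where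
    module R⋆ = A.Run (lookup F⋆) R₀ (feasible-cuts F⋆ feasible) (unique-terminals (toList S))

    B : ℚ
    B = ratio ℚ.* ℕ→ℚ R⋆.optimum

    B≥0 : 0ℚ ℚ.≤ B
    B≥0 = subst (ℚ._≤ B) (ℚ.*-zeroˡ (ℕ→ℚ R⋆.optimum))
      (ℚ.*-monoʳ-≤-nonNeg (ℕ→ℚ R⋆.optimum) {{ℕ→ℚ-nonNeg R⋆.optimum}} ratio≥0)

    B-harmonic≥0 : ∀ r → 0ℚ ℚ.≤ B ℚ.* harmonic r
    B-harmonic≥0 r = subst (ℚ._≤ B ℚ.* harmonic r) (ℚ.*-zeroʳ B)
      (ℚ.*-monoˡ-≤-nonNeg B {{ℚ.nonNegative B≥0}} (harmonic≥0 r))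

    -- The log begins with the last cut, the one among the fewest terminals, so the harmonic sum is
    -- built from its large terms on. The terms up to `1 / r` belong to no cut of the log; adding
    -- them on the left lets each cut supply the next term.
    schedule-cost : ∀ r log → R⋆.Schedule r log →
      ℕ→ℚ (total A.cutCost log) ℚ.+ B ℚ.* harmonic r ℚ.≤ B ℚ.* harmonic (r + length log)
    schedule-cost r []        _ = ℚ.≤-reflexive (trans (ℚ.+-identityˡ (B ℚ.* harmonic r))
      (cong (λ n → B ℚ.* harmonic n) (sym (+-identityʳ r))))
    schedule-cost r (c ∷ log) (share , sched) = begin
      ℕ→ℚ (A.cutCost c + total A.cutCost log) ℚ.+ B ℚ.* harmonic r ≡⟨ cong (ℚ._+ B ℚ.* harmonic r) (ℕ→ℚ-+ (A.cutCost c) (total A.cutCost log)) ⟩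
      (x ℚ.+ y) ℚ.+ B ℚ.* harmonic r ≤⟨ ℚ.+-monoˡ-≤ (B ℚ.* harmonic r) (ℚ.+-monoˡ-≤ y (round-share r (A.cutCost c) R⋆.optimum share)) ⟩
      (B ℚ.* u ℚ.+ y) ℚ.+ B ℚ.* harmonic r ≡⟨ rearrange B u y (harmonic r) ⟩
      y ℚ.+ B ℚ.* (harmonic r ℚ.+ u) ≤⟨ schedule-cost (suc r) log sched ⟩
      B ℚ.* harmonic (suc r + length log) ≡⟨ cong (λ n → B ℚ.* harmonic n) (+-suc r (length log)) ⟨
      B ℚ.* harmonic (r + suc (length log)) ∎
      where
      open ℚ.≤-Reasoning
      open ℚ.+-*-Solver
      x y u : ℚ
      x = ℕ→ℚ (A.cutCost c)
      y = ℕ→ℚ (total A.cutCost log)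
      u = ℤ.+ 1 ℚ./ suc r
      rearrange : ∀ b u y h → (b ℚ.* u ℚ.+ y) ℚ.+ b ℚ.* h ≡ y ℚ.+ b ℚ.* (h ℚ.+ u)
      rearrange = solve 4 (λ b u y h → (b :* u :+ y) :+ b :* h := y :+ b :* (h :+ u)) refl

    cuts-cost : ℕ→ℚ (total A.cutCost cuts) ℚ.≤ B ℚ.* harmonic #terminals
    cuts-cost = from-result R⋆.result
      where
      from-result : ∃[ R ] R⋆.State R cuts × length R ≤ 1 → ℕ→ℚ (total A.cutCost cuts) ℚ.≤ B ℚ.* harmonic #terminals
      from-result (R , st , _) = begin
        ℕ→ℚ (total A.cutCost cuts) ≡⟨ ℚ.+-identityʳ (ℕ→ℚ (total A.cutCost cuts)) ⟨
        ℕ→ℚ (total A.cutCost cuts) ℚ.+ 0ℚ ≤⟨ ℚ.+-monoʳ-≤ (ℕ→ℚ (total A.cutCost cuts)) (B-harmonic≥0 (length R)) ⟩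
        ℕ→ℚ (total A.cutCost cuts) ℚ.+ B ℚ.* harmonic (length R) ≤⟨ schedule-cost (length R) cuts (R⋆.State.sched st) ⟩
        B ℚ.* harmonic (length R + length cuts) ≡⟨ cong (λ n → B ℚ.* harmonic n) (trans (R⋆.State.lengths st) (length-terminals S)) ⟩
        B ℚ.* harmonic #terminals ∎
        where open ℚ.≤-Reasoning

    cost-bound : totalCost I F ℚ.≤ ratio ℚ.* harmonic #terminals ℚ.* totalCost I F⋆
    cost-bound = ℚ.*-cancelʳ-≤-pos (ℕ→ℚ D) {{ℕ→ℚ-pos D>0}} (begin
      totalCost I F ℚ.* ℕ→ℚ D ≡⟨ cost-of F (λ e → selected N cuts (dat e)) lookup-F ⟩
      ℕ→ℚ (total (λ e → if selected N cuts (dat e) then A.C e else 0) edgeIds)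
        ≤⟨ ℕ→ℚ-mono {total (λ e → if selected N cuts (dat e) then A.C e else 0) edgeIds} {total A.cutCost cuts} (R⋆.chosen-cost cuts) ⟩
      ℕ→ℚ (total A.cutCost cuts) ≤⟨ cuts-cost ⟩
      ratio ℚ.* ℕ→ℚ R⋆.optimum ℚ.* harmonic #terminals ≡⟨ cong (λ o → ratio ℚ.* o ℚ.* harmonic #terminals) (cost-of F⋆ (lookup F⋆) (λ _ → refl)) ⟨
      ratio ℚ.* (totalCost I F⋆ ℚ.* ℕ→ℚ D) ℚ.* harmonic #terminals
        ≡⟨ rearrange ratio (totalCost I F⋆) (ℕ→ℚ D) (harmonic #terminals) ⟩
      ratio ℚ.* harmonic #terminals ℚ.* totalCost I F⋆ ℚ.* ℕ→ℚ D ∎)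
      where
      open ℚ.≤-Reasoning
      open ℚ.+-*-Solver
      rearrange : ∀ r o s h → r ℚ.* (o ℚ.* s) ℚ.* h ≡ r ℚ.* h ℚ.* o ℚ.* s
      rearrange = solve 4 (λ r o s h → r :* (o :* s) :* h := r :* h :* o :* s) refl

  approximation : IsApproximation I γ (ratio ℚ.* harmonic #terminals) F
  approximation = record
    { cost-bound = λ { opt ((F⋆ , feasible , refl) , _) → Against.cost-bound F⋆ feasible }
    ; path-bound = path-bound
    }

theorem2p4 : (γ : ℚ) (2<γ : 2ℚ ℚ.< γ) →
    PolyTimeApproximation γ
    (λ r → ((2ℚ ℚ.* γ) ℚ.÷ (γ ℚ.- 2ℚ)) {{γ-2-nonZero 2<γ}} ℚ.* harmonic r)
theorem2p4 γ 2<γ = record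
  { program = prog algo 0
  ; c = coeff (time algo)
  ; d = degree (time algo)
  ; correct = λ I → solved I (run algo 0 (initial (encodeInstance I)) (Problem.rawInput I) (input≡ I))
  }
  where
  open Ratio γ 2<γ using (p; q)
  algo : PT inputT bitsT (algorithm p q)
  algo = algorithmᴾ p q
  input≡ : ∀ I → initial (encodeInstance I) 0 ≡ enc inputT (Problem.rawInput I)
  input≡ I = trans (update-same (λ _ → nil) 0 (encodeInstance I)) (sym (Problem.encode-input I))
  solved : ∀ I → Result (prog algo 0) 0 (initial (encodeInstance I)) (enc bitsT (algorithm p q (Problem.rawInput I)))
      (at (time algo) (sz inputT (Problem.rawInput I))) →
    ∃[ F ] ∃[ t ] Computes (prog algo 0) (encodeInstance I) (encodeSubset F) t
      × t ≤ coeff (time algo) * size (encodeInstance I) ^ degree (time algo) + coeff (time algo)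
      × IsApproximation I γ (Ratio.ratio γ 2<γ ℚ.* harmonic (Instance.#terminals I)) F
  solved I (σ , t , exec , t≤ , out , _) = Solution.F I γ 2<γ , t
    , (σ , exec , trans out (Solution.output I γ 2<γ))
    , (begin
        t ≤⟨ t≤ ⟩
        at (time algo) (sz inputT (Problem.rawInput I)) ≡⟨ cong (λ x → at (time algo) (size x)) (Problem.encode-input I) ⟩
        at (time algo) n ≤⟨ at≤monomial (time algo) n {{>-nonZero (size≥1 (encodeInstance I))}} ⟩
        coeff (time algo) * n ^ degree (time algo) ≤⟨ m≤m+n _ (coeff (time algo)) ⟩
        coeff (time algo) * n ^ degree (time algo) + coeff (time algo) ∎)
    , Solution.approximation I γ 2<γ
    where
    open ≤-Reasoning
    n = size (encodeInstance I)
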